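{- Let $q$ be a power of $3$. The generic lines of $PG(3,q)$ decompose into $G$-orbits as follows: for each $i\in\{1,2,4\}$ and each $r\in J_i$, there are exactly $i$ $G$-orbits of generic lines $L$ with $\jmath(f_L)=r$, each of size $|G|/i$, and every $G$-orbit of generic lines arises in this way. Consequently, the number of $G$-orbits of generic lines is $2q-3$, of which $q/3$ have size $|G|$, $q-1$ have size $|G|/2$, and $(2q-6)/3$ have size $|G|/4$.
   Context: Points of $PG(3,q)$ are written $(y_0:y_1:y_2:y_3)$. The twisted cubic is $C=\{\nu(s,t)=(s^3:s^2t:st^2:t^3):(s:t)\in PG(1,q)\}$; for a field $K\supseteq\mathbb{F}_q$, $C(K)$ denotes the analogous set of points with $(s:t)\in\mathbb{P}^1(K)$. $G=PGL_2(q)$, $|G|=q^3-q$, acts on $PG(3,q)$ by letting $g=\begin{pmatrix} a&b\\ c&d\end{pmatrix}$ act on column vectors $(y_0,y_1,y_2,y_3)^T$ by the matrix $\begin{pmatrix} a^3&0&0&b^3\\ a^2c&a(ad-bc)&-b(ad-bc)&b^2d\\ ac^2&-c(ad-bc)&d(ad-bc)&bd^2\\ c^3&0&0&d^3\end{pmatrix}$, so that $\nu(as+bt,cs+dt)$ is the image of $\nu(s,t)$. The osculating plane of $C$ at $\nu(s,t)$ is $t^3y_0-s^3y_3=0$ (characteristic $3$). A line of $PG(3,q)$ is generic if it does not meet $C(\overline{\mathbb{F}_q})$ and is not contained in any osculating plane of $C$. If $L$ is the line through distinct points $x,y$, its Plücker coordinates are $p_{ij}=x_iy_j-x_jy_i$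 ($0\le i<j\le3$), defined up to a common scalar, and its associated binary quartic form is $f_L=p_{23}X^4+p_{13}X^3Y+p_{03}X^2Y^2+p_{02}XY^3+p_{01}Y^4$. For a binary quartic form $f=z_0X^4+z_1X^3Y+z_2X^2Y^2+z_3XY^3+z_4Y^4$, $\Delta(f)=(z_0z_4-z_1z_3)^3+(z_0z_4-z_1z_3)^2z_2^2-z_2^3(z_0z_3^2+z_4z_1^2-z_0z_2z_4)$ and, when $\Delta(f)\ne0$, $\jmath(f)=z_2^6/\Delta(f)$ (for generic $L$ one has $\Delta(f_L)\neq 0$). $J_2$ is the set of non-squares of $\mathbb{F}_q^\times$; $J_4$ (resp. $J_1$) is the set of nonzero squares $r$ with $\mathrm{Tr}_{\mathbb{F}_q/\mathbb{F}_3}(1/\sqrt r)=0$ (resp. $\neq0$). -}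

module Defs where

open import Level using (Level; _⊔_)
open import Data.Nat as ℕ using (ℕ; zero; suc; NonZero)
open import Data.Product using (Σ; ∃; _×_; _,_)
open import Data.Sum using (_⊎_)
open import Data.List using (List; length)
open import Data.List.Relation.Unary.All using (All)
open import Data.List.Relation.Unary.Any using (Any)
open import Data.List.Relation.Unary.AllPairs using (AllPairs)
open import Data.List.Relation.Unary.Unique.Propositional using (Unique)
open import Data.List.Membership.Propositional using (_∈_)
open import Relation.Nullary using (¬_)
open import Relation.Binary.PropositionalEquality using (_≡_; _≢_)
open import Algebra.Structures using (IsCommutativeRing)

record Field : Set₁ where
  infixl 6 _+_
  infixl 7 _*_
  field
    Carrier    : Set
    _+_ _*_    : Carrier → Carrier → Carrier
    -_         : Carrier → Carrier
    0# 1#      : Carrier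
    isCommRing : IsCommutativeRing _≡_ _+_ _*_ -_ 0# 1#
    0≢1        : 0# ≢ 1#
    inverse    : ∀ x → x ≢ 0# → ∃ λ y → x * y ≡ 1#

record FiniteField : Set₁ where
  field
    field'   : Field
  open Field field' public
  field
    elems    : List Carrier
    unique   : Unique elems
    complete : ∀ x → x ∈ elems
  q : ℕ
  q = length elems

Char3 : FiniteField → Set
Char3 F = 1# + 1# + 1# ≡ 0#
  where open FiniteField F

-- Field homomorphisms F → K (these are the field extensions K ⊇ F)
record FieldHom (F K : Field) : Set where
  private
    module F = Field F
    module K = Field K
  field
    map   : F.Carrier → K.Carrier
    map-+ : ∀ x y → map (x F.+ y) ≡ map x K.+ map y
    map-* : ∀ x y → map (x F.* y) ≡ map x K.* map y
    map-1 : map F.1# ≡ K.1#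

record V4 (A : Set) : Set where
  constructor ⟨_,_,_,_⟩
  field c0 c1 c2 c3 : A

mapV4 : {A B : Set} → (A → B) → V4 A → V4 B
mapV4 f ⟨ a , b , c , d ⟩ = ⟨ f a , f b , f c , f d ⟩

-- Number of equivalence classes of a relation _~_ (an equivalence
-- relation in all uses below) among the elements satisfying P:
-- a list of n pairwise inequivalent representatives satisfying P
-- such that every element satisfying P is equivalent to one of them.

ClassCount : {ℓ ℓ' : Level} {A : Set} (_~_ : A → A → Set ℓ') (P : A → Set ℓ) → ℕ → Set (ℓ ⊔ ℓ')
ClassCount {A = A} _~_ P n =
  Σ (List A) λ reps →
    length reps ≡ n × All P reps ×
    AllPairs (λ a b → ¬ (a ~ b)) reps ×
    (∀ a → P a → Any (λ b → a ~ b) reps)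

module FieldOps (F : Field) where
  open Field F

  infixl 6 _-_
  _-_ : Carrier → Carrier → Carrier
  x - y = x + (- y)

  _^_ : Carrier → ℕ → Carrier
  x ^ zero  = 1#
  x ^ suc n = x * (x ^ n)

  Vec4 : Set
  Vec4 = V4 Carrier

  0v : Vec4
  0v = ⟨ 0# , 0# , 0# , 0# ⟩

  lin : Carrier → Vec4 → Carrier → Vec4 → Vec4
  lin a ⟨ x0 , x1 , x2 , x3 ⟩ b ⟨ y0 , y1 , y2 , y3 ⟩ =
    ⟨ a * x0 + b * y0 , a * x1 + b * y1 , a * x2 + b * y2 , a * x3 + b * y3 ⟩

  NonZeroPair : Carrier → Carrier → Set
  NonZeroPair s t = ¬ (s ≡ 0# × t ≡ 0#)

  ν : Carrier → Carrier → Vec4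
  ν s t = ⟨ s ^ 3 , (s ^ 2) * t , s * (t ^ 2) , t ^ 3 ⟩

  InSpan : Vec4 → Vec4 → Vec4 → Set
  InSpan x y z = ∃ λ a → ∃ λ b → z ≡ lin a x b y

  Independent : Vec4 → Vec4 → Set
  Independent x y = ∀ a b → lin a x b y ≡ 0v → a ≡ 0# × b ≡ 0#

module PG3 (F : FiniteField) where
  open FiniteField F hiding (Carrier; q)
  open FiniteField F public using (Carrier; q)
  open FieldOps field'

  record Line : Set where
    constructor line
    field
      p₁ p₂ : Vec4
      indep : Independent p₁ p₂

  -- two spanning pairs (the first one possibly not yet known to be
  -- independent) define the same line
  SameSpan : Vec4 × Vec4 → Line → Set
  SameSpan (x , y) M = InSpan x y (Line.p₁ M) × InSpan x y (Line.p₂ M)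

  SameLine : Line → Line → Set
  SameLine L M = SameSpan (Line.p₁ L , Line.p₂ L) M

  -- elements of G, represented by invertible matrices (a b ; c d)
  record GL2 : Set where
    constructor mat
    field
      a b c d : Carrier
      det≢0   : a * d - b * c ≢ 0#

  act : GL2 → Vec4 → Vec4
  act (mat a b c d _) ⟨ y0 , y1 , y2 , y3 ⟩ =
    ⟨ (a ^ 3) * y0 + (b ^ 3) * y3
    , (a ^ 2) * c * y0 + a * D * y1 - b * D * y2 + (b ^ 2) * d * y3
    , a * (c ^ 2) * y0 - c * D * y1 + d * D * y2 + b * (d ^ 2) * y3
    , (c ^ 3) * y0 + (d ^ 3) * y3 ⟩
    where D = a * d - b * c

  Orbit : Line → Line → Set
  Orbit L M = ∃ λ (g : GL2) → SameSpan (act g (Line.p₁ L) , act g (Line.p₂ L)) M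

  ∣G∣ : ℕ
  ∣G∣ = q ℕ.^ 3 ℕ.∸ q

  MeetsCurveOver : (K : Field) → FieldHom field' K → Line → Set
  MeetsCurveOver K ι L =
    ∃ λ s → ∃ λ t → K.NonZeroPair s t ×
      K.InSpan (mapV4 (FieldHom.map ι) (Line.p₁ L))
               (mapV4 (FieldHom.map ι) (Line.p₂ L)) (K.ν s t)
    where module K = FieldOps K

  InOscPlane : Carrier → Carrier → Vec4 → Set
  InOscPlane s t ⟨ y0 , _ , _ , y3 ⟩ = (t ^ 3) * y0 - (s ^ 3) * y3 ≡ 0#

  ContainedInOscPlane : Line → Set
  ContainedInOscPlane L =
    ∃ λ s → ∃ λ t → NonZeroPair s t ×
      InOscPlane s t (Line.p₁ L) × InOscPlane s t (Line.p₂ L)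

  Generic : Line → Set₁
  Generic L =
    (∀ (K : Field) (ι : FieldHom field' K) → ¬ MeetsCurveOver K ι L) ×
    ¬ ContainedInOscPlane L

  module Plücker (L : Line) where
    private
      x0 = V4.c0 (Line.p₁ L); x1 = V4.c1 (Line.p₁ L)
      x2 = V4.c2 (Line.p₁ L); x3 = V4.c3 (Line.p₁ L)
      y0 = V4.c0 (Line.p₂ L); y1 = V4.c1 (Line.p₂ L)
      y2 = V4.c2 (Line.p₂ L); y3 = V4.c3 (Line.p₂ L)
    p01 = x0 * y1 - x1 * y0
    p02 = x0 * y2 - x2 * y0
    p03 = x0 * y3 - x3 * y0
    p13 = x1 * y3 - x3 * y1
    p23 = x2 * y3 - x3 * y2

  -- coefficients z0..z4 of the binary quartic form f_L
  fL : Line → V4 Carrier × Carrier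
  fL L = ⟨ p23 , p13 , p03 , p02 ⟩ , p01
    where open Plücker L

  -- Δ of a binary quartic z0 X^4 + z1 X^3 Y + z2 X^2 Y^2 + z3 X Y^3 + z4 Y^4
  Δ : V4 Carrier × Carrier → Carrier
  Δ (⟨ z0 , z1 , z2 , z3 ⟩ , z4) =
    (w ^ 3) + (w ^ 2) * (z2 ^ 2)
      - (z2 ^ 3) * (z0 * (z3 ^ 2) + z4 * (z1 ^ 2) - z0 * z2 * z4)
    where w = z0 * z4 - z1 * z3

  JEq : V4 Carrier × Carrier → Carrier → Set
  JEq f r = Δ f ≢ 0# × (V4.c2 (Data.Product.proj₁ f) ^ 6) ≡ r * Δ f
    where import Data.Product

  -- absolute trace Tr_{F_q/F_3}, for q = 3^n:  x + x^3 + ... + x^(3^(n-1))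
  Tr : ℕ → Carrier → Carrier
  Tr zero    x = 0#
  Tr (suc k) x = Tr k x + (x ^ (3 ℕ.^ k))

  J₂ : Carrier → Set
  J₂ r = r ≢ 0# × ¬ (∃ λ s → s * s ≡ r)

  J₄ : ℕ → Carrier → Set
  J₄ n r = r ≢ 0# × ∃ λ s → ∃ λ u → s * s ≡ r × s * u ≡ 1# × Tr n u ≡ 0#

  J₁ : ℕ → Carrier → Set
  J₁ n r = r ≢ 0# × ∃ λ s → ∃ λ u → s * s ≡ r × s * u ≡ 1# × Tr n u ≢ 0#

  OrbitData : (i : ℕ) → .{{NonZero i}} → Carrier → Set₁
  OrbitData i r =
    ClassCount Orbit (λ L → Generic L × JEq (fL L) r) i ×
    (∀ L → Generic L → JEq (fL L) r →
       ClassCount SameLine (Orbit L) (∣G∣ ℕ./ i))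

  OrbitsOfSize : ℕ → ℕ → Set₁
  OrbitsOfSize m k =
    ClassCount Orbit (λ L → Generic L × ClassCount SameLine (Orbit L) m) k

{-# OPTIONS --safe #-}
module Submission where

-- A line that lies in no osculating plane has p₀₃ ≠ 0, so it is spanned by (1 : z1 : z0 : 0) and
-- (0 : z4 : z3 : 1) for a unique quadruple z, and f_L is p₀₃ (z0 X⁴ + z1 X³Y + X²Y² + z3 XY³ + z4 Y⁴).
-- The line is generic iff Δ(z) ≠ 0, and then ȷ = 1/Δ(z).  For each e ≠ 0 exactly q³ − q quadruples
-- have Δ = e: those with z0 = 0 are linear in z4, and the others are translates of forms with z1 = 0,
-- where Δ = e reads v³ + v² + v − e = z0 z3² with v = z0 z4.  So if all these z have a stabiliser of
-- the same order i, their orbits have size |G|/i and there are exactly i of them.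
--
-- A non-scalar matrix stabilising z has trace 0 (otherwise Δ(z) = 0) and, after conjugation, is
-- (0 β; 1 0) with z = (z0, z1, β z1, β² z0).  There Δ = θ²(θ + 1) for a rational θ, and the other
-- involutions in the stabiliser are the rational zeros of a binary quadratic form of discriminant
-- θ + 1; so the stabiliser has order 4 or 2 according as Δ is a square or not.  Conversely every
-- root of θ³ + θ² = Δ(z) gives an involution stabilising z.  This cubic has a root when ȷ = r is a
-- non-square, because φ ↦ φ³ − rφ is then bijective, and when 1/r = u² it has one iff u = s³ − s
-- for some s, that is, iff Tr u = 0.

open import Defs
open import Algebra.Bundles using (CommutativeRing; CommutativeMonoid)
open import Algebra.Structures using (IsCommutativeRing)
open import Data.Bool using (Bool; true; false; _∧_; T)
open import Data.Bool.Properties using (T-∧)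
open import Data.Empty using (⊥)
open import Data.Fin using (Fin; zero; suc)
open import Data.Fin.Properties using () renaming (_≟_ to _≟ᶠ_)
open import Data.List as List using (List; []; _∷_; length; filter; _++_; replicate; lookup)
open import Data.List.Properties
  using (length-map; length-++; length-replicate; length-filter; filter-reject)
open import Data.List.Membership.Propositional using (_∈_; find; lose)
open import Data.List.Membership.Propositional.Properties
  using (∈-filter⁺; ∈-filter⁻; ∈-map⁺; ∈-map⁻)
open import Data.List.Membership.Propositional.Properties.WithK using (unique∧set⇒bag)
open import Data.List.Relation.Binary.BagAndSetEquality using (∼bag⇒↭)
open import Data.List.Relation.Binary.Permutation.Propositional as ↭ using (_↭_)
open import Data.List.Relation.Unary.All as All using (All; []; _∷_)
import Data.List.Relation.Unary.All.Properties as All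
open import Data.List.Relation.Unary.AllPairs as AllPairs using (AllPairs; []; _∷_)
import Data.List.Relation.Unary.AllPairs.Properties as AllPairs
open import Data.List.Relation.Unary.Any as Any using (Any; here; there; _─_; index; any?)
import Data.List.Relation.Unary.Any.Properties as Any
open import Data.Nat as ℕ using (ℕ; zero; suc; NonZero; z≤n; s≤s)
import Data.Nat.DivMod as ℕ
import Data.Nat.Properties as ℕ
open import Data.Nat.Solver using (module +-*-Solver)
open import Data.Product using (_×_; _,_; proj₁; proj₂; ∃; ∃₂; Σ)
open import Data.Sum using (_⊎_; inj₁; inj₂; [_,_]′)
open import Data.Unit using (⊤; tt)
open import Data.Vec using (Vec; []; _∷_; tabulate) renaming (lookup to lookupᵛ; map to mapᵛ)
open import Data.Vec.Properties using (lookup-map)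
open import Function using (_∘_; id)
open import Function.Bundles using (Equivalence; mk⇔)
open import Relation.Binary using (IsEquivalence; Decidable; DecidableEquality; Transitive)
import Relation.Binary.Construct.On as On
open import Relation.Binary.PropositionalEquality hiding (J)
open import Relation.Nullary using (¬_; Dec; yes; no; contradiction; ¬?)
open import Relation.Nullary.Decidable using (map′; _×-dec_)
open import Relation.Unary using () renaming (Decidable to Decidable₁)

-- The four roots of a quartic need not be rational, and no splitting field is at hand. Pairings of
-- the roots replace them: a pairing can be rational when no root is, the cubic θ³ + θ² = Δ(z) is
-- the resolvent whose roots are the pairings, and the involution exchanging the roots inside both
-- pairs has rational entries. Involutions in a stabiliser are therefore found and excluded by
-- matrix computations over the ground field. Genericity, in contrast, speaks of all extension
-- fields. Up to sign, Δ(z) is the resultant of two cubics whose common roots are the points of the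
-- line on C. Hence Δ(z) ≠ 0 forbids such points in every extension, while for Δ(z) = 0 one appears
-- over the ground field or over a quadratic extension. The algebraic steps are polynomial
-- identities in characteristic 3, verified by expansion over 𝔽₃ from an explicit certificate of
-- ideal membership; a division enters as a further variable i with the hypothesis x · i = 1.

-- Polynomial identities in characteristic 3, checked by reflection.

data 𝔽₃ : Set where
  𝟘 𝟙 𝟚 : 𝔽₃

module 𝔽₃-Arithmetic where
  infixl 6 _+₃_
  infixl 7 _*₃_
  _+₃_ _*₃_ : 𝔽₃ → 𝔽₃ → 𝔽₃
  𝟘 +₃ y = y
  𝟙 +₃ 𝟘 = 𝟙
  𝟙 +₃ 𝟙 = 𝟚
  𝟙 +₃ 𝟚 = 𝟘
  𝟚 +₃ 𝟘 = 𝟚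
  𝟚 +₃ 𝟙 = 𝟘
  𝟚 +₃ 𝟚 = 𝟙
  𝟘 *₃ y = 𝟘
  𝟙 *₃ y = y
  𝟚 *₃ 𝟘 = 𝟘
  𝟚 *₃ 𝟙 = 𝟚
  𝟚 *₃ 𝟚 = 𝟙

-- Polynomials over 𝔽₃ in n variables, in dense recursive Horner form.
Poly : ℕ → Set
Poly zero    = 𝔽₃
Poly (suc n) = List (Poly n)

constᵖ : ∀ n → 𝔽₃ → Poly n
constᵖ zero    k = k
constᵖ (suc n) k = constᵖ n k ∷ []

varᵖ : ∀ {n} → Fin n → Poly n
varᵖ {suc n} zero    = constᵖ n 𝟘 ∷ constᵖ n 𝟙 ∷ []
varᵖ {suc n} (suc i) = varᵖ i ∷ []

infixl 6 _+ᵖ_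
infixl 7 _*ᵖ_ _·ᵖ_

_+ᵖ_ : ∀ {n} → Poly n → Poly n → Poly n
_+ᵖ_ {zero}  p        q        = p 𝔽₃-Arithmetic.+₃ q
_+ᵖ_ {suc n} []       q        = q
_+ᵖ_ {suc n} (c ∷ p)  []       = c ∷ p
_+ᵖ_ {suc n} (c ∷ p)  (d ∷ q)  = (c +ᵖ d) ∷ (p +ᵖ q)

_*ᵖ_ : ∀ {n} → Poly n → Poly n → Poly n
_·ᵖ_ : ∀ {n} → Poly n → List (Poly n) → List (Poly n)
_*ᵖ_ {zero}  p       q = p 𝔽₃-Arithmetic.*₃ q
_*ᵖ_ {suc n} []      q = []
_*ᵖ_ {suc n} (c ∷ p) q = c ·ᵖ q +ᵖ (constᵖ n 𝟘 ∷ p *ᵖ q)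
c ·ᵖ []      = []
c ·ᵖ (d ∷ q) = c *ᵖ d ∷ c ·ᵖ q

-- Sums and products leave trailing zero coefficients, so the representation is not canonical and
-- vanishing is tested coefficient by coefficient.
isZero : ∀ n → Poly n → Bool
isZero zero    𝟘       = true
isZero zero    𝟙       = false
isZero zero    𝟚       = false
isZero (suc n) []      = true
isZero (suc n) (c ∷ p) = isZero n c ∧ isZero (suc n) p

module Expressions where
  infixl 6 _+_ _-_
  infixl 7 _*_
  infixr 8 _^_
  infix  8 -_
  data Expr (n : ℕ) : Set where
    var     : Fin n → Expr n
    :0 :1   : Expr n
    _+_ _*_ : Expr n → Expr n → Expr n
    -_      : Expr n → Expr n

  _-_ : ∀ {n} → Expr n → Expr n → Expr n
  x - y = x + (- y)

  _^_ : ∀ {n} → Expr n → ℕ → Expr n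
  x ^ zero  = :1
  x ^ suc k = x * x ^ k

  infix 4 _≈_
  infixr 3 _∙[_]⇒_
  -- l₁ ≈ r₁ ∙[ c₁ ]⇒ … ⇒ concl l r asserts that the hypotheses lᵢ = rᵢ imply
  -- l = r, with certificate l − r = Σ cᵢ (lᵢ − rᵢ).
  data Equation (n : ℕ) : Set where
    _≈_ : Expr n → Expr n → Equation n

  data Claim (n : ℕ) : Set where
    concl    : Equation n → Claim n
    _∙[_]⇒_ : Equation n → Expr n → Claim n → Claim n

  ⟦_⟧ᵖ : ∀ {n} → Expr n → Poly n
  ⟦_⟧ᵖ {n} (var i) = varᵖ i
  ⟦_⟧ᵖ {n} :0      = constᵖ n 𝟘
  ⟦_⟧ᵖ {n} :1      = constᵖ n 𝟙
  ⟦ e + f ⟧ᵖ       = ⟦ e ⟧ᵖ +ᵖ ⟦ f ⟧ᵖ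
  ⟦ e * f ⟧ᵖ       = ⟦ e ⟧ᵖ *ᵖ ⟦ f ⟧ᵖ
  ⟦_⟧ᵖ {n} (- e)   = constᵖ n 𝟚 *ᵖ ⟦ e ⟧ᵖ

  difference : ∀ {n} → Claim n → Poly n
  difference (concl (l ≈ r))      = ⟦ l - r ⟧ᵖ
  difference (l ≈ r ∙[ c ]⇒ rest) = difference rest +ᵖ ⟦ - (c * (l - r)) ⟧ᵖ

  certified : ∀ {n} → Claim n → Bool
  certified {n} cl = isZero n (difference cl)

  -- Claims whose conclusion is an equation between quadruples. A scalar hypothesis carries one
  -- coefficient per component, a quadruple of hypotheses a 4 × 4 matrix of coefficients.
  infix 4 _≈⁴_
  infixr 3 _∙⁴[_]⇒_
  data Equation⁴ (n : ℕ) : Set where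
    _≈⁴_ : V4 (Expr n) → V4 (Expr n) → Equation⁴ n

  data Claim⁴ (n : ℕ) : Set where
    concl⁴   : Equation⁴ n → Claim⁴ n
    _∙[_]⇒_  : Equation n → V4 (Expr n) → Claim⁴ n → Claim⁴ n
    _∙⁴[_]⇒_ : Equation⁴ n → V4 (V4 (Expr n)) → Claim⁴ n → Claim⁴ n

  component : ∀ {n} → (∀ {A} → V4 A → A) → Claim⁴ n → Claim n
  component c (concl⁴ (x ≈⁴ y))         = concl (c x ≈ c y)
  component c (eq ∙[ k ]⇒ rest)         = eq ∙[ c k ]⇒ component c rest
  component c (x ≈⁴ y ∙⁴[ k ]⇒ rest) =
    V4.c0 x ≈ V4.c0 y ∙[ V4.c0 (c k) ]⇒ V4.c1 x ≈ V4.c1 y ∙[ V4.c1 (c k) ]⇒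
    V4.c2 x ≈ V4.c2 y ∙[ V4.c2 (c k) ]⇒ V4.c3 x ≈ V4.c3 y ∙[ V4.c3 (c k) ]⇒ component c rest

  certified⁴ : ∀ {n} → Claim⁴ n → Bool
  certified⁴ cl = certified (component V4.c0 cl) ∧ certified (component V4.c1 cl) ∧
                  certified (component V4.c2 cl) ∧ certified (component V4.c3 cl)

V4-≡ : ∀ {A : Set} {x y : V4 A} → V4.c0 x ≡ V4.c0 y → V4.c1 x ≡ V4.c1 y → V4.c2 x ≡ V4.c2 y → V4.c3 x ≡ V4.c3 y → x ≡ y
V4-≡ refl refl refl refl = refl

Curried : ℕ → Set → Set → Set
Curried zero    A B = B
Curried (suc n) A B = A → Curried n A B

_$$_ : ∀ {n A B} → Curried n A B → Vec A n → B
f $$ []       = f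
f $$ (x ∷ xs) = f x $$ xs

infixr 5 _⧺_
_⧺_ : ∀ {A : Set} {m n} → Vec (V4 A) m → Vec A n → Vec A (m ℕ.* 4 ℕ.+ n)
[]                       ⧺ xs = xs
(⟨ a , b , c , d ⟩ ∷ vs) ⧺ xs = a ∷ b ∷ c ∷ d ∷ vs ⧺ xs

split : ∀ {A : Set} m {n} → Vec A (m ℕ.* 4 ℕ.+ n) → Vec (V4 A) m × Vec A n
split zero    xs                   = [] , xs
split (suc m) (a ∷ b ∷ c ∷ d ∷ xs) = let (vs , ys) = split m xs in ⟨ a , b , c , d ⟩ ∷ vs , ys

Quantified : ∀ {A : Set} n → (Vec A n → Set) → Set
Quantified zero    P = P []
Quantified (suc n) P = ∀ x → Quantified n (λ xs → P (x ∷ xs))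

quantify : ∀ {A : Set} n {P : Vec A n → Set} → (∀ xs → P xs) → Quantified n P
quantify zero    f = f []
quantify (suc n) f = λ x → quantify n (λ xs → f (x ∷ xs))

HasChar3 : Field → Set
HasChar3 F = 1# + 1# + 1# ≡ 0#
  where open Field F

IsSquare : (F : Field) → Field.Carrier F → Set
IsSquare F x = ∃ λ s → s * s ≡ x
  where open Field F

module FieldProperties (F : Field) where
  open Field F public
  open FieldOps F public

  commutativeRing : CommutativeRing _ _
  commutativeRing = record { isCommutativeRing = isCommRing }

  open IsCommutativeRing isCommRing public
    using (+-assoc; +-comm; +-identityˡ; +-identityʳ; -‿inverseˡ; -‿inverseʳ;
           *-assoc; *-comm; *-identityˡ; *-identityʳ; distribˡ; distribʳ; zeroˡ; zeroʳ)
  open import Algebra.Properties.Ring (CommutativeRing.ring commutativeRing) public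
    using (-0#≈0#; -‿involutive; +-cancelˡ; x+x≈x⇒x≈0)

  open import Algebra.Properties.CommutativeSemigroup
      (CommutativeMonoid.commutativeSemigroup (CommutativeRing.+-commutativeMonoid commutativeRing))
      using () renaming (interchange to +-medial)
  open import Algebra.Properties.CommutativeSemigroup
      (CommutativeMonoid.commutativeSemigroup (CommutativeRing.*-commutativeMonoid commutativeRing))
      using () renaming (x∙yz≈y∙xz to *-swap)

  module Char3Solver (char3 : HasChar3 F) where
    open 𝔽₃-Arithmetic

    ⟦_⟧₃ : 𝔽₃ → Carrier
    ⟦ 𝟘 ⟧₃ = 0#
    ⟦ 𝟙 ⟧₃ = 1#
    ⟦ 𝟚 ⟧₃ = 1# + 1#

    1+2≡0 : 1# + (1# + 1#) ≡ 0#
    1+2≡0 = trans (sym (+-assoc _ _ _)) char3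

    2+2≡1 : (1# + 1#) + (1# + 1#) ≡ 1#
    2+2≡1 = trans (+-assoc _ _ _) (trans (cong (1# +_) 1+2≡0) (+-identityʳ 1#))

    +₃-homo : ∀ a b → ⟦ a +₃ b ⟧₃ ≡ ⟦ a ⟧₃ + ⟦ b ⟧₃
    +₃-homo 𝟘 b = sym (+-identityˡ _)
    +₃-homo 𝟙 𝟘 = sym (+-identityʳ _)
    +₃-homo 𝟙 𝟙 = refl
    +₃-homo 𝟙 𝟚 = sym 1+2≡0
    +₃-homo 𝟚 𝟘 = sym (+-identityʳ _)
    +₃-homo 𝟚 𝟙 = sym char3
    +₃-homo 𝟚 𝟚 = sym 2+2≡1

    *₃-homo : ∀ a b → ⟦ a *₃ b ⟧₃ ≡ ⟦ a ⟧₃ * ⟦ b ⟧₃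
    *₃-homo 𝟘 b = sym (zeroˡ _)
    *₃-homo 𝟙 b = sym (*-identityˡ _)
    *₃-homo 𝟚 𝟘 = sym (zeroʳ _)
    *₃-homo 𝟚 𝟙 = sym (*-identityʳ _)
    *₃-homo 𝟚 𝟚 = sym (trans (distribˡ _ _ _) (trans (cong₂ _+_ (*-identityʳ _) (*-identityʳ _)) 2+2≡1))

    eval : ∀ {n} → Poly n → Vec Carrier n → Carrier
    eval {zero}  k       []      = ⟦ k ⟧₃
    eval {suc n} []      (x ∷ ρ) = 0#
    eval {suc n} (c ∷ p) (x ∷ ρ) = eval c ρ + x * eval {suc n} p (x ∷ ρ)

    const-eval : ∀ n k ρ → eval (constᵖ n k) ρ ≡ ⟦ k ⟧₃
    const-eval zero    k []      = refl
    const-eval (suc n) k (x ∷ ρ) =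
      trans (cong₂ _+_ (const-eval n k ρ) (zeroʳ x)) (+-identityʳ _)

    var-eval : ∀ {n} (i : Fin n) ρ → eval (varᵖ i) ρ ≡ lookupᵛ ρ i
    var-eval {suc n} zero (x ∷ ρ) = begin
      eval (constᵖ n 𝟘) ρ + x * (eval (constᵖ n 𝟙) ρ + x * 0#)
        ≡⟨ cong₂ (λ a b → a + x * b) (const-eval n 𝟘 ρ)
             (cong₂ _+_ (const-eval n 𝟙 ρ) (zeroʳ x)) ⟩
      0# + x * (1# + 0#) ≡⟨ +-identityˡ _ ⟩
      x * (1# + 0#)      ≡⟨ cong (x *_) (+-identityʳ 1#) ⟩
      x * 1#             ≡⟨ *-identityʳ x ⟩
      x                  ∎
      where open ≡-Reasoning
    var-eval {suc n} (suc i) (x ∷ ρ) =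
      trans (cong₂ _+_ (var-eval i ρ) (zeroʳ x)) (+-identityʳ _)

    +-eval : ∀ {n} (p q : Poly n) ρ → eval (p +ᵖ q) ρ ≡ eval p ρ + eval q ρ
    +-eval {zero}  p       q       []      = +₃-homo p q
    +-eval {suc n} []      q       (x ∷ ρ) = sym (+-identityˡ _)
    +-eval {suc n} (c ∷ p) []      (x ∷ ρ) = sym (+-identityʳ _)
    +-eval {suc n} (c ∷ p) (d ∷ q) (x ∷ ρ) = begin
      eval (c +ᵖ d) ρ + x * eval {suc n} (p +ᵖ q) (x ∷ ρ)
        ≡⟨ cong₂ (λ a b → a + x * b) (+-eval c d ρ) (+-eval {suc n} p q (x ∷ ρ)) ⟩
      (eval c ρ + eval d ρ) + x * (eval {suc n} p (x ∷ ρ) + eval {suc n} q (x ∷ ρ))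
        ≡⟨ cong₂ _+_ refl (distribˡ _ _ _) ⟩
      (eval c ρ + eval d ρ) + (x * eval {suc n} p (x ∷ ρ) + x * eval {suc n} q (x ∷ ρ))
        ≡⟨ +-medial _ _ _ _ ⟩
      (eval c ρ + x * eval {suc n} p (x ∷ ρ)) + (eval d ρ + x * eval {suc n} q (x ∷ ρ)) ∎
      where open ≡-Reasoning

    *-eval : ∀ {n} (p q : Poly n) ρ → eval (p *ᵖ q) ρ ≡ eval p ρ * eval q ρ
    ·-eval : ∀ {n} (c : Poly n) (q : Poly (suc n)) x ρ →
             eval {suc n} (c ·ᵖ q) (x ∷ ρ) ≡ eval c ρ * eval {suc n} q (x ∷ ρ)
    *-eval {zero}  p       q []      = *₃-homo p q
    *-eval {suc n} []      q (x ∷ ρ) = sym (zeroˡ _)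
    *-eval {suc n} (c ∷ p) q (x ∷ ρ) = begin
      eval {suc n} (c ·ᵖ q +ᵖ (constᵖ n 𝟘 ∷ p *ᵖ q)) (x ∷ ρ)
        ≡⟨ +-eval {suc n} (c ·ᵖ q) _ (x ∷ ρ) ⟩
      eval {suc n} (c ·ᵖ q) (x ∷ ρ) + (eval (constᵖ n 𝟘) ρ + x * eval {suc n} (p *ᵖ q) (x ∷ ρ))
        ≡⟨ cong₂ _+_ (·-eval c q x ρ)
             (trans (cong₂ _+_ (const-eval n 𝟘 ρ) refl) (+-identityˡ _)) ⟩
      eval c ρ * Q + x * eval {suc n} (p *ᵖ q) (x ∷ ρ)
        ≡⟨ cong (λ a → eval c ρ * Q + x * a) (*-eval {suc n} p q (x ∷ ρ)) ⟩
      eval c ρ * Q + x * (P * Q) ≡⟨ cong₂ _+_ refl (*-assoc x P Q) ⟨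
      eval c ρ * Q + x * P * Q   ≡⟨ distribʳ Q _ _ ⟨
      (eval c ρ + x * P) * Q     ∎
      where
      open ≡-Reasoning
      P = eval {suc n} p (x ∷ ρ)
      Q = eval {suc n} q (x ∷ ρ)
    ·-eval c []      x ρ = sym (zeroʳ _)
    ·-eval c (d ∷ q) x ρ = begin
      eval (c *ᵖ d) ρ + x * eval (c ·ᵖ q) (x ∷ ρ)
        ≡⟨ cong₂ (λ a b → a + x * b) (*-eval c d ρ) (·-eval c q x ρ) ⟩
      eval c ρ * eval d ρ + x * (eval c ρ * eval q (x ∷ ρ))
        ≡⟨ cong₂ _+_ refl (*-swap x _ _) ⟩
      eval c ρ * eval d ρ + eval c ρ * (x * eval q (x ∷ ρ))
        ≡⟨ distribˡ _ _ _ ⟨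
      eval c ρ * (eval d ρ + x * eval q (x ∷ ρ)) ∎
      where open ≡-Reasoning

    isZero-sound : ∀ n (p : Poly n) ρ → T (isZero n p) → eval p ρ ≡ 0#
    isZero-sound zero    𝟘       []      t = refl
    isZero-sound (suc n) []      (x ∷ ρ) t = refl
    isZero-sound (suc n) (c ∷ p) (x ∷ ρ) t with isZero n c in eq
    ... | true = trans (cong₂ (λ a b → a + x * b)
                          (isZero-sound n c ρ (subst T (sym eq) _))
                          (isZero-sound (suc n) p (x ∷ ρ) t))
                       (trans (+-identityˡ _) (zeroʳ x))

    module E = Expressions
    open E using (Expr; Claim; Claim⁴; ⟦_⟧ᵖ)

    ⟦_⟧ : ∀ {n} → Expr n → Vec Carrier n → Carrier
    ⟦ E.var i   ⟧ ρ = lookupᵛ ρ i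
    ⟦ E.:0      ⟧ ρ = 0#
    ⟦ E.:1      ⟧ ρ = 1#
    ⟦ e E.+ f   ⟧ ρ = ⟦ e ⟧ ρ + ⟦ f ⟧ ρ
    ⟦ e E.* f   ⟧ ρ = ⟦ e ⟧ ρ * ⟦ f ⟧ ρ
    ⟦ E.- e     ⟧ ρ = - ⟦ e ⟧ ρ

    2*x≡-x : ∀ x → (1# + 1#) * x ≡ - x
    2*x≡-x x = +-cancelˡ x _ _ (begin
      x + (1# + 1#) * x      ≡⟨ cong₂ _+_ (*-identityˡ x) refl ⟨
      1# * x + (1# + 1#) * x ≡⟨ distribʳ x _ _ ⟨
      (1# + (1# + 1#)) * x   ≡⟨ cong (_* x) 1+2≡0 ⟩
      0# * x                 ≡⟨ zeroˡ x ⟩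
      0#                     ≡⟨ -‿inverseʳ x ⟨
      x + - x                ∎)
      where open ≡-Reasoning

    expr-eval : ∀ {n} (e : Expr n) ρ → eval ⟦ e ⟧ᵖ ρ ≡ ⟦ e ⟧ ρ
    expr-eval     (E.var i) ρ = var-eval i ρ
    expr-eval {n} E.:0      ρ = const-eval n 𝟘 ρ
    expr-eval {n} E.:1      ρ = const-eval n 𝟙 ρ
    expr-eval (e E.+ f) ρ = trans (+-eval ⟦ e ⟧ᵖ ⟦ f ⟧ᵖ ρ) (cong₂ _+_ (expr-eval e ρ) (expr-eval f ρ))
    expr-eval (e E.* f) ρ = trans (*-eval ⟦ e ⟧ᵖ ⟦ f ⟧ᵖ ρ) (cong₂ _*_ (expr-eval e ρ) (expr-eval f ρ))
    expr-eval {n} (E.- e) ρ =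
      trans (*-eval (constᵖ n 𝟚) ⟦ e ⟧ᵖ ρ)
      (trans (cong₂ _*_ (const-eval n 𝟚 ρ) (expr-eval e ρ)) (2*x≡-x _))

    Holds : ∀ {n} → Claim n → Vec Carrier n → Set
    Holds (E.concl (l E.≈ r))      ρ = ⟦ l ⟧ ρ ≡ ⟦ r ⟧ ρ
    Holds (l E.≈ r E.∙[ c ]⇒ rest) ρ = ⟦ l ⟧ ρ ≡ ⟦ r ⟧ ρ → Holds rest ρ

    x≡y⇒x-y≡0 : ∀ {x y} → x ≡ y → x - y ≡ 0#
    x≡y⇒x-y≡0 {x} refl = -‿inverseʳ x

    x-y≡0⇒x≡y : ∀ {x y} → x - y ≡ 0# → x ≡ y
    x-y≡0⇒x≡y {x} {y} h = begin
      x             ≡⟨ +-identityʳ x ⟨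
      x + 0#        ≡⟨ cong (x +_) (-‿inverseˡ y) ⟨
      x + (- y + y) ≡⟨ +-assoc x (- y) y ⟨
      x - y + y     ≡⟨ cong (_+ y) h ⟩
      0# + y        ≡⟨ +-identityˡ y ⟩
      y             ∎
      where open ≡-Reasoning

    difference-sound : ∀ {n} (cl : Claim n) ρ → eval (E.difference cl) ρ ≡ 0# → Holds cl ρ
    difference-sound (E.concl (l E.≈ r)) ρ h =
      x-y≡0⇒x≡y (trans (sym (expr-eval (l E.- r) ρ)) h)
    difference-sound (l E.≈ r E.∙[ c ]⇒ rest) ρ h hyp = difference-sound rest ρ (begin
      eval (E.difference rest) ρ      ≡⟨ +-identityʳ _ ⟨
      eval (E.difference rest) ρ + 0# ≡⟨ cong₂ _+_ refl vanishes ⟨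
      eval (E.difference rest) ρ + eval ⟦ d ⟧ᵖ ρ ≡⟨ +-eval (E.difference rest) ⟦ d ⟧ᵖ ρ ⟨
      eval (E.difference rest +ᵖ ⟦ d ⟧ᵖ) ρ ≡⟨ h ⟩
      0# ∎)
      where
      open ≡-Reasoning
      d = E.- (c E.* (l E.- r))
      vanishes : eval ⟦ d ⟧ᵖ ρ ≡ 0#
      vanishes = trans (expr-eval d ρ)
        (trans (cong -_ (trans (cong (⟦ c ⟧ ρ *_) (x≡y⇒x-y≡0 hyp)) (zeroʳ _))) -0#≈0#)

    Holds⁴ : ∀ {n} → Claim⁴ n → Vec Carrier n → Set
    Holds⁴ (E.concl⁴ (x E.≈⁴ y))       ρ = mapV4 (λ e → ⟦ e ⟧ ρ) x ≡ mapV4 (λ e → ⟦ e ⟧ ρ) y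
    Holds⁴ (l E.≈ r E.∙[ c ]⇒ rest)    ρ = ⟦ l ⟧ ρ ≡ ⟦ r ⟧ ρ → Holds⁴ rest ρ
    Holds⁴ (x E.≈⁴ y E.∙⁴[ c ]⇒ rest) ρ = mapV4 (λ e → ⟦ e ⟧ ρ) x ≡ mapV4 (λ e → ⟦ e ⟧ ρ) y → Holds⁴ rest ρ

    certified-sound : ∀ {n} (cl : Claim n) ρ → T (E.certified cl) → Holds cl ρ
    certified-sound {n} cl ρ t = difference-sound cl ρ (isZero-sound n (E.difference cl) ρ t)

    -- For a concrete claim the check evaluates to `⊤` and `_` supplies it, so an identity is proved
    -- by computation alone; the result is stated directly about elements of the field.
    follows : ∀ n (f : Curried n (Expr n) (Claim n)) →
              T (E.certified (f $$ tabulate E.var)) →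
              Quantified n (Holds (f $$ tabulate E.var))
    follows n f t = quantify n (λ ρ → certified-sound (f $$ tabulate E.var) ρ t)

    components-sound : ∀ {n} (cl : Claim⁴ n) ρ →
      Holds (E.component V4.c0 cl) ρ → Holds (E.component V4.c1 cl) ρ →
      Holds (E.component V4.c2 cl) ρ → Holds (E.component V4.c3 cl) ρ → Holds⁴ cl ρ
    components-sound (E.concl⁴ (x E.≈⁴ y)) ρ h₀ h₁ h₂ h₃ = V4-≡ h₀ h₁ h₂ h₃
    components-sound (l E.≈ r E.∙[ c ]⇒ rest) ρ h₀ h₁ h₂ h₃ =
      λ h → components-sound rest ρ (h₀ h) (h₁ h) (h₂ h) (h₃ h)
    components-sound (x E.≈⁴ y E.∙⁴[ c ]⇒ rest) ρ h₀ h₁ h₂ h₃ = λ h →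
      let e₀ = cong V4.c0 h; e₁ = cong V4.c1 h; e₂ = cong V4.c2 h; e₃ = cong V4.c3 h in
      components-sound rest ρ (h₀ e₀ e₁ e₂ e₃) (h₁ e₀ e₁ e₂ e₃) (h₂ e₀ e₁ e₂ e₃) (h₃ e₀ e₁ e₂ e₃)

    follows⁴ : ∀ m n (f : Curried m (V4 (Expr (m ℕ.* 4 ℕ.+ n))) (Curried n (Expr (m ℕ.* 4 ℕ.+ n)) (Claim⁴ (m ℕ.* 4 ℕ.+ n)))) →
      let (vs , xs) = split m (tabulate E.var); cl = (f $$ vs) $$ xs in
      T (E.certified⁴ cl) → Quantified m (λ us → Quantified n (λ ys → Holds⁴ cl (us ⧺ ys)))
    follows⁴ m n f t = quantify m (λ us → quantify n (λ ys →
      let (t₀ , t₁₂₃) = to T-∧ t; (t₁ , t₂₃) = to T-∧ t₁₂₃; (t₂ , t₃) = to T-∧ t₂₃ in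
      components-sound _ (us ⧺ ys) (certified-sound _ _ t₀) (certified-sound _ _ t₁)
                                   (certified-sound _ _ t₂) (certified-sound _ _ t₃)))
      where open Equivalence using (to)

-- Counting classes of an equivalence relation.

length-filter-split : ∀ {a p} {A : Set a} {P : A → Set p} (P? : Decidable₁ P) xs →
  length (filter P? xs) ℕ.+ length (filter (¬? ∘ P?) xs) ≡ length xs
length-filter-split P? []       = refl
length-filter-split P? (x ∷ xs) with P? x
... | yes _ = cong suc (length-filter-split P? xs)
... | no  _ = trans (ℕ.+-suc _ _) (cong suc (length-filter-split P? xs))

filter-absorb : ∀ {a p q} {A : Set a} {P : A → Set p} {Q : A → Set q}
  (P? : Decidable₁ P) (Q? : Decidable₁ Q) → (∀ {x} → P x → Q x) →
  ∀ xs → filter P? (filter Q? xs) ≡ filter P? xs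
filter-absorb P? Q? P⇒Q []       = refl
filter-absorb P? Q? P⇒Q (x ∷ xs) with Q? x
... | no ¬q = trans (filter-absorb P? Q? P⇒Q xs) (sym (filter-reject P? (¬q ∘ P⇒Q)))
... | yes _ with P? x
...   | yes _ = cong (x ∷_) (filter-absorb P? Q? P⇒Q xs)
...   | no _  = filter-absorb P? Q? P⇒Q xs

length-─ : ∀ {a p} {A : Set a} {P : A → Set p} {xs} (i : Any P xs) →
  length xs ≡ suc (length (xs ─ i))
length-─ (here _)  = refl
length-─ (there i) = cong suc (length-─ i)

module _ {A : Set} {ℓ} {_~_ : A → A → Set ℓ} (~-equiv : IsEquivalence _~_) where
  private module ~ = IsEquivalence ~-equiv

  Any-─ : ∀ {x x′ ys} (i : Any (x ~_) ys) → ¬ x ~ x′ → Any (x′ ~_) ys → Any (x′ ~_) (ys ─ i)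
  Any-─ (here x~y) x≁x′ (here x′~y) = contradiction (~.trans x~y (~.sym x′~y)) x≁x′
  Any-─ (here x~y) x≁x′ (there j)   = j
  Any-─ (there i)  x≁x′ (here x′~y) = here x′~y
  Any-─ (there i)  x≁x′ (there j)   = there (Any-─ i x≁x′ j)

  -- Pigeonhole: each element of `xs` uses up one matching entry of `ys`, and the remaining ones
  -- keep their matches because inequivalent elements never match the same entry.
  length-≤ : ∀ {xs ys} → AllPairs (λ a b → ¬ (a ~ b)) xs → All (λ x → Any (x ~_) ys) xs →
             length xs ℕ.≤ length ys
  length-≤ [] [] = z≤n
  length-≤ {ys = ys} (x≁xs ∷ xs!) (i ∷ xs⊆ys) rewrite length-─ i =
    s≤s (length-≤ xs! (All.zipWith (λ (x≁x′ , j) → Any-─ i x≁x′ j) (x≁xs , xs⊆ys)))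

  ClassCount-unique : ∀ {p} {P : A → Set p} {m n} →
    ClassCount _~_ P m → ClassCount _~_ P n → m ≡ n
  ClassCount-unique (xs , refl , Pxs , xs! , xs-all) (ys , refl , Pys , ys! , ys-all) =
    ℕ.≤-antisym (length-≤ xs! (All.map (ys-all _) Pxs)) (length-≤ ys! (All.map (xs-all _) Pys))

-- The last hypothesis joins surjectivity and compatibility in one clause. For `Orbit` this clause
-- follows directly from `∼⇒Orbit`, without composing orbits of lines.
ClassCount-image′ : ∀ {A B : Set} {ℓ ℓ′ p q} {_~_ : A → A → Set ℓ} {_≈_ : B → B → Set ℓ′}
  {P : A → Set p} {Q : B → Set q} (f : A → B) →
  (∀ {a} → P a → Q (f a)) →
  (∀ {a a′} → P a → P a′ → f a ≈ f a′ → a ~ a′) →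
  (∀ b → Q b → ∃ λ a → P a × (∀ {a′} → P a′ → a ~ a′ → b ≈ f a′)) →
  ∀ {n} → ClassCount _~_ P n → ClassCount _≈_ Q n
ClassCount-image′ {A} {_~_ = _~_} {_≈_} {P} f P⇒Q f-inj f-onto (xs , len , Pxs , xs! , xs-all) =
  List.map f xs , trans (length-map f xs) len , All.map⁺ (All.map P⇒Q Pxs) ,
  pairs Pxs xs! ,
  λ b Qb → let (a , Pa , b≈) = f-onto b Qb in Any.map⁺ (locate b≈ Pxs (xs-all a Pa))
  where
  pairs : ∀ {ys} → All P ys → AllPairs (λ a a′ → ¬ (a ~ a′)) ys →
          AllPairs (λ b b′ → ¬ (b ≈ b′)) (List.map f ys)
  pairs [] [] = []
  pairs (Py ∷ Pys) (y≁ ∷ ys!) =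
    All.map⁺ (All.zipWith (λ (Py′ , y≁y′) → y≁y′ ∘ f-inj Py Py′) (Pys , y≁)) ∷ pairs Pys ys!
  locate : ∀ {r s} {R : A → Set r} {S : A → Set s} {ys} →
           (∀ {y} → P y → R y → S y) → All P ys → Any R ys → Any S ys
  locate g (Py ∷ _)  (here Ry) = here (g Py Ry)
  locate g (_ ∷ Pys) (there i) = there (locate g Pys i)

ClassCount-image : ∀ {A B : Set} {ℓ ℓ′ p q} {_~_ : A → A → Set ℓ} {_≈_ : B → B → Set ℓ′}
  {P : A → Set p} {Q : B → Set q} → Transitive _≈_ → (f : A → B) →
  (∀ {a} → P a → Q (f a)) →
  (∀ {a a′} → P a → P a′ → f a ≈ f a′ → a ~ a′) →
  (∀ {a a′} → P a → P a′ → a ~ a′ → f a ≈ f a′) →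
  (∀ b → Q b → ∃ λ a → P a × b ≈ f a) →
  ∀ {n} → ClassCount _~_ P n → ClassCount _≈_ Q n
ClassCount-image ≈-trans f P⇒Q f-inj f-cong f-onto = ClassCount-image′ f P⇒Q f-inj
  (λ b Qb → let (a , Pa , b≈fa) = f-onto b Qb in a , Pa , λ Pa′ a~a′ → ≈-trans b≈fa (f-cong Pa Pa′ a~a′))

ClassCount-resp : ∀ {A : Set} {ℓ p q} {_~_ : A → A → Set ℓ} {P : A → Set p} {Q : A → Set q} →
  (∀ {a} → P a → Q a) → (∀ {a} → Q a → P a) →
  ∀ {n} → ClassCount _~_ P n → ClassCount _~_ Q n
ClassCount-resp P⇒Q Q⇒P (xs , len , Pxs , xs! , xs-all) =
  xs , len , All.map P⇒Q Pxs , xs! , λ a Qa → xs-all a (Q⇒P Qa)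

ClassCount-⊎ : ∀ {A : Set} {ℓ p q} {_~_ : A → A → Set ℓ} {P : A → Set p} {Q : A → Set q} →
  (∀ {a b} → P a → Q b → ¬ (a ~ b)) → ∀ {m n} →
  ClassCount _~_ P m → ClassCount _~_ Q n → ClassCount _~_ (λ a → P a ⊎ Q a) (m ℕ.+ n)
ClassCount-⊎ P≁Q (xs , refl , Pxs , xs! , xs-all) (ys , refl , Qys , ys! , ys-all) =
  xs ++ ys , length-++ xs , All.++⁺ (All.map inj₁ Pxs) (All.map inj₂ Qys) ,
  AllPairs.++⁺ xs! ys! (All.map (λ Px → All.map (P≁Q Px) Qys) Pxs) ,
  λ { a (inj₁ Pa) → Any.++⁺ˡ (xs-all a Pa) ; a (inj₂ Qa) → Any.++⁺ʳ xs (ys-all a Qa) }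

ClassCount-filter : ∀ {A : Set} {ℓ p q} {_~_ : A → A → Set ℓ} {P : A → Set p} {Q : A → Set q} →
  (Q? : Decidable₁ Q) → (∀ {a b} → a ~ b → Q a → Q b) →
  ((xs , _) : Σ (List A) λ xs → All P xs × AllPairs (λ a b → ¬ (a ~ b)) xs ×
                (∀ a → P a → Any (a ~_) xs)) →
  ClassCount _~_ (λ a → P a × Q a) (length (filter Q? xs))
ClassCount-filter {_~_ = _~_} {P} {Q} Q? Q-resp (xs , Pxs , xs! , xs-all) =
  filter Q? xs , refl , All.zip (All.filter⁺ Q? Pxs , All.all-filter Q? xs) ,
  AllPairs.filter⁺ Q? xs! ,
  λ a (Pa , Qa) → let (b , b∈xs , a~b) = find (xs-all a Pa) in
    lose (∈-filter⁺ Q? b∈xs (Q-resp a~b Qa)) a~b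

ClassCount-complement : ∀ {A : Set} {ℓ p q} {_~_ : A → A → Set ℓ} {P : A → Set p} {Q : A → Set q} →
  IsEquivalence _~_ → Decidable₁ Q → (∀ {a b} → a ~ b → Q a → Q b) → ∀ {m n} →
  ClassCount _~_ P m → ClassCount _~_ (λ a → P a × Q a) n →
  ∃ λ k → n ℕ.+ k ≡ m × ClassCount _~_ (λ a → P a × ¬ Q a) k
ClassCount-complement ~-equiv Q? Q-resp (xs , refl , rest) count-Q =
  length (filter (¬? ∘ Q?) xs) ,
  trans (cong (ℕ._+ _) (ClassCount-unique ~-equiv count-Q (ClassCount-filter Q? Q-resp (xs , rest))))
        (length-filter-split Q? xs) ,
  ClassCount-filter (¬? ∘ Q?) (λ a~b ¬Qa Qb → ¬Qa (Q-resp (IsEquivalence.sym ~-equiv a~b) Qb)) (xs , rest)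

module _ {A : Set} {ℓ} {_≈_ : A → A → Set ℓ} (≈-equiv : IsEquivalence _≈_) (_≈?_ : Decidable _≈_) (k : ℕ) where
  private module ≈ = IsEquivalence ≈-equiv

  -- Takes the head as a representative, deletes its whole class of k entries and recurses; `n`
  -- bounds the length, since the filtered list is not a structural subterm.
  class-representatives : ∀ n xs → length xs ℕ.≤ n →
    All (λ x → length (filter (x ≈?_) xs) ≡ k) xs →
    Σ (List A) λ reps → length reps ℕ.* k ≡ length xs × All (_∈ xs) reps ×
      AllPairs (λ a b → ¬ (a ≈ b)) reps × (∀ {x} → x ∈ xs → Any (x ≈_) reps)
  class-representatives n       []       _     _ = [] , refl , [] , [] , λ ()
  class-representatives (suc n) (x ∷ xs) (s≤s |xs|≤n) sizes@(size-x ∷ _) =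
    let (reps , len , reps∈ , reps! , cover) = class-representatives n others |others|≤n sizes′ in
    x ∷ reps ,
    trans (cong₂ ℕ._+_ (sym size-x) len) (length-filter-split (x ≈?_) (x ∷ xs)) ,
    here refl ∷ All.map (proj₁ ∘ ∈-filter⁻ (¬? ∘ (x ≈?_))) reps∈ ,
    All.map (proj₂ ∘ ∈-filter⁻ (¬? ∘ (x ≈?_)) {xs = x ∷ xs}) reps∈ ∷ reps! ,
    covers cover
    where
    others = filter (¬? ∘ (x ≈?_)) (x ∷ xs)

    |others|≤n : length others ℕ.≤ n
    |others|≤n rewrite filter-reject (¬? ∘ (x ≈?_)) {xs = xs} (λ x≉x → x≉x ≈.refl) =
      ℕ.≤-trans (length-filter (¬? ∘ (x ≈?_)) xs) |xs|≤n

    size-other : ∀ {y} → y ∈ others → length (filter (y ≈?_) others) ≡ k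
    size-other {y} y∈ = let (y∈xs , x≉y) = ∈-filter⁻ (¬? ∘ (x ≈?_)) {xs = x ∷ xs} y∈ in
      trans (cong length (filter-absorb (y ≈?_) (¬? ∘ (x ≈?_))
              (λ y≈z x≈z → x≉y (≈.trans x≈z (≈.sym y≈z))) (x ∷ xs)))
            (All.lookup sizes y∈xs)

    sizes′ : All (λ y → length (filter (y ≈?_) others) ≡ k) others
    sizes′ = All.tabulate size-other

    covers : ∀ {reps} → (∀ {y} → y ∈ others → Any (y ≈_) reps) →
             ∀ {y} → y ∈ x ∷ xs → Any (y ≈_) (x ∷ reps)
    covers cover {y} y∈ with x ≈? y
    ... | yes x≈y = here (≈.sym x≈y)
    ... | no  x≉y = there (cover (∈-filter⁺ (¬? ∘ (x ≈?_)) y∈ x≉y))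

  -- The division principle behind the counts: each class of the coarser relation `_≈_` consists of
  -- k classes of `_~_`. It serves for the fibres of x³ - x, for the pairs ±u, for cosets of a
  -- stabiliser and for the orbits among the quartics of given discriminant.
  ClassCount-quotient : ∀ {ℓ′ p} {_~_ : A → A → Set ℓ′} {P : A → Set p} → IsEquivalence _~_ →
    (∀ {a b} → a ~ b → a ≈ b) → ∀ {N} → ClassCount _~_ P N →
    (∀ a → P a → ClassCount _~_ (λ b → P b × a ≈ b) k) →
    ∃ λ m → m ℕ.* k ≡ N × ClassCount _≈_ P m
  ClassCount-quotient {P = P} ~-equiv ~⇒≈ (xs , refl , Pxs , xs! , xs-all) class-size =
    let (reps , len , reps∈ , reps! , cover) =
          class-representatives (length xs) xs ℕ.≤-refl
            (All.map (λ {x} Px → ClassCount-unique ~-equiv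
               (ClassCount-filter (x ≈?_) (λ a~b x≈a → ≈.trans x≈a (~⇒≈ a~b)) (xs , Pxs , xs! , xs-all))
               (class-size x Px)) Pxs)
    in length reps , len , reps , refl , All.map (All.lookup Pxs) reps∈ , reps! ,
       λ a Pa → let (b , b∈xs , a~b) = find (xs-all a Pa) in
         Any.map (≈.trans (~⇒≈ a~b)) (cover b∈xs)

module _ {I A : Set} {ℓ ℓ′ j p} {_~_ : I → I → Set ℓ} {_≈_ : A → A → Set ℓ′}
  {J : I → Set j} {P : I → A → Set p}
  (P-resp : ∀ {r r′ a} → r ~ r′ → P r a → P r′ a)
  (disjoint : ∀ {r r′ a a′} → J r → J r′ → P r a → P r′ a′ → a ≈ a′ → r ~ r′) where

  concat-classes : ∀ {i} rs → All J rs → AllPairs (λ r r′ → ¬ (r ~ r′)) rs →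
    (∀ r → J r → ClassCount _≈_ (P r) i) →
    Σ (List A) λ xs → length xs ≡ length rs ℕ.* i × All (λ a → Any (λ r → P r a) rs) xs ×
      AllPairs (λ a b → ¬ (a ≈ b)) xs × All (λ r → ∀ a → P r a → Any (a ≈_) xs) rs
  concat-classes [] [] [] fibre = [] , refl , [] , [] , []
  concat-classes (r ∷ rs) (Jr ∷ Jrs) (r≁rs ∷ rs!) fibre =
    let (xs , len , Pxs , xs! , xs-all) = fibre r Jr
        (ys , len′ , Pys , ys! , ys-all) = concat-classes rs Jrs rs! fibre
    in xs ++ ys , trans (length-++ xs) (cong₂ ℕ._+_ len len′) ,
       All.++⁺ (All.map here Pxs) (All.map there Pys) ,
       AllPairs.++⁺ xs! ys! (All.map (λ Pra → All.map (λ Any-P a≈b → apart Pra Any-P a≈b) Pys) Pxs) ,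
       (λ a Pa → Any.++⁺ˡ (xs-all a Pa)) ∷ All.map (λ all a Pa → Any.++⁺ʳ xs (all a Pa)) ys-all
    where
    apart : ∀ {a b} → P r a → Any (λ r′ → P r′ b) rs → ¬ (a ≈ b)
    apart Pra any a≈b = let (r′ , r′∈ , Pr′b) = find any in
      All.lookup r≁rs r′∈ (disjoint Jr (All.lookup Jrs r′∈) Pra Pr′b a≈b)

  -- Equivalent elements have equivalent indices by `disjoint`, so the lists for inequivalent
  -- indices can simply be concatenated.
  ClassCount-fibres : ∀ {k i} → ClassCount _~_ J k → (∀ r → J r → ClassCount _≈_ (P r) i) →
    ClassCount _≈_ (λ a → ∃ λ r → J r × P r a) (k ℕ.* i)
  ClassCount-fibres (rs , refl , Jrs , rs! , rs-all) fibre =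
    let (xs , len , Pxs , xs! , xs-all) = concat-classes rs Jrs rs! fibre in
    xs , len ,
    All.map (λ any → let (r , r∈ , Pra) = find any in r , All.lookup Jrs r∈ , Pra) Pxs ,
    xs! ,
    λ a (r , Jr , Pra) → let (r′ , r′∈ , r~r′) = find (rs-all r Jr) in
      All.lookup xs-all r′∈ a (P-resp r~r′ Pra)

ClassCount-× : ∀ {A B : Set} {p q} {P : A → Set p} {Q : B → Set q} {m n} →
  ClassCount _≡_ P m → ClassCount _≡_ Q n →
  ClassCount _≡_ (λ (a , b) → P a × Q b) (m ℕ.* n)
ClassCount-× countP countQ = ClassCount-resp
  (λ { (_ , Pr , refl , Qb) → Pr , Qb }) (λ { (Pa , Qb) → _ , Pa , refl , Qb })
  (ClassCount-fibres {P = λ r (a , b) → r ≡ a × _} (λ { refl Px → Px })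
    (λ { _ _ (refl , _) (refl , _) refl → refl }) countP
    (λ r _ → ClassCount-image trans (r ,_) (refl ,_) (λ { _ _ refl → refl }) (λ { _ _ refl → refl })
       (λ { (_ , b) (refl , Qb) → b , Qb , refl }) countQ))

-- Powers, products and polynomials over a field of characteristic 3.

module FieldIdentities (F : Field) (char3 : HasChar3 F) where
  open FieldProperties.Char3Solver F char3 using (follows)
  open Expressions
  x²≈y²⇒ = follows 2 (λ x y → x * x ≈ y * y ∙[ :1 ]⇒ concl ((x - y) * (x + y) ≈ :0)) _
  sum≈0⇒ = follows 2 (λ x y → x + y ≈ :0 ∙[ :1 ]⇒ concl (x ≈ - y)) _
  neg-sq = follows 1 (λ x → concl ((- x) * (- x) ≈ x * x)) _
  x≈-x⇒ = follows 1 (λ x → x ≈ - x ∙[ - :1 ]⇒ concl (x ≈ :0)) _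
  -- The map x ↦ x³ - x is additive with kernel 𝔽₃, so the difference of two values is the product
  -- of x - y - c over c in 𝔽₃.
  ℘-split = follows 2 (λ x y → x ^ 3 - x ≈ y ^ 3 - y ∙[ :1 ]⇒
              concl ((x - y) * ((x - (y + :1)) * (x - (y + :1 + :1))) ≈ :0)) _
  ℘+1 = follows 1 (λ x → concl (x ^ 3 - x ≈ (x + :1) ^ 3 - (x + :1))) _
  ℘+2 = follows 1 (λ x → concl (x ^ 3 - x ≈ (x + :1 + :1) ^ 3 - (x + :1 + :1))) _
  x≈x+1⇒ = follows 1 (λ x → x ≈ x + :1 ∙[ - :1 ]⇒ concl (:1 ≈ :0)) _
  x≈x+2⇒ = follows 1 (λ x → x ≈ x + :1 + :1 ∙[ :1 ]⇒ concl (:1 ≈ :0)) _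
  x+1≈x+2⇒ = follows 1 (λ x → x + :1 ≈ x + :1 + :1 ∙[ - :1 ]⇒ concl (:1 ≈ :0)) _
  ℘0 = follows 0 (concl (:0 ^ 3 - :0 ≈ :0)) _
  ℘-neg = follows 1 (λ s → concl ((- s) ^ 3 - (- s) ≈ - (s ^ 3 - s))) _
  Frobenius-step = follows 2 (λ x y → concl ((x - y) ^ 3 ≈ x ^ 3 - y ^ 3)) _
  poly-step = follows 5 (λ c x p q r → concl (c + x * (p + q * r) ≈ (c + x * p) + x * q * r)) _
  monic-step = follows 4 (λ c x p q → concl (c + x * (p + q) ≈ (c + x * p) + x * q)) _
  medial = follows 4 (λ a b c d → concl (a * b * (c * d) ≈ a * c * (b * d))) _
  Horner-step = follows 6 (λ c x a p r q → p ≈ r + (x - a) * q ∙[ x ]⇒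
    concl (c + x * p ≈ (c + a * r) + (x - a) * (r + x * q))) _
  Horner-base = follows 3 (λ c x a → concl (c + x * :1 ≈ (c + a * :1) + (x - a) * :1)) _
  root⇒ = follows 5 (λ P x R a q → P ≈ R + (x - a) * q ∙[ - :1 ]⇒ P ≈ :0 ∙[ :1 ]⇒ R ≈ :0 ∙[ - :1 ]⇒
    concl ((x - a) * q ≈ :0)) _
  factor-out = follows 2 (λ p a → concl (p * (a - :1) ≈ a * p - p)) _
  telescope = follows 3 (λ x y z → concl ((x - y) + (z - x) ≈ z - y)) _

module Char3Field (F : Field) (char3 : HasChar3 F) where
  open FieldProperties F public
  private module I = FieldIdentities F char3

  x*y≢0 : ∀ {x y} → x ≢ 0# → y ≢ 0# → x * y ≢ 0#
  x*y≢0 {x} {y} x≢0 y≢0 xy≡0 = y≢0 (begin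
    y            ≡⟨ *-identityˡ y ⟨
    1# * y       ≡⟨ cong (_* y) (proj₂ (inverse x x≢0)) ⟨
    x * x⁻¹ * y  ≡⟨ cong (_* y) (*-comm x x⁻¹) ⟩
    x⁻¹ * x * y  ≡⟨ *-assoc x⁻¹ x y ⟩
    x⁻¹ * (x * y) ≡⟨ cong (x⁻¹ *_) xy≡0 ⟩
    x⁻¹ * 0#     ≡⟨ zeroʳ x⁻¹ ⟩
    0#           ∎)
    where
    open ≡-Reasoning
    x⁻¹ = proj₁ (inverse x x≢0)

  x≢0⇒xⁿ≢0 : ∀ {x} → x ≢ 0# → ∀ n → x ^ n ≢ 0#
  x≢0⇒xⁿ≢0 x≢0 zero    = 0≢1 ∘ sym
  x≢0⇒xⁿ≢0 x≢0 (suc n) = x*y≢0 x≢0 (x≢0⇒xⁿ≢0 x≢0 n)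

  xy≡1⇒x≢0 : ∀ {x y} → x * y ≡ 1# → x ≢ 0#
  xy≡1⇒x≢0 xy≡1 refl = 0≢1 (trans (sym (zeroˡ _)) xy≡1)

  xy≢0⇒x≢0 : ∀ {x y} → x * y ≢ 0# → x ≢ 0#
  xy≢0⇒x≢0 xy≢0 refl = xy≢0 (zeroˡ _)

  xy≢0⇒y≢0 : ∀ {x y} → x * y ≢ 0# → y ≢ 0#
  xy≢0⇒y≢0 xy≢0 refl = xy≢0 (zeroʳ _)

  -x≢0 : ∀ {x} → x ≢ 0# → - x ≢ 0#
  -x≢0 {x} x≢0 -x≡0 = x≢0 (trans (sym (-‿involutive x)) (trans (cong -_ -x≡0) -0#≈0#))

  x≢y⇒x-y≢0 : ∀ {x y} → x ≢ y → x - y ≢ 0#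
  x≢y⇒x-y≢0 x≢y = x≢y ∘ Char3Solver.x-y≡0⇒x≡y char3

  ^-+ : ∀ x m n → x ^ (m ℕ.+ n) ≡ x ^ m * x ^ n
  ^-+ x zero    n = sym (*-identityˡ _)
  ^-+ x (suc m) n = trans (cong (x *_) (^-+ x m n)) (sym (*-assoc _ _ _))

  ^-3* : ∀ x m → x ^ (3 ℕ.* m) ≡ (x ^ m) ^ 3
  ^-3* x m = trans (^-+ x m _) (cong (x ^ m *_) (trans (^-+ x m _) (cong (x ^ m *_) (^-+ x m 0))))

  *-^ : ∀ x y m → (x * y) ^ m ≡ x ^ m * y ^ m
  *-^ x y zero    = sym (*-identityˡ 1#)
  *-^ x y (suc m) = trans (cong (x * y *_) (*-^ x y m)) (I.medial x y (x ^ m) (y ^ m))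

  1^ : ∀ m → 1# ^ m ≡ 1#
  1^ zero    = refl
  1^ (suc m) = trans (*-identityˡ _) (1^ m)

  ^3-^ : ∀ x m → (x ^ 3) ^ m ≡ (x ^ m) ^ 3
  ^3-^ x m = trans (*-^ x _ m) (cong (x ^ m *_) (trans (*-^ x _ m) (cong (x ^ m *_)
               (trans (*-^ x 1# m) (cong (x ^ m *_) (1^ m))))))

  Frobenius-minus : ∀ k x y → (x - y) ^ (3 ℕ.^ k) ≡ x ^ (3 ℕ.^ k) - y ^ (3 ℕ.^ k)
  Frobenius-minus zero    x y = trans (*-identityʳ _) (sym (cong₂ _-_ (*-identityʳ x) (*-identityʳ y)))
  Frobenius-minus (suc k) x y = begin
    (x - y) ^ (3 ℕ.* 3ᵏ)           ≡⟨ ^-3* (x - y) 3ᵏ ⟩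
    ((x - y) ^ 3ᵏ) ^ 3             ≡⟨ cong (_^ 3) (Frobenius-minus k x y) ⟩
    (x ^ 3ᵏ - y ^ 3ᵏ) ^ 3          ≡⟨ I.Frobenius-step _ _ ⟩
    (x ^ 3ᵏ) ^ 3 - (y ^ 3ᵏ) ^ 3    ≡⟨ cong₂ _-_ (^-3* x 3ᵏ) (^-3* y 3ᵏ) ⟨
    x ^ (3 ℕ.* 3ᵏ) - y ^ (3 ℕ.* 3ᵏ) ∎
    where
    open ≡-Reasoning
    3ᵏ = 3 ℕ.^ k

  ∏ : List Carrier → Carrier
  ∏ []       = 1#
  ∏ (x ∷ xs) = x * ∏ xs

  ∏-↭ : ∀ {xs ys} → xs ↭ ys → ∏ xs ≡ ∏ ys
  ∏-↭ ↭.refl = refl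
  ∏-↭ (↭.prep x p) = cong (x *_) (∏-↭ p)
  ∏-↭ (↭.swap x y p) = trans (sym (*-assoc x y _)) (trans (cong₂ _*_ (*-comm x y) (∏-↭ p)) (*-assoc y x _))
  ∏-↭ (↭.trans p q) = trans (∏-↭ p) (∏-↭ q)

  ∏-scale : ∀ a xs → ∏ (List.map (a *_) xs) ≡ a ^ length xs * ∏ xs
  ∏-scale a []       = sym (*-identityˡ 1#)
  ∏-scale a (x ∷ xs) = trans (cong (a * x *_) (∏-scale a xs)) (I.medial a x (a ^ length xs) (∏ xs))

  ∏≢0 : ∀ {xs} → All (_≢ 0#) xs → ∏ xs ≢ 0#
  ∏≢0 []           = 0≢1 ∘ sym
  ∏≢0 (x≢0 ∷ xs≢0) = x*y≢0 x≢0 (∏≢0 xs≢0)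

  -- Coefficients are listed from the constant term up; monic cs has the further
  -- leading term x ^ length cs.
  poly monic : List Carrier → Carrier → Carrier
  poly []       x = 0#
  poly (c ∷ cs) x = c + x * poly cs x
  monic []       x = 1#
  monic (c ∷ cs) x = c + x * monic cs x

  monic-poly : ∀ cs x → monic cs x ≡ poly cs x + x ^ length cs
  monic-poly []       x = sym (+-identityˡ 1#)
  monic-poly (c ∷ cs) x = trans (cong (λ p → c + x * p) (monic-poly cs x)) (I.monic-step c x _ _)

  poly-++ : ∀ cs ds x → poly (cs ++ ds) x ≡ poly cs x + x ^ length cs * poly ds x
  poly-++ []       ds x = sym (trans (+-identityˡ _) (*-identityˡ _))
  poly-++ (c ∷ cs) ds x = trans (cong (λ p → c + x * p) (poly-++ cs ds x)) (I.poly-step c x _ _ _)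

  poly-zeros : ∀ k x → poly (replicate k 0#) x ≡ 0#
  poly-zeros zero    x = refl
  poly-zeros (suc k) x = trans (+-identityˡ _) (trans (cong (x *_) (poly-zeros k x)) (zeroʳ x))

  quotient : Carrier → List Carrier → List Carrier
  quotient a []       = []
  quotient a (d ∷ ds) = monic (d ∷ ds) a ∷ quotient a ds

  length-quotient : ∀ a cs → length (quotient a cs) ≡ length cs
  length-quotient a []       = refl
  length-quotient a (d ∷ ds) = cong suc (length-quotient a ds)

  synthetic-division : ∀ c cs x a →
    monic (c ∷ cs) x ≡ monic (c ∷ cs) a + (x - a) * monic (quotient a cs) x
  synthetic-division c []       x a = I.Horner-base c x a
  synthetic-division c (d ∷ ds) x a =
    I.Horner-step c x a (monic (d ∷ ds) x) (monic (d ∷ ds) a) _ (synthetic-division d ds x a)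

  x*y≡0⇒y≡0 : DecidableEquality Carrier → ∀ {x y} → x ≢ 0# → x * y ≡ 0# → y ≡ 0#
  x*y≡0⇒y≡0 _≟_ {x} {y} x≢0 xy≡0 with y ≟ 0#
  ... | yes y≡0 = y≡0
  ... | no  y≢0 = contradiction xy≡0 (x*y≢0 x≢0 y≢0)

  root-bound : DecidableEquality Carrier → ∀ cs xs → AllPairs _≢_ xs →
               All (λ x → monic cs x ≡ 0#) xs → length xs ℕ.≤ length cs
  root-bound _≟_ cs       []       _           _              = z≤n
  root-bound _≟_ []       (x ∷ xs) _           (1≡0 ∷ _)      = contradiction (sym 1≡0) 0≢1
  root-bound _≟_ (c ∷ cs) (a ∷ xs) (a≢ ∷ xs!) (a-root ∷ roots) =
    s≤s (subst (length xs ℕ.≤_) (length-quotient a cs)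
          (root-bound _≟_ (quotient a cs) xs xs! (All.zipWith quotient-root (a≢ , roots))))
    where
    quotient-root : ∀ {x} → a ≢ x × monic (c ∷ cs) x ≡ 0# → monic (quotient a cs) x ≡ 0#
    quotient-root {x} (a≢x , x-root) = x*y≡0⇒y≡0 _≟_ (x≢y⇒x-y≢0 (a≢x ∘ sym))
      (I.root⇒ _ x _ a _ (synthetic-division c cs x a) x-root a-root)

-- Finite fields: decidability, pigeonhole and Fermat.

module Char3FiniteField (FF : FiniteField) (char3 : Char3 FF) where
  open FiniteField FF using (field'; elems; unique; complete; q) public
  open Char3Field field' char3 public
  private module I = FieldIdentities field' char3

  abstract
    infix 4 _≟_
    _≟_ : DecidableEquality Carrier
    x ≟ y = map′
      (λ i≡j → trans (Any.lookup-index (complete x))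
                 (trans (cong (lookup elems) i≡j) (sym (Any.lookup-index (complete y)))))
      (cong (index ∘ complete))
      (index (complete x) ≟ᶠ index (complete y))

    infix 21 _⁻¹
    -- The default value 0 at 0 matters: a singular matrix then sends every quartic to the zero
    -- vector (`▷-degenerate`), so that `▷-∝` holds for all matrices.
    _⁻¹ : Carrier → Carrier
    x ⁻¹ with x ≟ 0#
    ... | yes _   = 0#
    ... | no  x≢0 = proj₁ (inverse x x≢0)

    ⁻¹-inverse : ∀ {x} → x ≢ 0# → x * x ⁻¹ ≡ 1#
    ⁻¹-inverse {x} x≢0 with x ≟ 0#
    ... | yes x≡0 = contradiction x≡0 x≢0
    ... | no  x≢0 = proj₂ (inverse x x≢0)

    0⁻¹≡0 : 0# ⁻¹ ≡ 0#
    0⁻¹≡0 with 0# ≟ 0#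
    ... | yes _   = refl
    ... | no  0≢0 = contradiction refl 0≢0

  ⁻¹≢0 : ∀ {x} → x ≢ 0# → x ⁻¹ ≢ 0#
  ⁻¹≢0 x≢0 = xy≡1⇒x≢0 (trans (*-comm _ _) (⁻¹-inverse x≢0))

  x*y≡0⇒ : ∀ {x y} → x * y ≡ 0# → x ≡ 0# ⊎ y ≡ 0#
  x*y≡0⇒ {x} xy≡0 with x ≟ 0#
  ... | yes x≡0 = inj₁ x≡0
  ... | no  x≢0 = inj₂ (x*y≡0⇒y≡0 _≟_ x≢0 xy≡0)

  ∃? : ∀ {p} {P : Carrier → Set p} → Decidable₁ P → Dec (∃ P)
  ∃? P? = map′ (λ any → let (x , _ , Px) = find any in x , Px)
               (λ (x , Px) → lose (complete x) Px) (any? P? elems)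

  x²≡y²⇒ : ∀ {x y} → x * x ≡ y * y → x ≡ y ⊎ x ≡ - y
  x²≡y²⇒ {x} {y} eq with x*y≡0⇒ (I.x²≈y²⇒ x y eq)
  ... | inj₁ x-y≡0 = inj₁ (Char3Solver.x-y≡0⇒x≡y char3 x-y≡0)
  ... | inj₂ x+y≡0 = inj₂ (I.sum≈0⇒ x y x+y≡0)

  count-all : ClassCount _≡_ (λ (_ : Carrier) → ⊤) q
  count-all = elems , refl , All.tabulate _ , unique , λ x _ → complete x

  count-zero : ClassCount _≡_ (λ x → ⊤ × x ≡ 0#) 1
  count-zero = 0# ∷ [] , refl , (tt , refl) ∷ [] , [] ∷ [] , λ x (_ , x≡0) → here x≡0

  abstract
    nonzero-count : ∃ λ q-1 → suc q-1 ≡ q × ClassCount _≡_ (_≢ 0#) q-1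
    nonzero-count = let (k , eq , count) = ClassCount-complement isEquivalence (_≟ 0#) (λ { refl → id }) count-all count-zero
                    in k , eq , ClassCount-resp proj₂ (tt ,_) count

  injective⇒surjective : (f : Carrier → Carrier) → (∀ {x y} → f x ≡ f y → x ≡ y) →
                         ∀ y → ∃ λ x → f x ≡ y
  injective⇒surjective f f-inj y with ∃? (λ x → f x ≟ y)
  ... | yes hit = hit
  ... | no miss = contradiction
        (length-≤ isEquivalence {y ∷ List.map f elems} {elems}
           (All.map⁺ (All.tabulate (λ {x} _ y≡fx → miss (x , sym y≡fx))) ∷
            AllPairs.map⁺ (AllPairs.map (_∘ f-inj) unique))
           (All.tabulate (λ {x} _ → complete x)))
        (ℕ.<⇒≱ (s≤s (ℕ.≤-reflexive (sym (length-map f elems)))))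

  -- Multiplication by a nonzero x permutes the nonzero elements; comparing their product before and
  -- after gives x^(q-1) = 1.
  Fermat : ∀ x → x ^ q ≡ x
  Fermat x with nonzero-count | x ≟ 0#
  ... | (_ , 1+k≡q , _) | yes refl rewrite sym 1+k≡q = zeroˡ _
  ... | (_ , 1+k≡q , xs , refl , xs≢0 , xs! , xs-all) | no x≢0 rewrite sym 1+k≡q =
    trans (cong (x *_) x^k≡1) (*-identityʳ x)
    where
    open ≡-Reasoning
    *-cancel : ∀ {y z} → x * y ≡ x * z → y ≡ z
    *-cancel {y} {z} eq = begin
      y                ≡⟨ *-identityˡ y ⟨
      1# * y           ≡⟨ cong (_* y) x⁻¹x≡1 ⟨
      x ⁻¹ * x * y     ≡⟨ *-assoc _ _ _ ⟩
      x ⁻¹ * (x * y)   ≡⟨ cong (x ⁻¹ *_) eq ⟩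
      x ⁻¹ * (x * z)   ≡⟨ *-assoc _ _ _ ⟨
      x ⁻¹ * x * z     ≡⟨ cong (_* z) x⁻¹x≡1 ⟩
      1# * z           ≡⟨ *-identityˡ z ⟩
      z                ∎
      where x⁻¹x≡1 = trans (*-comm _ _) (⁻¹-inverse x≢0)
    ∈-scaled : ∀ {y} → y ∈ xs → y ∈ List.map (x *_) xs
    ∈-scaled {y} y∈ = subst (_∈ _) (begin
        x * (x ⁻¹ * y) ≡⟨ *-assoc _ _ _ ⟨
        x * x ⁻¹ * y   ≡⟨ cong (_* y) (⁻¹-inverse x≢0) ⟩
        1# * y         ≡⟨ *-identityˡ y ⟩
        y              ∎)
      (∈-map⁺ (x *_) (xs-all (x ⁻¹ * y) (x*y≢0 (⁻¹≢0 x≢0) (All.lookup xs≢0 y∈))))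
    scaled : List.map (x *_) xs ↭ xs
    scaled = ∼bag⇒↭ (unique∧set⇒bag (AllPairs.map⁺ (AllPairs.map (_∘ *-cancel) xs!)) xs! (mk⇔
      (λ y∈ → let (z , z∈ , y≡xz) = ∈-map⁻ (x *_) y∈ in
        xs-all _ (subst (_≢ 0#) (sym y≡xz) (x*y≢0 x≢0 (All.lookup xs≢0 z∈))))
      ∈-scaled))
    x^k≡1 : x ^ length xs ≡ 1#
    x^k≡1 = Char3Solver.x-y≡0⇒x≡y char3 (x*y≡0⇒y≡0 _≟_ (∏≢0 xs≢0) (begin
      ∏ xs * (x ^ length xs - 1#)        ≡⟨ I.factor-out _ _ ⟩
      x ^ length xs * ∏ xs - ∏ xs        ≡⟨ cong (_- ∏ xs) (∏-scale x xs) ⟨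
      ∏ (List.map (x *_) xs) - ∏ xs           ≡⟨ cong (_- ∏ xs) (∏-↭ scaled) ⟩
      ∏ xs - ∏ xs                        ≡⟨ -‿inverseʳ _ ⟩
      0#                                 ∎))

-- The trace and the sizes of J₁, J₂ and J₄.

module InverseIdentities (F : Field) (char3 : HasChar3 F) where
  open FieldProperties.Char3Solver F char3 using (follows)
  open Expressions
  inverse-unique = follows 3 (λ u i s → u * i ≈ :1 ∙[ - s ]⇒ s * u ≈ :1 ∙[ i ]⇒ concl (s ≈ i)) _
  inverse-squares = follows 4 (λ u v i j →
    u * i ≈ :1 ∙[ v * v * (u * i + :1) ]⇒ v * j ≈ :1 ∙[ - (u * u * (v * j + :1)) ]⇒
    i * i ≈ j * j ∙[ - (u * u * v * v) ]⇒ concl (u * u ≈ v * v)) _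

module TraceCounting (FF : FiniteField) (char3 : Char3 FF) (m : ℕ)
                     (q≡3ⁿ : FiniteField.q FF ≡ 3 ℕ.^ suc m) where
  open Char3FiniteField FF char3 public
  open PG3 FF using (Tr; J₁; J₂; J₄)
  private
    module I = FieldIdentities field' char3
    module I′ = InverseIdentities field' char3
    n = suc m

  ℘ : Carrier → Carrier
  ℘ s = s ^ 3 - s

  -- The sum of the conjugates of s³ - s telescopes; for k = n Fermat then makes it vanish.
  Tr-℘ : ∀ k s → Tr k (℘ s) ≡ s ^ (3 ℕ.^ k) - s
  Tr-℘ zero    s = sym (trans (cong (_- s) (*-identityʳ s)) (-‿inverseʳ s))
  Tr-℘ (suc k) s = begin
    Tr k (℘ s) + ℘ s ^ 3ᵏ
      ≡⟨ cong₂ _+_ (Tr-℘ k s) (Frobenius-minus k (s ^ 3) s) ⟩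
    (s ^ 3ᵏ - s) + ((s ^ 3) ^ 3ᵏ - s ^ 3ᵏ)
      ≡⟨ I.telescope _ _ _ ⟩
    (s ^ 3) ^ 3ᵏ - s
      ≡⟨ cong (_- s) (trans (^3-^ s 3ᵏ) (sym (^-3* s 3ᵏ))) ⟩
    s ^ (3 ℕ.* 3ᵏ) - s ∎
    where
    open ≡-Reasoning
    3ᵏ = 3 ℕ.^ k

  Tr-℘≡0 : ∀ s → Tr n (℘ s) ≡ 0#
  Tr-℘≡0 s = trans (Tr-℘ n s)
    (trans (cong (_- s) (trans (cong (s ^_) (sym q≡3ⁿ)) (Fermat s))) (-‿inverseʳ s))

  -- Padding with zeros to exactly 3^k coefficients places the next summand x^(3^k) right behind the
  -- list. In `Tr-monic` that summand is the leading term, so the trace has degree 3^m.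
  Tr-poly : ∀ k → ∃ λ cs → length cs ≡ 3 ℕ.^ k × (∀ x → poly cs x ≡ Tr k x)
  Tr-poly zero    = 0# ∷ [] , refl , λ x → trans (+-identityˡ _) (zeroʳ x)
  Tr-poly (suc k) with Tr-poly k
  ... | cs , len , eq = cs ++ 1# ∷ replicate padding 0# ,
    trans (length-++ cs) (cong₂ ℕ._+_ len (trans (cong suc (length-replicate padding)) 1+padding)) ,
    λ x → trans (poly-++ cs _ x) (cong₂ _+_ (eq x) (begin
      x ^ length cs * (1# + x * poly (replicate padding 0#) x)
        ≡⟨ cong₂ (λ l p → x ^ l * (1# + x * p)) len (poly-zeros padding x) ⟩
      x ^ 3ᵏ * (1# + x * 0#) ≡⟨ cong (λ p → x ^ 3ᵏ * (1# + p)) (zeroʳ x) ⟩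
      x ^ 3ᵏ * (1# + 0#)     ≡⟨ cong (x ^ 3ᵏ *_) (+-identityʳ 1#) ⟩
      x ^ 3ᵏ * 1#            ≡⟨ *-identityʳ _ ⟩
      x ^ 3ᵏ                 ∎))
    where
    open ≡-Reasoning
    3ᵏ = 3 ℕ.^ k
    padding = ℕ.pred (3ᵏ ℕ.+ (3ᵏ ℕ.+ 0))
    1+padding : suc padding ≡ 3ᵏ ℕ.+ (3ᵏ ℕ.+ 0)
    1+padding = ℕ.suc-pred _ {{ℕ.>-nonZero (ℕ.≤-trans (ℕ.m^n>0 3 k) (ℕ.m≤m+n 3ᵏ _))}}

  Tr-monic : ∃ λ cs → length cs ≡ 3 ℕ.^ m × (∀ x → monic cs x ≡ Tr n x)
  Tr-monic = let (cs , len , eq) = Tr-poly m in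
    cs , len , λ x → trans (monic-poly cs x) (cong₂ _+_ (eq x) (cong (x ^_) len))

  _≈℘_ : Carrier → Carrier → Set
  x ≈℘ y = ℘ x ≡ ℘ y

  ℘-fibre-count : ∀ a → ⊤ → ClassCount _≡_ (λ b → ⊤ × a ≈℘ b) 3
  ℘-fibre-count a _ =
    a ∷ a + 1# ∷ a + 1# + 1# ∷ [] , refl ,
    (tt , refl) ∷ (tt , I.℘+1 a) ∷ (tt , I.℘+2 a) ∷ [] ,
    (1≢0 ∘ I.x≈x+1⇒ a ∷ 1≢0 ∘ I.x≈x+2⇒ a ∷ []) ∷ (1≢0 ∘ I.x+1≈x+2⇒ a ∷ []) ∷ [] ∷ [] ,
    λ b (_ , eq) → [ (λ z → here (x-y≡0⇒x≡y z)) ,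
                     (λ z → there ([ here ∘ x-y≡0⇒x≡y , there ∘ here ∘ x-y≡0⇒x≡y ]′ (x*y≡0⇒ z))) ]′
                   (x*y≡0⇒ (I.℘-split b a (sym eq)))
    where
    open Char3Solver char3 using (x-y≡0⇒x≡y)
    1≢0 : 1# ≢ 0#
    1≢0 = 0≢1 ∘ sym

  ℘-image-count : ClassCount _≡_ (λ u → ∃ λ s → u ≡ ℘ s) (3 ℕ.^ m)
  ℘-image-count =
    let (k , k*3≡q , count) = ClassCount-quotient (On.isEquivalence ℘ isEquivalence) (λ x y → ℘ x ≟ ℘ y) 3
                                isEquivalence (cong ℘) count-all ℘-fibre-count
        k≡3ᵐ = ℕ.*-cancelʳ-≡ k (3 ℕ.^ m) 3 (trans k*3≡q (trans q≡3ⁿ (ℕ.*-comm 3 (3 ℕ.^ m))))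
    in subst (ClassCount _≡_ _) k≡3ᵐ
         (ClassCount-image trans ℘ (λ {s} _ → s , refl) (λ _ _ → id) (λ _ _ → id)
            (λ u (s , eq) → s , tt , eq) count)

  -- The image of ℘ already provides 3 ^ m roots of the trace polynomial, which has degree 3 ^ m.
  Tr≡0⇒℘ : ∀ u → Tr n u ≡ 0# → ∃ λ s → u ≡ ℘ s
  Tr≡0⇒℘ u Tr≡0 with ∃? (λ s → u ≟ ℘ s)
  ... | yes found = found
  ... | no  none  =
    let (cs , len-cs , eval-cs)   = Tr-monic
        (us , len-us , us∈℘ , us! , _) = ℘-image-count
    in contradiction
         (root-bound _≟_ cs (u ∷ us)
           (All.map (λ { (s , refl) u≡℘s → none (s , u≡℘s) }) us∈℘ ∷ us!)
           (trans (eval-cs u) Tr≡0 ∷ All.map (λ { (s , refl) → trans (eval-cs (℘ s)) (Tr-℘≡0 s) }) us∈℘))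
         (ℕ.<⇒≱ (s≤s (ℕ.≤-reflexive (trans len-cs (sym len-us)))))

  Tr-neg : ∀ {u} → Tr n u ≡ 0# → Tr n (- u) ≡ 0#
  Tr-neg {u} Tr≡0 = let (s , u≡℘s) = Tr≡0⇒℘ u Tr≡0 in
    subst (λ v → Tr n v ≡ 0#) (trans (I.℘-neg s) (cong -_ (sym u≡℘s))) (Tr-℘≡0 (- s))

  Tr-0 : Tr n 0# ≡ 0#
  Tr-0 = subst (λ v → Tr n v ≡ 0#) I.℘0 (Tr-℘≡0 0#)

  kernel-count : ClassCount _≡_ (λ u → Tr n u ≡ 0#) (3 ℕ.^ m)
  kernel-count = ClassCount-resp (λ { (s , refl) → Tr-℘≡0 s }) (Tr≡0⇒℘ _) ℘-image-count

  _≈±_ : Carrier → Carrier → Set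
  x ≈± y = x * x ≡ y * y

  ±-count : ∀ {P : Carrier → Set} → (∀ {u} → P u → u ≢ 0#) → (∀ {u} → P u → P (- u)) →
            ∀ {N} → ClassCount _≡_ P N → ∃ λ k → k ℕ.* 2 ≡ N × ClassCount _≈±_ P k
  ±-count P⇒≢0 P-neg count =
    ClassCount-quotient (On.isEquivalence (λ x → x * x) isEquivalence) (λ x y → x * x ≟ y * y) 2
      isEquivalence (cong (λ x → x * x)) count
      (λ u Pu → u ∷ - u ∷ [] , refl , (Pu , refl) ∷ (P-neg Pu , sym (I.neg-sq u)) ∷ [] ,
        (P⇒≢0 Pu ∘ I.x≈-x⇒ u ∷ []) ∷ [] ∷ [] ,
        λ v (_ , u²≡v²) → [ here , there ∘ here ]′ (x²≡y²⇒ (sym u²≡v²)))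

  -- A square r = s² is the same as a pair ±u with u = 1/s, and r = u⁻²; this turns the conditions
  -- on 1/√r in `J₁` and `J₄` into conditions on u.
  ⁻²-count : ∀ {P : Carrier → Set} → (∀ {u} → P u → u ≢ 0#) → ∀ {k} → ClassCount _≈±_ P k →
    ClassCount _≡_ (λ r → r ≢ 0# × ∃ λ s → ∃ λ u → s * s ≡ r × s * u ≡ 1# × P u) k
  ⁻²-count P⇒≢0 = ClassCount-image trans (λ u → u ⁻¹ * u ⁻¹)
    (λ {u} Pu → x*y≢0 (⁻¹≢0 (P⇒≢0 Pu)) (⁻¹≢0 (P⇒≢0 Pu)) ,
                u ⁻¹ , u , refl , trans (*-comm _ _) (⁻¹-inverse (P⇒≢0 Pu)) , Pu)
    (λ {u} {v} Pu Pv → I′.inverse-squares u v _ _ (⁻¹-inverse (P⇒≢0 Pu)) (⁻¹-inverse (P⇒≢0 Pv)))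
    (λ {u} {v} Pu Pv → I′.inverse-squares (u ⁻¹) (v ⁻¹) u v
       (trans (*-comm _ _) (⁻¹-inverse (P⇒≢0 Pu))) (trans (*-comm _ _) (⁻¹-inverse (P⇒≢0 Pv))))
    (λ { r (_ , s , u , refl , su≡1 , Pu) → u , Pu ,
         let s≡u⁻¹ = I′.inverse-unique u (u ⁻¹) s (⁻¹-inverse (P⇒≢0 Pu)) su≡1 in cong₂ _*_ s≡u⁻¹ s≡u⁻¹ })

  abstract
    -- The 3^n - 3^m elements of nonzero trace fall into pairs ±u, one pair for each r.
    J₁-count : ∃ λ k → 3 ℕ.^ m ℕ.+ k ℕ.* 2 ≡ 3 ℕ.^ n × ClassCount _≡_ (J₁ n) k
    J₁-count =
      let (l , 3ᵐ+l≡q , count) = ClassCount-complement isEquivalence (λ u → Tr n u ≟ 0#) (λ { refl → id })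
                                  count-all (ClassCount-resp (tt ,_) proj₂ kernel-count)
          (k , k*2≡l , count±) = ±-count (λ { (_ , Tr≢0) refl → Tr≢0 Tr-0 })
                                   (λ { (_ , Tr≢0) → tt , λ Tr≡0 → Tr≢0 (subst (λ v → Tr n v ≡ 0#) (-‿involutive _) (Tr-neg Tr≡0)) })
                                   count
      in k , trans (cong (3 ℕ.^ m ℕ.+_) k*2≡l) (trans 3ᵐ+l≡q q≡3ⁿ) ,
         ClassCount-resp (λ { (r≢0 , s , u , e , f , (_ , g)) → r≢0 , s , u , e , f , g })
                         (λ { (r≢0 , s , u , e , f , g) → r≢0 , s , u , e , f , (tt , g) })
           (⁻²-count (λ { (_ , Tr≢0) refl → Tr≢0 Tr-0 }) count±)

    J₄-count : ∃ λ k → suc (k ℕ.* 2) ≡ 3 ℕ.^ m × ClassCount _≡_ (J₄ n) k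
    J₄-count =
      let (l , 1+l≡3ᵐ , count) = ClassCount-complement isEquivalence (_≟ 0#) (λ { refl → id }) kernel-count
                                   (0# ∷ [] , refl , (Tr-0 , refl) ∷ [] , [] ∷ [] , λ x (_ , x≡0) → here x≡0)
          (k , k*2≡l , count±) = ±-count proj₂ (λ (Tr≡0 , u≢0) → Tr-neg Tr≡0 , -x≢0 u≢0) count
      in k , trans (cong suc k*2≡l) 1+l≡3ᵐ ,
         ClassCount-resp (λ { (r≢0 , s , u , e , f , (g , _)) → r≢0 , s , u , e , f , g })
                         (λ { (r≢0 , s , u , e , f , g) → r≢0 , s , u , e , f , (g , xy≢0⇒y≢0 (subst (_≢ 0#) (sym f) (0≢1 ∘ sym))) })
           (⁻²-count proj₂ count±)

    -- The nonzero squares correspond to the pairs ±s, hence are half of the nonzero elements, and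
    -- the non-squares are the other half.
    J₂-count : ∃ λ k → suc (k ℕ.* 2) ≡ q × ClassCount _≡_ J₂ k
    J₂-count =
      let (l , 1+l≡q , count)    = nonzero-count
          (k , k*2≡l , count±)   = ±-count id -x≢0 count
          (k′ , k+k′≡l , count′) = ClassCount-complement isEquivalence (λ r → ∃? (λ s → s * s ≟ r)) (λ { refl → id }) count
            (ClassCount-image trans (λ s → s * s) (λ {s} s≢0 → x*y≢0 s≢0 s≢0 , s , refl) (λ _ _ → id) (λ _ _ → id)
               (λ { r (r≢0 , s , refl) → s , xy≢0⇒x≢0 r≢0 , refl }) count±)
          k′≡k = ℕ.+-cancelˡ-≡ k k′ k (trans k+k′≡l (trans (sym k*2≡l)
                   (trans (ℕ.*-comm k 2) (cong (k ℕ.+_) (ℕ.+-identityʳ k)))))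
      in k , trans (cong suc k*2≡l) 1+l≡q , subst (ClassCount _≡_ J₂) k′≡k count′

-- Matrices acting on quartics, and the invariance of the discriminant.

module ActionExpressions {n : ℕ} where
  open Expressions public
  open V4 public

  E E⁴ : Set
  E  = Expr n
  E⁴ = V4 E

  infixl 7 _∙_ _·_
  det : E⁴ → E
  det ⟨ a , b , c , d ⟩ = a * d - b * c

  _∙_ : E⁴ → E⁴ → E⁴
  ⟨ a , b , c , d ⟩ ∙ ⟨ p , q , r , s ⟩ = ⟨ a * p + b * r , a * q + b * s , c * p + d * r , c * q + d * s ⟩

  _·_ : E → E⁴ → E⁴
  k · ⟨ a , b , c , d ⟩ = ⟨ k * a , k * b , k * c , k * d ⟩

  adj : E⁴ → E⁴
  adj ⟨ a , b , c , d ⟩ = ⟨ d , - b , - c , a ⟩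

  𝐈 : E⁴
  𝐈 = ⟨ :1 , :0 , :0 , :1 ⟩

  diagonal : E → V4 E⁴
  diagonal k = ⟨ ⟨ k , :0 , :0 , :0 ⟩ , ⟨ :0 , k , :0 , :0 ⟩ , ⟨ :0 , :0 , k , :0 ⟩ , ⟨ :0 , :0 , :0 , k ⟩ ⟩

  lhs rhs : E⁴ → E⁴ → E⁴
  lhs g@(⟨ a , b , c , d ⟩) ⟨ z0 , z1 , z3 , z4 ⟩ =
    ⟨ a ^ 2 * c + a * D * z1 - b * D * z0 , a * c ^ 2 - c * D * z1 + d * D * z0
    , a * D * z4 - b * D * z3 + b ^ 2 * d , b * d ^ 2 + (d * D * z3 - c * D * z4) ⟩
    where D = det g
  rhs ⟨ a , b , c , d ⟩ ⟨ z0 , z1 , z3 , z4 ⟩ =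
    ⟨ a ^ 3 * z1 + c ^ 3 * z4 , a ^ 3 * z0 + c ^ 3 * z3 , b ^ 3 * z1 + d ^ 3 * z4 , b ^ 3 * z0 + d ^ 3 * z3 ⟩

  Acts : E⁴ → E⁴ → E⁴ → Equation⁴ n
  Acts g z y = lhs g z ≈⁴ rhs g y

  Acts₁ Acts₂ Acts₃ Acts₄ : E⁴ → E⁴ → Equation n
  Acts₁ g z = c0 (lhs g z) ≈ c0 (rhs g z)
  Acts₂ g z = c1 (lhs g z) ≈ c1 (rhs g z)
  Acts₃ g z = c2 (lhs g z) ≈ c2 (rhs g z)
  Acts₄ g z = c3 (lhs g z) ≈ c3 (rhs g z)

  -- The solution of the equations `Acts`. They are linear in the image, with the entrywise cube of
  -- g as coefficients; its determinant is D³, and one factor D cancels against the left sides,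
  -- which leaves `i ^ 2`.
  image : E⁴ → E⁴ → E → E⁴
  image ⟨ a , b , c , d ⟩ ⟨ z0 , z1 , z3 , z4 ⟩ i = i ^ 2 ·
    ⟨ d ^ 3 * (d * z0 - c * z1) - c ^ 3 * (d * z3 - c * z4) + (c * d) ^ 2
    , d ^ 3 * (a * z1 - b * z0) - c ^ 3 * (a * z4 - b * z3) + c * d * (a * d + b * c)
    , a ^ 3 * (d * z3 - c * z4) - b ^ 3 * (d * z0 - c * z1) + a * b * (a * d + b * c)
    , a ^ 3 * (a * z4 - b * z3) - b ^ 3 * (a * z1 - b * z0) + (a * b) ^ 2 ⟩

  disc : E⁴ → E
  disc ⟨ z0 , z1 , z3 , z4 ⟩ = w ^ 3 + w ^ 2 - (z0 * z3 ^ 2 + z4 * z1 ^ 2 - z0 * z4)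
    where w = z0 * z4 - z1 * z3

  translate : E → E⁴ → E⁴
  translate u ⟨ z0 , z1 , z3 , z4 ⟩ =
    ⟨ z0 , z1 - u * z0 , z3 + u - u ^ 3 * z0 , z4 - u * z3 + u ^ 2 - u ^ 3 * (z1 - u * z0) ⟩

  reverse : E⁴ → E⁴
  reverse ⟨ z0 , z1 , z3 , z4 ⟩ = ⟨ z4 , z3 , z1 , z0 ⟩

  fixed : (β z0 z1 : E) → E⁴
  fixed β z0 z1 = ⟨ z0 , z1 , β * z1 , β ^ 2 * z0 ⟩

  -- The traceless matrices that anticommute with (0 β; 1 0), that is, commute with it up to a
  -- scalar.
  commuting : (β a c : E) → E⁴
  commuting β a c = ⟨ a , - (β * c) , c , - a ⟩

  -- The binary quadratic form in (a : c) whose zeros with nonzero determinant give the further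
  -- involutions. With B = 1 - βz0 its discriminant B² - 4βz1² is B² - βz1² in characteristic 3.
  conic : (β z0 z1 a c : E) → E
  conic β z0 z1 a c = z1 * (a ^ 2 + β * c ^ 2) + (:1 - β * z0) * (a * c)

module ActionIdentities (F : Field) (char3 : HasChar3 F) where
  open FieldProperties.Char3Solver F char3 using (follows; follows⁴)
  open ActionExpressions

  Acts-image = follows⁴ 2 1 (λ g z i → det g * i ≈ :1 ∙[ - (det g * i + :1) · lhs g z ]⇒
    concl⁴ (Acts g z (image g z i))) _

  Acts-unique = follows⁴ 3 1 (λ g z y i → let ⟨ a , b , c , d ⟩ = g
                                              k = - (det g * i - :1) ^ 2
                                              ⟨ z0 , z1 , z3 , z4 ⟩ = image g z i in
    det g * i ≈ :1 ∙[ ⟨ z0 + k * c0 y , z1 + k * c1 y , z3 + k * c2 y , z4 + k * c3 y ⟩ ]⇒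
    Acts g z y ∙⁴[ ⟨ ⟨ :0 , - (i * d) ^ 3 , :0 , (i * c) ^ 3 ⟩ , ⟨ - (i * d) ^ 3 , :0 , (i * c) ^ 3 , :0 ⟩
                   , ⟨ :0 , (i * b) ^ 3 , :0 , - (i * a) ^ 3 ⟩ , ⟨ (i * b) ^ 3 , :0 , - (i * a) ^ 3 , :0 ⟩ ⟩ ]⇒
    concl⁴ (y ≈⁴ image g z i)) _

  Acts-∙ = follows⁴ 5 0 (λ g h z y x → let ⟨ a , b , c , d ⟩ = g; D = det g; ⟨ p , q , r , s ⟩ = h in
    Acts h z y ∙⁴[ ⟨ ⟨ a * D , - (b * D) , :0 , :0 ⟩ , ⟨ - (c * D) , d * D , :0 , :0 ⟩
                   , ⟨ :0 , :0 , a * D , - (b * D) ⟩ , ⟨ :0 , :0 , - (c * D) , d * D ⟩ ⟩ ]⇒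
    Acts g y x ∙⁴[ ⟨ ⟨ p ^ 3 , :0 , r ^ 3 , :0 ⟩ , ⟨ :0 , p ^ 3 , :0 , r ^ 3 ⟩
                   , ⟨ q ^ 3 , :0 , s ^ 3 , :0 ⟩ , ⟨ :0 , q ^ 3 , :0 , s ^ 3 ⟩ ⟩ ]⇒
    concl⁴ (Acts (g ∙ h) z x)) _

  Acts-· = follows⁴ 3 1 (λ g z y k → Acts g z y ∙⁴[ diagonal (k ^ 3) ]⇒ concl⁴ (Acts (k · g) z y)) _
  Acts-𝐈 = follows⁴ 1 0 (λ z → concl⁴ (Acts 𝐈 z z)) _
  Acts-translation = follows⁴ 1 1 (λ z u → concl⁴ (Acts ⟨ :1 , u , :0 , :1 ⟩ z (translate u z))) _
  Acts-swap = follows⁴ 1 0 (λ z → concl⁴ (Acts ⟨ :0 , :1 , :1 , :0 ⟩ z (reverse z))) _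
  Acts-diagonal = follows⁴ 1 4 (λ z a d α δ → let ⟨ z0 , z1 , z3 , z4 ⟩ = z in
    a * α ≈ :1 ∙[ ⟨ - (a ^ 2 * d * z1) , - (a * d ^ 2 * z0 * (a * α + :1)) , :0 , :0 ⟩ ]⇒
    d * δ ≈ :1 ∙[ ⟨ :0 , :0 , - (a ^ 2 * d * z4 * (d * δ + :1)) , - (a * d ^ 2 * z3) ⟩ ]⇒
    concl⁴ (Acts ⟨ a , :0 , :0 , d ⟩ z ⟨ (d * α) ^ 2 * z0 , d * α * z1 , a * δ * z3 , (a * δ) ^ 2 * z4 ⟩)) _

  disc-translate = follows 5 (λ u z0 z1 z3 z4 → let z = ⟨ z0 , z1 , z3 , z4 ⟩ in concl (disc (translate u z) ≈ disc z)) _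
  disc-reverse = follows 4 (λ z0 z1 z3 z4 → let z = ⟨ z0 , z1 , z3 , z4 ⟩ in concl (disc (reverse z) ≈ disc z)) _
  disc-diagonal = follows 6 (λ ρ σ z0 z1 z3 z4 →
    let p = ρ * σ; t = (p + :1) * (z0 * z4) - z1 * z3 in
    ρ * σ ≈ :1 ∙[ (p - :1) ^ 2 * t ^ 3
                + t * (p ^ 2 * (z0 * z4) - p * (z1 * z3) + z0 * z4 - z1 * z3)
                - (p + :1) * (z0 * z3 ^ 2 + z4 * z1 ^ 2 - z0 * z4) ]⇒
    concl (disc ⟨ ρ ^ 2 * z0 , ρ * z1 , σ * z3 , σ ^ 2 * z4 ⟩ ≈ disc ⟨ z0 , z1 , z3 , z4 ⟩)) _
  diagonal-inverse = follows 4 (λ a d α δ → a * α ≈ :1 ∙[ d * δ ]⇒ d * δ ≈ :1 ∙[ :1 ]⇒ concl ((d * α) * (a * δ) ≈ :1)) _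

  companion-z4 = follows 6 (λ β δ z0 z1 z3 z4 → Acts₁ ⟨ :0 , β , :1 , δ ⟩ ⟨ z0 , z1 , z3 , z4 ⟩ ∙[ - :1 ]⇒
    concl (z4 ≈ β ^ 2 * z0)) _
  companion-z3 = follows 6 (λ β δ z0 z1 z3 z4 → Acts₂ ⟨ :0 , β , :1 , δ ⟩ ⟨ z0 , z1 , z3 , z4 ⟩ ∙[ - :1 ]⇒
    concl (z3 ≈ β * (z1 - δ * z0))) _
  companion-z0 = follows 4 (λ β δ z0 z1 →
    Acts₃ ⟨ :0 , β , :1 , δ ⟩ ⟨ z0 , z1 , β * (z1 - δ * z0) , β ^ 2 * z0 ⟩ ∙[ :1 ]⇒
    concl (β ^ 2 * (δ * (:1 - z0 * (β + δ ^ 2))) ≈ :0)) _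
  companion-z1 = follows 4 (λ β δ z0 z1 →
    Acts₄ ⟨ :0 , β , :1 , δ ⟩ ⟨ z0 , z1 , β * (z1 - δ * z0) , β ^ 2 * z0 ⟩ ∙[ :1 ]⇒
    concl (β * (δ * (δ - (β + δ ^ 2) * (z1 - δ * z0))) ≈ :0)) _
  companion-solve = follows 4 (λ β δ z0 z1 →
    :1 - z0 * (β + δ ^ 2) ≈ :0 ∙[ z1 - δ * z0 ]⇒ δ - (β + δ ^ 2) * (z1 - δ * z0) ≈ :0 ∙[ - z0 ]⇒
    concl (z1 ≈ - (δ * z0))) _
  companion-disc = follows 3 (λ β δ z0 →
    let y = β * z0; p = z0 * (β + δ ^ 2) - :1 in
    :1 - z0 * (β + δ ^ 2) ≈ :0 ∙[ - (y ^ 2 * (y * p ^ 2 + p)) ]⇒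
    concl (disc ⟨ z0 , - (δ * z0) , β * (- (δ * z0) - δ * z0) , β ^ 2 * z0 ⟩ ≈ :0)) _

  conic⇐₁ = follows 5 (λ β z0 z1 a c → Acts₁ (commuting β a c) (fixed β z0 z1) ∙[ :1 ]⇒
    concl (a * conic β z0 z1 a c ≈ :0)) _
  conic⇐₂ = follows 5 (λ β z0 z1 a c → Acts₂ (commuting β a c) (fixed β z0 z1) ∙[ :1 ]⇒
    concl (c * conic β z0 z1 a c ≈ :0)) _
  conic⇒ = follows⁴ 0 5 (λ β z0 z1 a c → conic β z0 z1 a c ≈ :0 ∙[ ⟨ a , c , - (β ^ 2 * c) , - (β * a) ⟩ ]⇒
    concl⁴ (Acts (commuting β a c) (fixed β z0 z1) (fixed β z0 z1))) _
  involution = follows⁴ 0 3 (λ β z0 z1 → concl⁴ (Acts ⟨ :0 , β , :1 , :0 ⟩ (fixed β z0 z1) (fixed β z0 z1))) _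
  involution-disc = follows 3 (λ β z0 z1 → concl (disc (fixed β z0 z1) ≈
    (β ^ 2 * z0 ^ 2 - β * z1 ^ 2 + β * z0) ^ 2 * ((:1 - β * z0) ^ 2 - β * z1 ^ 2))) _
  involution-root = follows 3 (λ β z0 z1 → concl (
    (:1 - β * z0) ^ 2 - β * z1 ^ 2 ≈ :1 + (β ^ 2 * z0 ^ 2 - β * z1 ^ 2 + β * z0))) _

  -- The form z1X³Y + X²Y² + z4Y⁴ has the root ∞, and X/Y = θ/z1 is another one because θ³ + θ² =
  -- -z1²z4. The traceless matrix with first column (θ, z1) exchanges these two; the entry -sζ is
  -- the value for which it also exchanges the remaining two roots.
  rational-root = follows⁴ 0 3 (λ θ z1 ζ → let s = θ ^ 2 + θ; z = ⟨ :0 , z1 , :0 , - ((θ ^ 3 + θ ^ 2) * ζ ^ 2) ⟩ in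
    z1 * ζ ≈ :1 ∙[ ⟨ z1 * θ ^ 2 * (:1 + θ) * (z1 * ζ - :1) , - (z1 ^ 2 * s)
                   , ζ ^ 2 * s ^ 2 * θ , s * ζ * θ * (θ + s * (z1 * ζ)) ⟩ ]⇒
    concl⁴ (Acts ⟨ θ , - (s * ζ) , z1 , - θ ⟩ z z)) _
  rational-root-z4 = follows 4 (λ θ z1 ζ z4 → z1 * ζ ≈ :1 ∙[ - (z4 * (z1 * ζ + :1)) ]⇒
    disc ⟨ :0 , z1 , :0 , z4 ⟩ ≈ θ ^ 3 + θ ^ 2 ∙[ - ζ ^ 2 ]⇒ concl (z4 ≈ - ((θ ^ 3 + θ ^ 2) * ζ ^ 2))) _
  rational-root-det = follows 3 (λ θ z1 ζ → z1 * ζ ≈ :1 ∙[ θ ^ 2 + θ ]⇒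
    concl (det ⟨ θ , - ((θ ^ 2 + θ) * ζ) , z1 , - θ ⟩ ≈ θ)) _

  root-free-relation = follows 4 (λ t z0 z3 z4 → let θ = t + z0 * z4 - :1 in
    disc ⟨ z0 , :0 , z3 , z4 ⟩ ≈ θ ^ 3 + θ ^ 2 ∙[ - :1 ]⇒ concl (z0 * z3 ^ 2 ≈ - (t * (t ^ 2 + t + :1 - z0 * z4)))) _
  -- Suppose z0x⁴ + x² + z3x + z4 is z0(x² + px + a)(x² - px + b). Then t = -z0p² satisfies the
  -- relation, and the matrix is the involution exchanging the two roots inside each factor. It
  -- depends only on p², hence is rational even when p is not.
  root-free = follows⁴ 0 4 (λ t z0 z3 z4 → let v = z0 * z4; z = ⟨ z0 , :0 , z3 , z4 ⟩ in
    z0 * z3 ^ 2 ≈ - (t * (t ^ 2 + t + :1 - v)) ∙[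
      ⟨ - (z0 ^ 2 * t ^ 2) , :0 , z3 * t * (:1 - t) * z0 , z0 * (z0 * z3 ^ 2 - t * (t ^ 2 + t + :1 - v) + t * (:1 - t ^ 2 - v)) ⟩ ]⇒
    concl⁴ (Acts ⟨ - (z0 * z3) , t - t ^ 2 , - (t * z0) , z0 * z3 ⟩ z z)) _
  root-free-det = follows 4 (λ t z0 z3 z4 → z0 * z3 ^ 2 ≈ - (t * (t ^ 2 + t + :1 - z0 * z4)) ∙[ - z0 ]⇒
    concl (det ⟨ - (z0 * z3) , t - t ^ 2 , - (t * z0) , z0 * z3 ⟩ ≈ - (z0 * (t * (t + z0 * z4 - :1))))) _
  reflection = follows⁴ 0 2 (λ z0 z4 → let z = ⟨ z0 , :0 , :0 , z4 ⟩ in concl⁴ (Acts ⟨ :1 , :0 , :0 , - :1 ⟩ z z)) _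

module MatrixIdentities (F : Field) (char3 : HasChar3 F) where
  open FieldProperties.Char3Solver F char3 using (follows; follows⁴)
  open ActionExpressions
  det-∙ = follows 8 (λ a b c d p q r s → let g = ⟨ a , b , c , d ⟩; h = ⟨ p , q , r , s ⟩ in
    concl (det (g ∙ h) ≈ det g * det h)) _
  det-· = follows 5 (λ k a b c d → let g = ⟨ a , b , c , d ⟩ in concl (det (k · g) ≈ k * k * det g)) _
  det-adj = follows 4 (λ a b c d → let g = ⟨ a , b , c , d ⟩ in concl (det (adj g) ≈ det g)) _
  adj-∙ = follows⁴ 1 0 (λ g → concl⁴ (adj g ∙ g ≈⁴ det g · 𝐈)) _
  ∙-adj-∙ = follows⁴ 2 0 (λ g h → concl⁴ (g ∙ (adj g ∙ h) ≈⁴ det g · h)) _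
  adj-∙-∙ = follows⁴ 2 0 (λ g h → concl⁴ (adj g ∙ (g ∙ h) ≈⁴ det g · h)) _
  ∙-∙-adj = follows⁴ 2 0 (λ g h → concl⁴ ((g ∙ h) ∙ adj h ≈⁴ det h · g)) _
  ∙-assoc = follows⁴ 3 0 (λ f g h → concl⁴ ((f ∙ g) ∙ h ≈⁴ f ∙ (g ∙ h))) _
  ∙-identityʳ = follows⁴ 1 0 (λ g → concl⁴ (g ∙ 𝐈 ≈⁴ g)) _
  ∙-· = follows⁴ 2 1 (λ g h k → concl⁴ (g ∙ (k · h) ≈⁴ k · (g ∙ h))) _
  ·-∙ = follows⁴ 2 1 (λ g h k → concl⁴ ((k · g) ∙ h ≈⁴ k · (g ∙ h))) _
  ·-assoc = follows⁴ 1 2 (λ g j k → concl⁴ ((j * k) · g ≈⁴ j · (k · g))) _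
  1· = follows⁴ 1 0 (λ g → concl⁴ (:1 · g ≈⁴ g)) _
  det-𝐈 = follows 0 (concl (:1 * :1 - :0 * :0 ≈ :1)) _
  det-swap = follows 0 (concl (:0 * :0 - :1 * :1 ≈ - :1)) _
  det-translation = follows 1 (λ u → concl (:1 * :1 - u * :0 ≈ :1)) _
  det-triangular = follows 3 (λ a b d → concl (a * d - b * :0 ≈ a * d)) _
  Borel = follows⁴ 0 4 (λ a b d α → a * α ≈ :1 ∙[ ⟨ :0 , - b , :0 , :0 ⟩ ]⇒
    concl⁴ (⟨ a , b , :0 , d ⟩ ≈⁴ ⟨ a , :0 , :0 , d ⟩ ∙ ⟨ :1 , b * α , :0 , :1 ⟩)) _
  Bruhat = follows⁴ 0 5 (λ a b c d γ → c * γ ≈ :1 ∙[ ⟨ - a , - (a * d * γ) , :0 , - d ⟩ ]⇒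
    concl⁴ (⟨ a , b , c , d ⟩ ≈⁴
      ⟨ :1 , a * γ , :0 , :1 ⟩ ∙ (⟨ :0 , :1 , :1 , :0 ⟩ ∙ (⟨ c , :0 , :0 , b - a * d * γ ⟩ ∙ ⟨ :1 , d * γ , :0 , :1 ⟩)))) _
  Bruhat-det = follows 5 (λ a b c d γ → c * γ ≈ :1 ∙[ - (a * d) ]⇒ concl (a * d - b * c ≈ - (c * (b - a * d * γ)))) _

module Action (FF : FiniteField) (char3 : Char3 FF) where
  open Char3FiniteField FF char3
  private
    module I = ActionIdentities field' char3
    module M = MatrixIdentities field' char3

  infix 4 _≟ᵛ_
  _≟ᵛ_ : DecidableEquality Vec4
  x ≟ᵛ y = map′ (λ (e , f , g , h) → V4-≡ e f g h) (λ { refl → refl , refl , refl , refl })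
    (V4.c0 x ≟ V4.c0 y ×-dec V4.c1 x ≟ V4.c1 y ×-dec V4.c2 x ≟ V4.c2 y ×-dec V4.c3 x ≟ V4.c3 y)

  Matrix : Set
  Matrix = Vec4

  det : Matrix → Carrier
  det ⟨ a , b , c , d ⟩ = a * d - b * c

  infixl 7 _∙_
  infixr 8 _·_
  _∙_ : Matrix → Matrix → Matrix
  ⟨ a , b , c , d ⟩ ∙ ⟨ a′ , b′ , c′ , d′ ⟩ =
    ⟨ a * a′ + b * c′ , a * b′ + b * d′ , c * a′ + d * c′ , c * b′ + d * d′ ⟩

  _·_ : Carrier → Matrix → Matrix
  k · ⟨ a , b , c , d ⟩ = ⟨ k * a , k * b , k * c , k * d ⟩

  adj : Matrix → Matrix
  adj ⟨ a , b , c , d ⟩ = ⟨ d , - b , - c , a ⟩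

  𝐈 : Matrix
  𝐈 = ⟨ 1# , 0# , 0# , 1# ⟩

  det-∙ : ∀ g h → det (g ∙ h) ≡ det g * det h
  det-∙ ⟨ a , b , c , d ⟩ ⟨ p , q , r , s ⟩ = M.det-∙ a b c d p q r s

  det-· : ∀ k g → det (k · g) ≡ k * k * det g
  det-· k ⟨ a , b , c , d ⟩ = M.det-· k a b c d

  det-adj : ∀ g → det (adj g) ≡ det g
  det-adj ⟨ a , b , c , d ⟩ = M.det-adj a b c d

  det-𝐈≢0 : det 𝐈 ≢ 0#
  det-𝐈≢0 = subst (_≢ 0#) (sym M.det-𝐈) (0≢1 ∘ sym)

  det-∙≢0 : ∀ {g h} → det g ≢ 0# → det h ≢ 0# → det (g ∙ h) ≢ 0#
  det-∙≢0 {g} {h} g≢0 h≢0 = subst (_≢ 0#) (sym (det-∙ g h)) (x*y≢0 g≢0 h≢0)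

  det-adj≢0 : ∀ {g} → det g ≢ 0# → det (adj g) ≢ 0#
  det-adj≢0 {g} = subst (_≢ 0#) (sym (det-adj g))

  det-·≢0 : ∀ {k g} → k ≢ 0# → det g ≢ 0# → det (k · g) ≢ 0#
  det-·≢0 {k} {g} k≢0 g≢0 = subst (_≢ 0#) (sym (det-· k g)) (x*y≢0 (x*y≢0 k≢0 k≢0) g≢0)

  infix 4 _∝_
  -- On invertible matrices this is equality in PGL₂.
  _∝_ : Matrix → Matrix → Set
  g ∝ h = ∃ λ k → k ≢ 0# × h ≡ k · g

  ∝-isEquivalence : IsEquivalence _∝_
  ∝-isEquivalence = record
    { refl  = λ {g} → 1# , 0≢1 ∘ sym , sym (M.1· g)
    ; sym   = λ { {g} (k , k≢0 , refl) → k ⁻¹ , ⁻¹≢0 k≢0 ,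
        sym (trans (sym (M.·-assoc g (k ⁻¹) k))
              (trans (cong (_· g) (trans (*-comm _ _) (⁻¹-inverse k≢0))) (M.1· g))) }
    ; trans = λ { {g} (k , k≢0 , refl) (j , j≢0 , refl) → j * k , x*y≢0 j≢0 k≢0 , sym (M.·-assoc g j k) }
    }
  module ∝ = IsEquivalence ∝-isEquivalence

  ∝⇒∙∝ : ∀ g {h h′} → h ∝ h′ → g ∙ h ∝ g ∙ h′
  ∝⇒∙∝ g {h} (k , k≢0 , refl) = k , k≢0 , M.∙-· g h k

  ∝-cancel : ∀ {g h h′} → det g ≢ 0# → g ∙ h ∝ g ∙ h′ → h ∝ h′
  ∝-cancel {g} {h} {h′} g≢0 gh∝gh′ = ∝.trans
    (det g , g≢0 , M.adj-∙-∙ g h)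
    (∝.trans (∝⇒∙∝ (adj g) gh∝gh′) (∝.sym (det g , g≢0 , M.adj-∙-∙ g h′)))

  -- A quadruple ⟨ z0 , z1 , z3 , z4 ⟩ stands for the quartic form with z2 = 1, equivalently for
  -- the line through (1 : z1 : z0 : 0) and (0 : z4 : z3 : 1).
  Quartic : Set
  Quartic = Vec4

  disc : Quartic → Carrier
  disc ⟨ z0 , z1 , z3 , z4 ⟩ = (w ^ 3) + (w ^ 2) - (z0 * (z3 ^ 2) + z4 * (z1 ^ 2) - z0 * z4)
    where w = z0 * z4 - z1 * z3

  -- g maps the line of z to the line of z′: the images of the two spanning points of z are the
  -- combinations of those of z′ with coefficients (a³, c³) and (b³, d³).
  lhs rhs : Matrix → Quartic → Vec4
  lhs ⟨ a , b , c , d ⟩ ⟨ z0 , z1 , z3 , z4 ⟩ =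
    ⟨ (a ^ 2) * c + a * D * z1 - b * D * z0 , a * (c ^ 2) - c * D * z1 + d * D * z0
    , a * D * z4 - b * D * z3 + (b ^ 2) * d , b * (d ^ 2) + (d * D * z3 - c * D * z4) ⟩
    where D = a * d - b * c
  rhs ⟨ a , b , c , d ⟩ ⟨ z0 , z1 , z3 , z4 ⟩ =
    ⟨ (a ^ 3) * z1 + (c ^ 3) * z4 , (a ^ 3) * z0 + (c ^ 3) * z3 , (b ^ 3) * z1 + (d ^ 3) * z4 , (b ^ 3) * z0 + (d ^ 3) * z3 ⟩

  record Acts (g : Matrix) (z z′ : Quartic) : Set where
    constructor acts
    field equations : lhs g z ≡ rhs g z′

  open Acts

  abstract
    infixr 7 _▷_
    _▷_ : Matrix → Quartic → Quartic
    ⟨ a , b , c , d ⟩ ▷ ⟨ z0 , z1 , z3 , z4 ⟩ =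
      ⟨ ((D ⁻¹) ^ 2) * ((d ^ 3) * (d * z0 - c * z1) - (c ^ 3) * (d * z3 - c * z4) + ((c * d) ^ 2))
      , ((D ⁻¹) ^ 2) * ((d ^ 3) * (a * z1 - b * z0) - (c ^ 3) * (a * z4 - b * z3) + c * d * (a * d + b * c))
      , ((D ⁻¹) ^ 2) * ((a ^ 3) * (d * z3 - c * z4) - (b ^ 3) * (d * z0 - c * z1) + a * b * (a * d + b * c))
      , ((D ⁻¹) ^ 2) * ((a ^ 3) * (a * z4 - b * z3) - (b ^ 3) * (a * z1 - b * z0) + ((a * b) ^ 2)) ⟩
      where
      D : Carrier
      D = a * d - b * c

    Acts-▷ : ∀ {g} z → det g ≢ 0# → Acts g z (g ▷ z)
    Acts-▷ {g} z g≢0 = acts (I.Acts-image g z (det g ⁻¹) (⁻¹-inverse g≢0))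

    Acts⇒▷ : ∀ {g z y} → det g ≢ 0# → Acts g z y → y ≡ g ▷ z
    Acts⇒▷ {g} {z} {y} g≢0 A = I.Acts-unique g z y (det g ⁻¹) (⁻¹-inverse g≢0) (equations A)

    ▷-degenerate : ∀ g z → det g ≡ 0# → g ▷ z ≡ 0v
    ▷-degenerate g z g≡0 = V4-≡ (vanish _) (vanish _) (vanish _) (vanish _)
      where
      vanish : ∀ x → ((det g ⁻¹) ^ 2) * x ≡ 0#
      vanish x = trans (cong (λ i → (i ^ 2) * x) (trans (cong _⁻¹ g≡0) 0⁻¹≡0))
                       (trans (cong (_* x) (zeroˡ _)) (zeroˡ x))

  Acts-functional : ∀ {g z y y′} → det g ≢ 0# → Acts g z y → Acts g z y′ → y ≡ y′
  Acts-functional g≢0 A B = trans (Acts⇒▷ g≢0 A) (sym (Acts⇒▷ g≢0 B))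

  Acts-∙ : ∀ {g h z y x} → Acts h z y → Acts g y x → Acts (g ∙ h) z x
  Acts-∙ {g} {h} {z} {y} {x} H G = acts (I.Acts-∙ g h z y x (equations H) (equations G))

  Acts-· : ∀ k {g z y} → Acts g z y → Acts (k · g) z y
  Acts-· k {g} {z} {y} G = acts (I.Acts-· g z y k (equations G))

  Acts-𝐈 : ∀ z → Acts 𝐈 z z
  Acts-𝐈 z = acts (I.Acts-𝐈 z)

  Acts-adj : ∀ {g z y} → det g ≢ 0# → Acts g z y → Acts (adj g) y z
  Acts-adj {g} {z} {y} g≢0 A = subst (Acts (adj g) y) x≡z B
    where
    B : Acts (adj g) y (adj g ▷ y)
    B = Acts-▷ y (det-adj≢0 g≢0)
    x≡z : adj g ▷ y ≡ z
    x≡z = Acts-functional (det-·≢0 g≢0 det-𝐈≢0) (subst (λ h → Acts h z (adj g ▷ y)) (M.adj-∙ g) (Acts-∙ A B)) (Acts-· (det g) (Acts-𝐈 z))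

  ▷-∝ : ∀ {g h} z → g ∝ h → g ▷ z ≡ h ▷ z
  ▷-∝ {g} z (k , k≢0 , refl) with det g ≟ 0#
  ... | no  g≢0 = Acts⇒▷ (det-·≢0 k≢0 g≢0) (Acts-· k (Acts-▷ z g≢0))
  ... | yes g≡0 = trans (▷-degenerate g z g≡0) (sym (▷-degenerate (k · g) z (trans (det-· k g) (trans (cong (k * k *_) g≡0) (zeroʳ _)))))

  translation : Carrier → Matrix
  translation u = ⟨ 1# , u , 0# , 1# ⟩

  det-translation≢0 : ∀ u → det (translation u) ≢ 0#
  det-translation≢0 u = subst (_≢ 0#) (sym (M.det-translation u)) (0≢1 ∘ sym)

  translate : Carrier → Quartic → Quartic
  translate u ⟨ z0 , z1 , z3 , z4 ⟩ =
    ⟨ z0 , z1 - u * z0 , z3 + u - (u ^ 3) * z0 , z4 - u * z3 + (u ^ 2) - (u ^ 3) * (z1 - u * z0) ⟩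

  Acts-translation : ∀ u z → Acts (translation u) z (translate u z)
  Acts-translation u z = acts (I.Acts-translation z u)

  disc-translate : ∀ u z → disc (translate u z) ≡ disc z
  disc-translate u ⟨ z0 , z1 , z3 , z4 ⟩ = I.disc-translate u z0 z1 z3 z4

  swap : Matrix
  swap = ⟨ 0# , 1# , 1# , 0# ⟩

  det-swap≢0 : det swap ≢ 0#
  det-swap≢0 = subst (_≢ 0#) (sym M.det-swap) (-x≢0 (0≢1 ∘ sym))

  reverse : Quartic → Quartic
  reverse ⟨ z0 , z1 , z3 , z4 ⟩ = ⟨ z4 , z3 , z1 , z0 ⟩

  Acts-swap : ∀ z → Acts swap z (reverse z)
  Acts-swap z = acts (I.Acts-swap z)

  disc-reverse : ∀ z → disc (reverse z) ≡ disc z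
  disc-reverse ⟨ z0 , z1 , z3 , z4 ⟩ = I.disc-reverse z0 z1 z3 z4

  DiscPreserving : Matrix → Set
  DiscPreserving g = ∀ z → ∃ λ y → Acts g z y × disc y ≡ disc z

  DiscPreserving-∙ : ∀ {g h} → DiscPreserving g → DiscPreserving h → DiscPreserving (g ∙ h)
  DiscPreserving-∙ G H z =
    let (y , A , e) = H z ; (x , B , f) = G y in x , Acts-∙ A B , trans f e

  translation-preserving : ∀ u → DiscPreserving (translation u)
  translation-preserving u z = translate u z , Acts-translation u z , disc-translate u z

  diagonal-preserving : ∀ {a d} → a ≢ 0# → d ≢ 0# → DiscPreserving ⟨ a , 0# , 0# , d ⟩
  diagonal-preserving {a} {d} a≢0 d≢0 z@(⟨ z0 , z1 , z3 , z4 ⟩) =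
    ⟨ ((d * α) ^ 2) * z0 , d * α * z1 , a * δ * z3 , ((a * δ) ^ 2) * z4 ⟩ ,
    acts (I.Acts-diagonal z a d α δ aα≡1 dδ≡1) ,
    I.disc-diagonal (d * α) (a * δ) z0 z1 z3 z4 (I.diagonal-inverse a d α δ aα≡1 dδ≡1)
    where
    α = a ⁻¹
    δ = d ⁻¹
    aα≡1 = ⁻¹-inverse a≢0
    dδ≡1 = ⁻¹-inverse d≢0

  triangular-preserving : ∀ {a d} b → a ≢ 0# → d ≢ 0# → DiscPreserving ⟨ a , b , 0# , d ⟩
  triangular-preserving {a} {d} b a≢0 d≢0 = subst DiscPreserving
    (sym (M.Borel a b d α (⁻¹-inverse a≢0)))
    (DiscPreserving-∙ (diagonal-preserving a≢0 d≢0) (translation-preserving (b * α)))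
    where α = a ⁻¹

  -- The Bruhat decomposition reduces the invariance of `disc` to translations, diagonal matrices
  -- and the swap, for each of which it is a small identity.
  det≢0⇒preserving : ∀ g → det g ≢ 0# → DiscPreserving g
  det≢0⇒preserving ⟨ a , b , c , d ⟩ g≢0 with c ≟ 0#
  ... | yes refl = triangular-preserving b (xy≢0⇒x≢0 ad≢0) (xy≢0⇒y≢0 ad≢0)
    where ad≢0 = subst (_≢ 0#) (M.det-triangular a b d) g≢0
  ... | no c≢0 = subst DiscPreserving
    (sym (M.Bruhat a b c d γ (⁻¹-inverse c≢0)))
    (DiscPreserving-∙ (translation-preserving (a * γ)) (DiscPreserving-∙ swap-preserving
      (DiscPreserving-∙ (diagonal-preserving c≢0 β≢0) (translation-preserving (d * γ)))))
    where
    γ = c ⁻¹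
    β = b - a * d * γ
    β≢0 : β ≢ 0#
    β≢0 β≡0 = g≢0 (trans (M.Bruhat-det a b c d γ (⁻¹-inverse c≢0))
      (trans (cong (λ x → - (c * x)) β≡0) (trans (cong -_ (zeroʳ c)) -0#≈0#)))
    swap-preserving : DiscPreserving swap
    swap-preserving z = reverse z , Acts-swap z , disc-reverse z

  Acts⇒disc-≡ : ∀ {g z y} → det g ≢ 0# → Acts g z y → disc y ≡ disc z
  Acts⇒disc-≡ {g} {z} g≢0 A = let (y′ , B , e) = det≢0⇒preserving g g≢0 z in
    trans (cong disc (Acts-functional g≢0 A B)) e

-- Involutions in the stabiliser of a quartic.

module StabiliserIdentities (F : Field) (char3 : HasChar3 F) where
  open FieldProperties.Char3Solver F char3 using (follows; follows⁴)
  open ActionExpressions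

  trace-conj = follows 8 (λ a b c d p q r s → let h = ⟨ p , q , r , s ⟩; k = h ∙ (⟨ a , b , c , d ⟩ ∙ adj h) in
    concl (c0 k + c3 k ≈ det h * (a + d))) _
  conj-companion = follows⁴ 0 5 (λ a b c d γ → let h = ⟨ :1 , - (a * γ) , :0 , :1 ⟩; g = ⟨ a , b , c , d ⟩ in
    c * γ ≈ :1 ∙[ ⟨ - (a * γ) , - (a ^ 2 * γ ^ 2 + b * γ) , :1 , γ * a ⟩ ]⇒
    concl⁴ (γ · (h ∙ (g ∙ adj h)) ≈⁴ ⟨ :0 , - (γ ^ 2 * det g) , :1 , γ * (a + d) ⟩)) _
  swap-entry = follows 4 (λ a b c d → concl (- b ≈ :1 * (a * :0 + b * (- :1)) + :0 * (c * :0 + d * (- :1)))) _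
  shear-entry = follows 2 (λ a d → concl (- (a - d) ≈ :1 * (a * (- :1) + :0 * :1) + :1 * (:0 * (- :1) + d * :1))) _
  x-0 = follows 3 (λ β y1 y0 → concl (β * (y1 - :0 * y0) ≈ β * y1)) _
  J² = follows⁴ 0 1 (λ β → let J = ⟨ :0 , β , :1 , :0 ⟩ in concl⁴ (J ∙ J ≈⁴ β · 𝐈)) _
  J-det = follows 1 (λ β → concl (:0 * :0 - β * :1 ≈ - β)) _
  J-trace = follows 5 (λ a b c d β → (:0 * a + β * c) + (:1 * b + :0 * d) ≈ :0 ∙[ :1 ]⇒ concl (b ≈ - (β * c))) _
  trace-zero = follows 2 (λ a d → a + d ≈ :0 ∙[ :1 ]⇒ concl (d ≈ - a)) _
  -- Completing the square in z1 · `conic`; the middle terms match because -2 = 1.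
  conic-square = follows 6 (λ β z0 z1 a c s → let B = :1 - β * z0 in
    conic β z0 z1 a c ≈ :0 ∙[ z1 ]⇒ s * s ≈ B ^ 2 - β * z1 ^ 2 ∙[ - c ^ 2 ]⇒
    concl ((B * c - z1 * a) * (B * c - z1 * a) ≈ (s * c) * (s * c))) _
  conic-disc = follows 6 (λ β z0 z1 a c γ → let B = :1 - β * z0 in
    conic β z0 z1 a c ≈ :0 ∙[ z1 * γ ^ 2 ]⇒ c * γ ≈ :1 ∙[ (B ^ 2 - β * z1 ^ 2) * (c * γ + :1) ]⇒
    concl (((B * c - z1 * a) * γ) * ((B * c - z1 * a) * γ) ≈ B ^ 2 - β * z1 ^ 2)) _
  conic-disc₀ = follows 2 (λ β z0 → let B = :1 - β * z0 in concl (B * B ≈ B ^ 2 - β * :0 ^ 2)) _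
  conic-a = follows 4 (λ β z0 z1 a → conic β z0 z1 a :0 ≈ :0 ∙[ :1 ]⇒ concl (z1 * (a * a) ≈ :0)) _
  conic₀ = follows 4 (λ β z0 a c → conic β z0 :0 a c ≈ :0 ∙[ :1 ]⇒ concl ((:1 - β * z0) * (a * c) ≈ :0)) _
  conic₀₁ = follows 3 (λ β z0 a → concl (conic β z0 :0 a :0 ≈ :0)) _
  conic₀₂ = follows 3 (λ β z0 c → concl (conic β z0 :0 :0 c ≈ :0)) _
  conic-root = follows 4 (λ β z0 z1 s → let B = :1 - β * z0 in s * s ≈ B ^ 2 - β * z1 ^ 2 ∙[ z1 ]⇒
    concl (conic β z0 z1 (B - s) z1 ≈ :0)) _
  conic-root-det = follows 4 (λ β z0 z1 s → let B = :1 - β * z0 in s * s ≈ B ^ 2 - β * z1 ^ 2 ∙[ :1 ]⇒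
    concl ((B - s) * (- (B - s)) - (- (β * z1)) * z1 ≈ - (s * (B - s)))) _
  conic-root≢0 = follows 4 (λ β z0 z1 s → let B = :1 - β * z0 in B - s ≈ :0 ∙[ B + s ]⇒
    s * s ≈ B ^ 2 - β * z1 ^ 2 ∙[ :1 ]⇒
    concl (β * (z1 * z1) ≈ :0)) _
  neg-square = follows 2 (λ s x → s * s ≈ x ∙[ :1 ]⇒ concl ((- s) * (- s) ≈ x)) _
  conic-solve = follows 5 (λ B z1 a c s → B * c - z1 * a ≈ s * c ∙[ - :1 ]⇒ concl (z1 * a ≈ (B - s) * c)) _
  conic-solve⁻ = follows 5 (λ B z1 a c s → B * c - z1 * a ≈ - (s * c) ∙[ - :1 ]⇒ concl (z1 * a ≈ (B - (- s)) * c)) _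
  proportional = follows⁴ 0 6 (λ β z1 ζ a r c → z1 * ζ ≈ :1 ∙[ ⟨ - a , β * c , - c , a ⟩ ]⇒
    z1 * a ≈ r * c ∙[ ⟨ ζ , :0 , :0 , - ζ ⟩ ]⇒ concl⁴ (commuting β a c ≈⁴ (c * ζ) · commuting β r z1)) _
  same-scale = follows 4 (λ k z1 ζ s → z1 * ζ ≈ :1 ∙[ k - :1 ]⇒ z1 ≈ k * z1 ∙[ ζ ]⇒ concl (:1 ≈ k)) _
  distinct-roots = follows 3 (λ k B s → :1 ≈ k ∙[ B - s ]⇒ B - (- s) ≈ k * (B - s) ∙[ - :1 ]⇒ concl (s ≈ :0)) _
  diagonal-scale = follows⁴ 0 2 (λ β a → concl⁴ (commuting β a :0 ≈⁴ a · commuting β :1 :0)) _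
  antidiagonal-scale = follows⁴ 0 2 (λ β c → concl⁴ (commuting β :0 c ≈⁴ c · commuting β :0 :1)) _
  reflect-det = follows 1 (λ β → concl (:1 * (- :1) - (- (β * :0)) * :0 ≈ - :1)) _
  reflect-det′ = follows 0 (concl (:1 * (- :1) - :0 * :0 ≈ - :1)) _
  antireflect-det = follows 1 (λ β → concl (:0 * (- :0) - (- (β * :1)) * :1 ≈ β)) _
  1≉-1 = follows 1 (λ k → :1 ≈ k * :1 ∙[ :1 ]⇒ - :1 ≈ k * :1 ∙[ - :1 ]⇒ concl (- :1 ≈ :0)) _
  β≉-β = follows 2 (λ k β → :1 ≈ k * :1 ∙[ β ]⇒ - (β * :1) ≈ k * β ∙[ - :1 ]⇒ concl (- β ≈ :0)) _
  root-factor = follows 1 (λ θ → concl (θ ^ 2 * (:1 + θ) ≈ θ ^ 3 + θ ^ 2)) _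
  root-zero = follows 1 (λ θ → θ ≈ :0 ∙[ θ ^ 2 + θ ]⇒ concl (θ ^ 3 + θ ^ 2 ≈ :0)) _
  kill-z3 = follows 1 (λ z3 → concl (z3 + (- z3) - (- z3) ^ 3 * :0 ≈ :0)) _
  keep-z1 = follows 2 (λ z1 u → concl (z1 - u * :0 ≈ z1)) _
  kill-z1 = follows 3 (λ z0 z1 ζ → z0 * ζ ≈ :1 ∙[ - z1 ]⇒ concl (z1 - z1 * ζ * z0 ≈ :0)) _
  shift-root = follows 2 (λ θ v → concl (θ ≈ θ + :1 - v + v - :1)) _
  t≡0 = follows 4 (λ t q z0 z3 → t ≈ :0 ∙[ - q ]⇒ z0 * z3 ^ 2 ≈ - (t * q) ∙[ :1 ]⇒ concl (z0 * (z3 * z3) ≈ :0)) _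
  no-z0z1 = follows 2 (λ z3 z4 → concl (disc ⟨ :0 , :0 , z3 , z4 ⟩ ≈ :0)) _

module Stabiliser (FF : FiniteField) (char3 : Char3 FF) where
  open Char3FiniteField FF char3
  open Action FF char3
  private
    module I = ActionIdentities field' char3
    module M = MatrixIdentities field' char3
    module S = StabiliserIdentities field' char3

  trace : Matrix → Carrier
  trace ⟨ a , b , c , d ⟩ = a + d

  conj : Matrix → Matrix → Matrix
  conj h g = h ∙ (g ∙ adj h)

  det-conj≢0 : ∀ {h g} → det h ≢ 0# → det g ≢ 0# → det (conj h g) ≢ 0#
  det-conj≢0 {h} {g} h≢0 g≢0 = det-∙≢0 {h} {g ∙ adj h} h≢0 (det-∙≢0 {g} {adj h} g≢0 (det-adj≢0 {h} h≢0))

  Acts-conj : ∀ {h g z y} → det h ≢ 0# → Acts h z y → Acts g z z → Acts (conj h g) y y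
  Acts-conj h≢0 H G = Acts-∙ (Acts-∙ (Acts-adj h≢0 H) G) H

  trace-conj : ∀ h g → trace (conj h g) ≡ det h * trace g
  trace-conj ⟨ p , q , r , s ⟩ ⟨ a , b , c , d ⟩ = S.trace-conj a b c d p q r s

  -- The quartics fixed by the involution (0 β; 1 0).
  record Involutive (z : Quartic) : Set where
    constructor involutive
    open V4 z renaming (c0 to z0; c1 to z1; c2 to z3; c3 to z4)
    field
      β    : Carrier
      β≢0  : β ≢ 0#
      z3-≡ : z3 ≡ β * z1
      z4-≡ : z4 ≡ (β ^ 2) * z0

  InvolutiveForm : Quartic → Set
  InvolutiveForm z = ∃₂ λ h y → det h ≢ 0# × Acts h z y × Involutive y

  InvolutiveForm-Acts : ∀ {h z y} → det h ≢ 0# → Acts h z y → InvolutiveForm y → InvolutiveForm z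
  InvolutiveForm-Acts {h} h≢0 H (k , x , k≢0 , K , inv) = k ∙ h , x , det-∙≢0 {k} {h} k≢0 h≢0 , Acts-∙ H K , inv

  -- With δ ≠ 0 both remaining equations lose the factor δ; they give z0(β + δ²) = 1 and z1 = -δz0,
  -- and for these values `disc` vanishes identically.
  companion-δ≡0 : ∀ β δ z0 z1 → β ≢ 0# → disc ⟨ z0 , z1 , β * (z1 - δ * z0) , (β ^ 2) * z0 ⟩ ≢ 0# →
    1# - z0 * (β + (δ ^ 2)) ≡ 0# ⊎ δ ≡ 0# → δ - (β + (δ ^ 2)) * (z1 - δ * z0) ≡ 0# ⊎ δ ≡ 0# → δ ≡ 0#
  companion-δ≡0 β δ z0 z1 β≢0 disc≢0 (inj₂ δ≡0) _          = δ≡0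
  companion-δ≡0 β δ z0 z1 β≢0 disc≢0 (inj₁ _)  (inj₂ δ≡0) = δ≡0
  companion-δ≡0 β δ z0 z1 β≢0 disc≢0 (inj₁ f₀) (inj₁ f₁)  = contradiction
    (trans (cong (λ x → disc ⟨ z0 , x , β * (x - δ * z0) , (β ^ 2) * z0 ⟩) (I.companion-solve β δ z0 z1 f₀ f₁))
           (I.companion-disc β δ z0 f₀))
    disc≢0

  companion-fixed : ∀ β δ z → β ≢ 0# → disc z ≢ 0# → Acts ⟨ 0# , β , 1# , δ ⟩ z z → δ ≡ 0# × Involutive z
  companion-fixed β δ ⟨ z0 , z1 , z3 , z4 ⟩ β≢0 disc≢0 A = shape
      (I.companion-z3 β δ z0 z1 z3 z4 (cong V4.c1 (Acts.equations A))) (I.companion-z4 β δ z0 z1 z3 z4 (cong V4.c0 (Acts.equations A))) disc≢0 A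
    where
    factor : ∀ {x y} → x * y ≡ 0# → y ≡ 0# ⊎ x ≡ 0#
    factor = [ inj₂ , inj₁ ]′ ∘ x*y≡0⇒
    shape : ∀ {z3 z4} → z3 ≡ β * (z1 - δ * z0) → z4 ≡ (β ^ 2) * z0 → disc ⟨ z0 , z1 , z3 , z4 ⟩ ≢ 0# →
            Acts ⟨ 0# , β , 1# , δ ⟩ ⟨ z0 , z1 , z3 , z4 ⟩ ⟨ z0 , z1 , z3 , z4 ⟩ →
            δ ≡ 0# × Involutive ⟨ z0 , z1 , z3 , z4 ⟩
    shape refl refl disc≢0 A = δ≡0 ,
      involutive β β≢0 (trans (cong (λ x → β * (z1 - x * z0)) δ≡0) (S.x-0 β z1 z0)) refl
      where
      δ≡0 = companion-δ≡0 β δ z0 z1 β≢0 disc≢0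
        (factor (x*y≡0⇒y≡0 _≟_ (x≢0⇒xⁿ≢0 β≢0 2) (I.companion-z0 β δ z0 z1 (cong V4.c2 (Acts.equations A)))))
        (factor (x*y≡0⇒y≡0 _≟_ β≢0 (I.companion-z1 β δ z0 z1 (cong V4.c3 (Acts.equations A)))))

  Normalises : Matrix → Quartic → Set
  Normalises g z = trace g ≡ 0# × InvolutiveForm z

  Normalises-conj : ∀ h {g z y} → det h ≢ 0# → Acts h z y → Normalises (conj h g) y → Normalises g z
  Normalises-conj h {g} h≢0 H (tr≡0 , form) =
    x*y≡0⇒y≡0 _≟_ h≢0 (trans (sym (trace-conj h g)) tr≡0) , InvolutiveForm-Acts h≢0 H form

  -- The translation by -a/c fixes ∞ and moves its image a/c under the matrix to 0, which makes the
  -- upper left entry of the conjugate vanish. The lower right entry is then the trace, up to the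
  -- factor γ.
  conj-companion : ∀ a b c d γ → c * γ ≡ 1# →
    γ · conj (translation (- (a * γ))) ⟨ a , b , c , d ⟩ ≡ ⟨ 0# , - ((γ ^ 2) * (a * d - b * c)) , 1# , γ * (a + d) ⟩
  conj-companion = S.conj-companion

  normalise-companion : ∀ {g h k z y} β δ → det h ≢ 0# → Acts h z y → β ≢ 0# → disc z ≢ 0# → Acts g z z →
    k · conj h g ≡ ⟨ 0# , β , 1# , δ ⟩ → δ ≡ 0# × InvolutiveForm z
  normalise-companion {g} {h} {k} {z} {y} β δ h≢0 H β≢0 disc≢0 G eq =
    let (δ≡0 , inv) = companion-fixed β δ y β≢0 (subst (_≢ 0#) (sym (Acts⇒disc-≡ h≢0 H)) disc≢0)
                        (subst (λ k → Acts k y y) eq (Acts-· k (Acts-conj h≢0 H G)))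
    in δ≡0 , h , y , h≢0 , H , inv

  normalise-c≢0 : ∀ g {z} → det g ≢ 0# → disc z ≢ 0# → Acts g z z → V4.c2 g ≢ 0# → Normalises g z
  normalise-c≢0 ⟨ a , b , c , d ⟩ {z} g≢0 disc≢0 G c≢0 =
    let (δ≡0 , form) = normalise-companion (- ((γ ^ 2) * (a * d - b * c))) (γ * (a + d))
                         (det-translation≢0 u) (Acts-translation u z)
                         (-x≢0 (x*y≢0 (x≢0⇒xⁿ≢0 (⁻¹≢0 c≢0) 2) g≢0)) disc≢0 G
                         (conj-companion a b c d γ (⁻¹-inverse c≢0))
    in x*y≡0⇒y≡0 _≟_ (⁻¹≢0 c≢0) δ≡0 , form
    where
    γ = c ⁻¹
    u = - (a * γ)

  normalise-b≢0 : ∀ g {z} → det g ≢ 0# → disc z ≢ 0# → Acts g z z → V4.c1 g ≢ 0# → Normalises g z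
  normalise-b≢0 g@(⟨ a , b , c , d ⟩) {z} g≢0 disc≢0 G b≢0 =
    Normalises-conj swap {g} det-swap≢0 (Acts-swap z)
      (normalise-c≢0 (conj swap g) (det-conj≢0 {swap} {g} det-swap≢0 g≢0)
        (subst (_≢ 0#) (sym (disc-reverse z)) disc≢0)
        (Acts-conj {swap} {g} det-swap≢0 (Acts-swap z) G)
        (subst (_≢ 0#) (S.swap-entry a b c d) (-x≢0 b≢0)))

  normalise-a≢d : ∀ {a d z} → det ⟨ a , 0# , 0# , d ⟩ ≢ 0# → disc z ≢ 0# → Acts ⟨ a , 0# , 0# , d ⟩ z z → a ≢ d →
                  Normalises ⟨ a , 0# , 0# , d ⟩ z
  normalise-a≢d {a} {d} {z} g≢0 disc≢0 G a≢d =
    Normalises-conj h {g} (det-translation≢0 1#) (Acts-translation 1# z)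
      (normalise-b≢0 (conj h g) (det-conj≢0 {h} {g} (det-translation≢0 1#) g≢0)
        (subst (_≢ 0#) (sym (disc-translate 1# z)) disc≢0)
        (Acts-conj {h} {g} (det-translation≢0 1#) (Acts-translation 1# z) G)
        (subst (_≢ 0#) (S.shear-entry a d) (-x≢0 (x≢y⇒x-y≢0 a≢d))))
    where
    h = translation 1#
    g = ⟨ a , 0# , 0# , d ⟩

  -- Every non-scalar matrix has a conjugate with c ≠ 0: itself, its conjugate by the swap if b ≠ 0,
  -- and for a diagonal matrix first the conjugate by x ↦ x + 1, whose upper right entry is d - a.
  normalise : ∀ g {z} → det g ≢ 0# → disc z ≢ 0# → Acts g z z → 𝐈 ∝ g ⊎ Normalises g z
  normalise g@(⟨ a , b , c , d ⟩) g≢0 disc≢0 G with c ≟ 0# | b ≟ 0# | a ≟ d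
  ... | no c≢0   | _        | _        = inj₂ (normalise-c≢0 g g≢0 disc≢0 G c≢0)
  ... | yes _    | no b≢0   | _        = inj₂ (normalise-b≢0 g g≢0 disc≢0 G b≢0)
  ... | yes refl | yes refl | no a≢d   = inj₂ (normalise-a≢d g≢0 disc≢0 G a≢d)
  ... | yes refl | yes refl | yes refl = inj₁ (a , (λ { refl → g≢0 (trans (M.det-triangular 0# 0# 0#) (zeroˡ 0#)) }) ,
    V4-≡ (sym (*-identityʳ a)) (sym (zeroʳ a)) (sym (zeroʳ a)) (sym (*-identityʳ a)))

  Fixed : Quartic → Set
  Fixed z = ∃ λ g → det g ≢ 0# × Acts g z z × ¬ (𝐈 ∝ g)

  Fixed⇒InvolutiveForm : ∀ {z} → disc z ≢ 0# → Fixed z → InvolutiveForm z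
  Fixed⇒InvolutiveForm disc≢0 (g , g≢0 , G , g-nonscalar) with normalise g g≢0 disc≢0 G
  ... | inj₁ scalar     = contradiction scalar g-nonscalar
  ... | inj₂ (_ , form) = form

  𝐈∝̸ : ∀ {a b c d} → c ≢ 0# → ¬ (𝐈 ∝ ⟨ a , b , c , d ⟩)
  𝐈∝̸ c≢0 (k , _ , eq) = c≢0 (trans (cong V4.c2 eq) (zeroʳ k))

  -- A root θ of θ³ + θ² = disc z is a pairing of the four roots of the quartic z; the involution
  -- attached to this pairing is written down explicitly, after a translation making z1 or z3 vanish.
  root⇒Fixed₀ : ∀ θ z1 z4 → θ ≢ 0# → z1 ≢ 0# → disc ⟨ 0# , z1 , 0# , z4 ⟩ ≡ (θ ^ 3) + (θ ^ 2) →
                Fixed ⟨ 0# , z1 , 0# , z4 ⟩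
  root⇒Fixed₀ θ z1 z4 θ≢0 z1≢0 root =
    subst (λ x → Fixed ⟨ 0# , z1 , 0# , x ⟩) (sym (I.rational-root-z4 θ z1 (z1 ⁻¹) z4 z1ζ≡1 root))
      ( ⟨ θ , - (((θ ^ 2) + θ) * z1 ⁻¹) , z1 , - θ ⟩
      , subst (_≢ 0#) (sym (I.rational-root-det θ z1 (z1 ⁻¹) z1ζ≡1)) θ≢0
      , acts (I.rational-root θ z1 (z1 ⁻¹) z1ζ≡1)
      , 𝐈∝̸ z1≢0 )
    where z1ζ≡1 = ⁻¹-inverse z1≢0

  root⇒Fixed₁ : ∀ t z0 z3 z4 → t + z0 * z4 - 1# ≢ 0# → z0 ≢ 0# →
    z0 * (z3 ^ 2) ≡ - (t * ((t ^ 2) + t + 1# - z0 * z4)) → Fixed ⟨ z0 , 0# , z3 , z4 ⟩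
  root⇒Fixed₁ t z0 z3 z4 θ≢0 z0≢0 relation with t ≟ 0#
  ... | no t≢0 =
        ⟨ - (z0 * z3) , t - (t ^ 2) , - (t * z0) , z0 * z3 ⟩ ,
        subst (_≢ 0#) (sym (I.root-free-det t z0 z3 z4 relation)) (-x≢0 (x*y≢0 z0≢0 (x*y≢0 t≢0 θ≢0))) ,
        acts (I.root-free t z0 z3 z4 relation) ,
        𝐈∝̸ (-x≢0 (x*y≢0 t≢0 z0≢0))
  -- For t = 0 the matrix above is singular, but then z3 = 0, the quartic is even, and x ↦ -x
  -- exchanges the roots inside the two factors.
  ... | yes t≡0 =
        ⟨ 1# , 0# , 0# , - 1# ⟩ , subst (_≢ 0#) (sym S.reflect-det′) (-x≢0 (0≢1 ∘ sym)) ,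
        subst (λ x → Acts ⟨ 1# , 0# , 0# , - 1# ⟩ ⟨ z0 , 0# , x , z4 ⟩ ⟨ z0 , 0# , x , z4 ⟩) (sym z3≡0)
          (acts (I.reflection z0 z4)) ,
        λ (k , _ , eq) → -x≢0 (0≢1 ∘ sym) (S.1≉-1 k (cong V4.c0 eq) (cong V4.c3 eq))
    where
    z3≡0 : z3 ≡ 0#
    z3≡0 = [ id , id ]′ (x*y≡0⇒ (x*y≡0⇒y≡0 _≟_ z0≢0 (S.t≡0 t _ z0 z3 t≡0 relation)))

  translate-z3≡0 : ∀ z → V4.c0 z ≡ 0# → ∃ λ z4 → Acts (translation (- V4.c2 z)) z ⟨ 0# , V4.c1 z , 0# , z4 ⟩
  translate-z3≡0 z@(⟨ _ , z1 , z3 , z4 ⟩) refl = _ ,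
    subst (Acts (translation (- z3)) z) (V4-≡ refl (S.keep-z1 z1 (- z3)) (S.kill-z3 z3) refl) (Acts-translation (- z3) z)

  translate-z1≡0 : ∀ z → V4.c0 z ≢ 0# → ∃₂ λ z3 z4 → Acts (translation (V4.c1 z * V4.c0 z ⁻¹)) z ⟨ V4.c0 z , 0# , z3 , z4 ⟩
  translate-z1≡0 z@(⟨ z0 , z1 , z3 , z4 ⟩) z0≢0 = _ , _ ,
    subst (Acts (translation (z1 * z0 ⁻¹)) z)
      (V4-≡ refl (S.kill-z1 z0 z1 (z0 ⁻¹) (⁻¹-inverse z0≢0)) refl refl) (Acts-translation (z1 * z0 ⁻¹) z)

  z0≡0⇒z1≢0 : ∀ z → V4.c0 z ≡ 0# → disc z ≢ 0# → V4.c1 z ≢ 0#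
  z0≡0⇒z1≢0 ⟨ _ , _ , z3 , z4 ⟩ refl disc≢0 refl = disc≢0 (S.no-z0z1 z3 z4)

  root⇒InvolutiveForm : ∀ θ z → disc z ≢ 0# → disc z ≡ (θ ^ 3) + (θ ^ 2) → InvolutiveForm z
  root⇒InvolutiveForm θ z disc≢0 root with V4.c0 z ≟ 0#
  ... | yes z0≡0 = let (z4 , H) = translate-z3≡0 z z0≡0 ; disc≡ = Acts⇒disc-≡ (det-translation≢0 _) H in
    InvolutiveForm-Acts (det-translation≢0 _) H
      (Fixed⇒InvolutiveForm (subst (_≢ 0#) (sym disc≡) disc≢0)
        (root⇒Fixed₀ θ _ z4 (λ θ≡0 → disc≢0 (trans root (S.root-zero θ θ≡0))) (z0≡0⇒z1≢0 z z0≡0 disc≢0) (trans disc≡ root)))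
  ... | no z0≢0 = let (z3 , z4 , H) = translate-z1≡0 z z0≢0 ; disc≡ = Acts⇒disc-≡ (det-translation≢0 _) H ; v = V4.c0 z * z4 in
    InvolutiveForm-Acts (det-translation≢0 _) H
      (Fixed⇒InvolutiveForm (subst (_≢ 0#) (sym disc≡) disc≢0)
        -- The parameter t is recovered from θ = t + z0z4 - 1.
        (root⇒Fixed₁ (θ + 1# - v) _ z3 z4
          (subst (_≢ 0#) (S.shift-root θ v) (λ θ≡0 → disc≢0 (trans root (S.root-zero θ θ≡0)))) z0≢0
          (I.root-free-relation (θ + 1# - v) _ z3 z4
            (trans disc≡ (trans root (cong (λ x → (x ^ 3) + (x ^ 2)) (S.shift-root θ v)))))))

-- The order of the stabiliser.

module CountIdentities (F : Field) (char3 : HasChar3 F) where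
  open FieldProperties.Char3Solver F char3 using (follows)
  open Expressions
  zero-root = follows 2 (λ β a → a ≈ :0 ∙[ - a ]⇒ concl (a * (- a) - (- (β * :0)) * :0 ≈ :0)) _
  square-quotient = follows 5 (λ s x θ τ δ → s * s ≈ x ∙[ τ ^ 2 ]⇒ θ * τ ≈ :1 ∙[ δ * (θ * τ + :1) ]⇒
    x ≈ θ ^ 2 * δ ∙[ τ ^ 2 ]⇒
    concl ((s * τ) * (s * τ) ≈ δ)) _
  square-product = follows 4 (λ s x θ δ → s * s ≈ δ ∙[ θ ^ 2 ]⇒ x ≈ θ ^ 2 * δ ∙[ - :1 ]⇒
    concl ((θ * s) * (θ * s) ≈ x)) _

module StabiliserCount (FF : FiniteField) (char3 : Char3 FF) where
  open Char3FiniteField FF char3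
  open Action FF char3
  open Stabiliser FF char3
  private
    module I = ActionIdentities field' char3
    module M = MatrixIdentities field' char3
    module S = StabiliserIdentities field' char3
    module C = CountIdentities field' char3

  ∝⇒∝∙ : ∀ {g g′} h → g ∝ g′ → g ∙ h ∝ g′ ∙ h
  ∝⇒∝∙ {g} h (k , k≢0 , refl) = k , k≢0 , M.·-∙ g h k

  ∝-cancelʳ : ∀ {g g′} h → det h ≢ 0# → g ∙ h ∝ g′ ∙ h → g ∝ g′
  ∝-cancelʳ {g} {g′} h h≢0 gh∝g′h = ∝.trans
    (det h , h≢0 , M.∙-∙-adj g h)
    (∝.trans (∝⇒∝∙ (adj h) gh∝g′h) (∝.sym (det h , h≢0 , M.∙-∙-adj g′ h)))

  Stabilises : Quartic → Matrix → Set
  Stabilises z g = det g ≢ 0# × Acts g z z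

  conj-inverse : ∀ h g → adj h ∙ (conj h g ∙ h) ≡ det h · det h · g
  conj-inverse h g = begin
    adj h ∙ ((h ∙ (g ∙ adj h)) ∙ h) ≡⟨ cong (adj h ∙_) (M.∙-assoc h (g ∙ adj h) h) ⟩
    adj h ∙ (h ∙ ((g ∙ adj h) ∙ h)) ≡⟨ M.adj-∙-∙ h ((g ∙ adj h) ∙ h) ⟩
    det h · ((g ∙ adj h) ∙ h)       ≡⟨ cong (det h ·_) (M.∙-assoc g (adj h) h) ⟩
    det h · (g ∙ (adj h ∙ h))       ≡⟨ cong (λ k → det h · (g ∙ k)) (M.adj-∙ h) ⟩
    det h · (g ∙ (det h · 𝐈))       ≡⟨ cong (det h ·_) (M.∙-· g 𝐈 (det h)) ⟩
    det h · det h · (g ∙ 𝐈)         ≡⟨ cong (λ k → det h · det h · k) (M.∙-identityʳ g) ⟩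
    det h · det h · g               ∎
    where open ≡-Reasoning

  stabiliser-conjugate : ∀ {h z y i} → det h ≢ 0# → Acts h z y →
    ClassCount _∝_ (Stabilises y) i → ClassCount _∝_ (Stabilises z) i
  stabiliser-conjugate {h} h≢0 H = ClassCount-image ∝.trans (λ g → adj h ∙ (g ∙ h))
    (λ {g} (g≢0 , G) → det-∙≢0 {adj h} {g ∙ h} (det-adj≢0 {h} h≢0) (det-∙≢0 {g} {h} g≢0 h≢0) ,
                       Acts-∙ (Acts-∙ H G) (Acts-adj h≢0 H))
    (λ _ _ e → ∝-cancelʳ h h≢0 (∝-cancel {adj h} (det-adj≢0 {h} h≢0) e))
    (λ _ _ e → ∝⇒∙∝ (adj h) (∝⇒∝∙ h e))
    (λ g (g≢0 , G) → conj h g , (det-conj≢0 {h} {g} h≢0 g≢0 , Acts-conj h≢0 H G) ,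
       ∝.trans (det h , h≢0 , refl) (det h , h≢0 , conj-inverse h g))

  module InvolutiveQuartic (β z0 z1 : Carrier) (β≢0 : β ≢ 0#)
                           (disc≢0 : disc ⟨ z0 , z1 , β * z1 , (β ^ 2) * z0 ⟩ ≢ 0#) where
    z : Quartic
    z = ⟨ z0 , z1 , β * z1 , (β ^ 2) * z0 ⟩

    B δ θ : Carrier
    B = 1# - β * z0
    δ = (B ^ 2) - β * (z1 ^ 2)
    θ = (β ^ 2) * (z0 ^ 2) - β * (z1 ^ 2) + β * z0

    disc≡θ²δ : disc z ≡ (θ ^ 2) * δ
    disc≡θ²δ = I.involution-disc β z0 z1

    disc≡θ³+θ² : disc z ≡ (θ ^ 3) + (θ ^ 2)
    disc≡θ³+θ² = trans disc≡θ²δ (trans (cong ((θ ^ 2) *_) (I.involution-root β z0 z1)) (S.root-factor θ))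

    δ≢0 : δ ≢ 0#
    δ≢0 = xy≢0⇒y≢0 (subst (_≢ 0#) disc≡θ²δ disc≢0)

    J : Matrix
    J = ⟨ 0# , β , 1# , 0# ⟩

    J-stabilises : Stabilises z J
    J-stabilises = subst (_≢ 0#) (sym (S.J-det β)) (-x≢0 β≢0) ,
      acts (I.involution β z0 z1)

    𝐈-stabilises : Stabilises z 𝐈
    𝐈-stabilises = det-𝐈≢0 , Acts-𝐈 z

    J∙J : 𝐈 ∝ J ∙ J
    J∙J = β , β≢0 , S.J² β

    -- The involutions commuting with J.
    Inv : Carrier → Carrier → Matrix
    Inv a c = ⟨ a , - (β * c) , c , - a ⟩

    conic : Carrier → Carrier → Carrier
    conic a c = z1 * ((a ^ 2) + β * (c ^ 2)) + (1# - β * z0) * (a * c)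

    T-stabilises : ∀ {a c} → conic a c ≡ 0# → Acts (Inv a c) z z
    T-stabilises {a} {c} e = acts (I.conic⇒ β z0 z1 a c e)

    T-conic : ∀ {a c} → det (Inv a c) ≢ 0# → Acts (Inv a c) z z → conic a c ≡ 0#
    T-conic {a} {c} g≢0 A = by-cases (a ≟ 0#) (c ≟ 0#) g≢0 (I.conic⇐₁ β z0 z1 a c (cong V4.c0 (Acts.equations A))) (I.conic⇐₂ β z0 z1 a c (cong V4.c1 (Acts.equations A)))
      where
      by-cases : ∀ {a c x} → Dec (a ≡ 0#) → Dec (c ≡ 0#) → det (Inv a c) ≢ 0# → a * x ≡ 0# → c * x ≡ 0# → x ≡ 0#
      by-cases (no a≢0)  _          _   ax≡0 _    = x*y≡0⇒y≡0 _≟_ a≢0 ax≡0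
      by-cases (yes _)   (no c≢0)   _   _    cx≡0 = x*y≡0⇒y≡0 _≟_ c≢0 cx≡0
      by-cases (yes a≡0) (yes refl) g≢0 _    _    = contradiction (C.zero-root β _ a≡0) g≢0

    -- `normalise` is applied both to g and to `J ∙ g`. If one of them is scalar, g is the identity
    -- or `J` up to a scalar; otherwise both have trace 0, and these two linear conditions are
    -- exactly the shape `Inv`.
    stabiliser-element : ∀ g → Stabilises z g → 𝐈 ∝ g ⊎ J ∝ g ⊎ ∃₂ λ a c → g ≡ Inv a c × conic a c ≡ 0#
    stabiliser-element g (g≢0 , G) =
      [ inj₁ , (λ (tr , _) → inj₂
        ([ (λ 𝐈∝Jg → inj₁ (∝-cancel {J} {J} {g} (proj₁ J-stabilises) (∝.trans (∝.sym J∙J) 𝐈∝Jg)))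
         , (λ (tr′ , _) → inj₂ (V4.c0 g , V4.c2 g , involution-shape g g≢0 G tr tr′)) ]′
         (normalise (J ∙ g) (det-∙≢0 {J} {g} (proj₁ J-stabilises) g≢0) disc≢0 (Acts-∙ G (proj₂ J-stabilises))))) ]′
      (normalise g g≢0 disc≢0 G)
      where
      involution-shape : ∀ g → det g ≢ 0# → Acts g z z → trace g ≡ 0# → trace (J ∙ g) ≡ 0# →
                         g ≡ Inv (V4.c0 g) (V4.c2 g) × conic (V4.c0 g) (V4.c2 g) ≡ 0#
      involution-shape g@(⟨ a , b , c , d ⟩) g≢0 G tr tr′ = g≡T ,
        T-conic (subst (λ h → det h ≢ 0#) g≡T g≢0) (subst (λ h → Acts h z z) g≡T G)
        where
        g≡T : g ≡ Inv a c
        g≡T = V4-≡ refl (S.J-trace a b c d β tr′) refl (S.trace-zero a d tr)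

    count-nonsquare : ¬ (∃ λ s → s * s ≡ δ) → ClassCount _∝_ (Stabilises z) 2
    count-nonsquare nonsquare = 𝐈 ∷ J ∷ [] , refl , 𝐈-stabilises ∷ J-stabilises ∷ [] ,
      (𝐈∝̸ (0≢1 ∘ sym) ∷ []) ∷ [] ∷ [] , complete′
      where
      -- A zero of the form would make δ a square: (Bc - z1a)/c is a root of δ if c ≠ 0. If c = 0,
      -- then z1a² = 0, where a = 0 makes the matrix singular and z1 = 0 gives δ = B².
      no-T : ∀ a c → Dec (c ≡ 0#) → det (Inv a c) ≢ 0# → conic a c ≢ 0#
      no-T a c (no c≢0) g≢0 e = nonsquare (_ , S.conic-disc β z0 z1 a c (c ⁻¹) e (⁻¹-inverse c≢0))
      no-T a _ (yes refl) g≢0 e =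
        [ (λ z1≡0 → nonsquare (B , trans (S.conic-disc₀ β z0) (cong (λ x → (B ^ 2) - β * (x ^ 2)) (sym z1≡0))))
        , (λ aa≡0 → g≢0 (C.zero-root β a ([ id , id ]′ (x*y≡0⇒ aa≡0)))) ]′ (x*y≡0⇒ (S.conic-a β z0 z1 a e))
      complete′ : ∀ g → Stabilises z g → Any (g ∝_) (𝐈 ∷ J ∷ [])
      complete′ g (g≢0 , G) =
        [ here ∘ ∝.sym
        , [ there ∘ here ∘ ∝.sym
          , (λ (a , c , eq , e) → contradiction e (no-T a c (c ≟ 0#) (subst (λ h → det h ≢ 0#) eq g≢0))) ]′ ]′
        (stabiliser-element g (g≢0 , G))

    count-4 : ∀ {g h} → Stabilises z g → Stabilises z h →
      ¬ (𝐈 ∝ g) → ¬ (𝐈 ∝ h) → ¬ (J ∝ g) → ¬ (J ∝ h) → ¬ (g ∝ h) →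
      (∀ a c → det (Inv a c) ≢ 0# → conic a c ≡ 0# → g ∝ Inv a c ⊎ h ∝ Inv a c) →
      ClassCount _∝_ (Stabilises z) 4
    count-4 {g} {h} G H 𝐈∝̸g 𝐈∝̸h J∝̸g J∝̸h g∝̸h all-T =
      𝐈 ∷ J ∷ g ∷ h ∷ [] , refl , 𝐈-stabilises ∷ J-stabilises ∷ G ∷ H ∷ [] ,
      (𝐈∝̸ (0≢1 ∘ sym) ∷ 𝐈∝̸g ∷ 𝐈∝̸h ∷ []) ∷ (J∝̸g ∷ J∝̸h ∷ []) ∷ (g∝̸h ∷ []) ∷ [] ∷ [] , complete′
      where
      complete′ : ∀ k → Stabilises z k → Any (k ∝_) (𝐈 ∷ J ∷ g ∷ h ∷ [])
      complete′ k (k≢0 , K) =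
        [ here ∘ ∝.sym
        , [ there ∘ here ∘ ∝.sym
          , (λ (a , c , eq , e) →
              [ (λ g∝T → there (there (here (∝.sym (subst (g ∝_) (sym eq) g∝T)))))
              , (λ h∝T → there (there (there (here (∝.sym (subst (h ∝_) (sym eq) h∝T)))))) ]′
              (all-T a c (subst (λ h → det h ≢ 0#) eq k≢0) e)) ]′ ]′
        (stabiliser-element k (k≢0 , K))

    J∝̸T : ∀ {a c} → a ≢ 0# → ¬ (J ∝ Inv a c)
    J∝̸T a≢0 (k , _ , eq) = a≢0 (trans (cong V4.c0 eq) (zeroʳ k))

    module _ (z1≢0 : z1 ≢ 0#) where
      root-nonzero : ∀ {s} → s * s ≡ δ → B - s ≢ 0#
      root-nonzero {s} s²≡δ B-s≡0 = x*y≢0 β≢0 (x*y≢0 z1≢0 z1≢0) (S.conic-root≢0 β z0 z1 s B-s≡0 s²≡δ)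

      -- In characteristic 3 the quadratic formula (-B + s)/(2z1) for a/c reads (B - s)/z1.
      root-stabilises : ∀ {s} → s ≢ 0# → s * s ≡ δ → Stabilises z (Inv (B - s) z1)
      root-stabilises {s} s≢0 s²≡δ =
        subst (_≢ 0#) (sym (S.conic-root-det β z0 z1 s s²≡δ)) (-x≢0 (x*y≢0 s≢0 (root-nonzero s²≡δ))) ,
        T-stabilises (S.conic-root β z0 z1 s s²≡δ)

      proportional : ∀ {a c r} → c ≢ 0# → z1 * a ≡ r * c → Inv r z1 ∝ Inv a c
      proportional {a} {c} {r} c≢0 e = c * z1 ⁻¹ , x*y≢0 c≢0 (⁻¹≢0 z1≢0) ,
        S.proportional β z1 (z1 ⁻¹) a r c (⁻¹-inverse z1≢0) e

      count-square-generic : ∀ s → s * s ≡ δ → ClassCount _∝_ (Stabilises z) 4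
      count-square-generic s s²≡δ = count-4
        (root-stabilises s≢0 s²≡δ) (root-stabilises (-x≢0 s≢0) -s²≡δ)
        (𝐈∝̸ z1≢0) (𝐈∝̸ z1≢0) (J∝̸T (root-nonzero s²≡δ)) (J∝̸T (root-nonzero -s²≡δ)) distinct all-T
        where
        s≢0 : s ≢ 0#
        s≢0 s≡0 = δ≢0 (trans (sym s²≡δ) (trans (cong (_* s) s≡0) (zeroˡ s)))
        -s²≡δ : (- s) * (- s) ≡ δ
        -s²≡δ = S.neg-square s δ s²≡δ
        distinct : ¬ (Inv (B - s) z1 ∝ Inv (B - (- s)) z1)
        distinct (k , _ , eq) = s≢0 (S.distinct-roots k B s
          (S.same-scale k z1 (z1 ⁻¹) s (⁻¹-inverse z1≢0) (cong V4.c2 eq)) (cong V4.c0 eq))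
        all-T : ∀ a c → det (Inv a c) ≢ 0# → conic a c ≡ 0# → Inv (B - s) z1 ∝ Inv a c ⊎ Inv (B - (- s)) z1 ∝ Inv a c
        all-T a c g≢0 e = by-c (c ≟ 0#) g≢0 e
          where
          by-c : ∀ {c} → Dec (c ≡ 0#) → det (Inv a c) ≢ 0# → conic a c ≡ 0# → Inv (B - s) z1 ∝ Inv a c ⊎ Inv (B - (- s)) z1 ∝ Inv a c
          by-c (yes refl) g≢0 e = contradiction
            (C.zero-root β a ([ id , id ]′ (x*y≡0⇒ (x*y≡0⇒y≡0 _≟_ z1≢0 (S.conic-a β z0 z1 a e))))) g≢0
          by-c {c} (no c≢0) g≢0 e =
            [ inj₁ ∘ proportional c≢0 ∘ S.conic-solve B z1 a c s
            , inj₂ ∘ proportional c≢0 ∘ S.conic-solve⁻ B z1 a c s ]′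
            (x²≡y²⇒ (S.conic-square β z0 z1 a c s e s²≡δ))

    -- The form degenerates to B · ac with B ≠ 0, since δ = B²; its zeros are (1 : 0) and (0 : 1).
    count-square-special : z1 ≡ 0# → ClassCount _∝_ (Stabilises z) 4
    count-square-special z1≡0 = count-4 {Inv 1# 0#} {Inv 0# 1#}
      (subst (_≢ 0#) (sym (S.reflect-det β)) (-x≢0 1≢0) , T-stabilises (on-conic (S.conic₀₁ β z0 1#)))
      (subst (_≢ 0#) (sym (S.antireflect-det β)) β≢0 , T-stabilises (on-conic (S.conic₀₂ β z0 1#)))
      (λ (k , _ , eq) → -x≢0 1≢0 (S.1≉-1 k (cong V4.c0 eq) (cong V4.c3 eq)))
      (𝐈∝̸ 1≢0)
      (J∝̸T 1≢0)
      (λ (k , _ , eq) → -x≢0 β≢0 (S.β≉-β k β (cong V4.c2 eq) (cong V4.c1 eq)))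
      (λ (k , _ , eq) → 1≢0 (trans (cong V4.c2 eq) (zeroʳ k)))
      all-T
      where
      1≢0 : 1# ≢ 0#
      1≢0 = 0≢1 ∘ sym
      on-conic : ∀ {a c} → 0# * ((a ^ 2) + β * (c ^ 2)) + (1# - β * z0) * (a * c) ≡ 0# → conic a c ≡ 0#
      on-conic {a} {c} = subst (λ x → x * ((a ^ 2) + β * (c ^ 2)) + (1# - β * z0) * (a * c) ≡ 0#) (sym z1≡0)
      B≢0 : B ≢ 0#
      B≢0 = xy≢0⇒x≢0 (subst (_≢ 0#) (trans (cong (λ x → (B ^ 2) - β * (x ^ 2)) z1≡0) (sym (S.conic-disc₀ β z0))) δ≢0)
      all-T : ∀ a c → det (Inv a c) ≢ 0# → conic a c ≡ 0# → Inv 1# 0# ∝ Inv a c ⊎ Inv 0# 1# ∝ Inv a c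
      all-T a c g≢0 e = by-cases (a ≟ 0#) (c ≟ 0#) g≢0 e
        where
        by-cases : ∀ {a c} → Dec (a ≡ 0#) → Dec (c ≡ 0#) → det (Inv a c) ≢ 0# → conic a c ≡ 0# →
                   Inv 1# 0# ∝ Inv a c ⊎ Inv 0# 1# ∝ Inv a c
        by-cases {a} (yes a≡0) (yes refl) g≢0 e = contradiction (C.zero-root β a a≡0) g≢0
        by-cases {c = c} (yes refl) (no c≢0) g≢0 e = inj₂ (c , c≢0 ,
          S.antidiagonal-scale β c)
        by-cases {a} (no a≢0) (yes refl) g≢0 e = inj₁ (a , a≢0 ,
          S.diagonal-scale β a)
        by-cases {a} {c} (no a≢0) (no c≢0) g≢0 e = contradiction
          (x*y≡0⇒y≡0 _≟_ B≢0 (S.conic₀ β z0 a c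
            (subst (λ x → x * ((a ^ 2) + β * (c ^ 2)) + (1# - β * z0) * (a * c) ≡ 0#) z1≡0 e)))
          (x*y≢0 a≢0 c≢0)

    count-square : ∀ s → s * s ≡ δ → ClassCount _∝_ (Stabilises z) 4
    count-square s s²≡δ with z1 ≟ 0#
    ... | yes z1≡0 = count-square-special z1≡0
    ... | no  z1≢0 = count-square-generic z1≢0 s s²≡δ

  square-quotient : ∀ {x θ δ} → θ ≢ 0# → x ≡ (θ ^ 2) * δ → (∃ λ s → s * s ≡ x) → ∃ λ s → s * s ≡ δ
  square-quotient {x} {θ} {δ} θ≢0 x≡ (s , s²≡x) = s * θ ⁻¹ , C.square-quotient s x θ (θ ⁻¹) δ s²≡x (⁻¹-inverse θ≢0) x≡

  square-product : ∀ {x θ δ} → x ≡ (θ ^ 2) * δ → (∃ λ s → s * s ≡ δ) → ∃ λ s → s * s ≡ x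
  square-product {x} {θ} {δ} x≡ (s , s²≡δ) = θ * s , C.square-product s x θ δ s²≡δ x≡

  module _ {z : Quartic} (disc≢0 : disc z ≢ 0#) where
    -- The square class of δ at the involutive representative is that of `disc z`, because the two
    -- differ by the nonzero square θ² and `disc` is constant on the orbit.
    involutive-count : InvolutiveForm z → (∃ λ s → s * s ≡ disc z) × ClassCount _∝_ (Stabilises z) 4 ⊎
                       ¬ (∃ λ s → s * s ≡ disc z) × ClassCount _∝_ (Stabilises z) 2
    involutive-count (h , ⟨ z0 , z1 , _ , _ ⟩ , h≢0 , H , involutive β β≢0 refl refl) = by-square (∃? (λ s → s * s ≟ δ))
      where
      disc≡ = Acts⇒disc-≡ h≢0 H
      open InvolutiveQuartic β z0 z1 β≢0 (subst (_≢ 0#) (sym disc≡) disc≢0) using (δ; θ; disc≡θ²δ; count-square; count-nonsquare)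
      disc≡′ : disc z ≡ (θ ^ 2) * δ
      disc≡′ = trans (sym disc≡) disc≡θ²δ
      θ≢0 : θ ≢ 0#
      θ≢0 = xy≢0⇒x≢0 (xy≢0⇒x≢0 (subst (_≢ 0#) disc≡′ disc≢0))
      by-square : Dec (∃ λ s → s * s ≡ δ) → _
      by-square (yes (s , s²≡δ)) = inj₁ (square-product disc≡′ (s , s²≡δ) , stabiliser-conjugate h≢0 H (count-square s s²≡δ))
      by-square (no nonsquare)   = inj₂ (nonsquare ∘ square-quotient θ≢0 disc≡′ , stabiliser-conjugate h≢0 H (count-nonsquare nonsquare))

    InvolutiveForm⇒root : InvolutiveForm z → ∃ λ θ → disc z ≡ (θ ^ 3) + (θ ^ 2)
    InvolutiveForm⇒root (h , ⟨ z0 , z1 , _ , _ ⟩ , h≢0 , H , involutive β β≢0 refl refl) =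
      let disc≡ = Acts⇒disc-≡ h≢0 H in
      _ , trans (sym disc≡) (InvolutiveQuartic.disc≡θ³+θ² β z0 z1 β≢0 (subst (_≢ 0#) (sym disc≡) disc≢0))

    stabiliser-1 : ¬ (∃ λ θ → disc z ≡ (θ ^ 3) + (θ ^ 2)) → ClassCount _∝_ (Stabilises z) 1
    stabiliser-1 no-root = 𝐈 ∷ [] , refl , (det-𝐈≢0 , Acts-𝐈 z) ∷ [] , [] ∷ [] , λ g (g≢0 , G) →
      [ here ∘ ∝.sym , (λ (_ , form) → contradiction (InvolutiveForm⇒root form) no-root) ]′ (normalise g g≢0 disc≢0 G)

    stabiliser-2 : ∀ θ → disc z ≡ (θ ^ 3) + (θ ^ 2) → ¬ (∃ λ s → s * s ≡ disc z) → ClassCount _∝_ (Stabilises z) 2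
    stabiliser-2 θ root nonsquare with involutive-count (root⇒InvolutiveForm θ z disc≢0 root)
    ... | inj₁ (square , _) = contradiction square nonsquare
    ... | inj₂ (_ , count)  = count

    stabiliser-4 : ∀ θ → disc z ≡ (θ ^ 3) + (θ ^ 2) → (∃ λ s → s * s ≡ disc z) → ClassCount _∝_ (Stabilises z) 4
    stabiliser-4 θ root square with involutive-count (root⇒InvolutiveForm θ z disc≢0 root)
    ... | inj₁ (_ , count)     = count
    ... | inj₂ (nonsquare , _) = contradiction square nonsquare

-- Counting matrices, quartics of given discriminant, and orbits.

module ParametrisationIdentities (F : Field) (char3 : HasChar3 F) where
  open FieldProperties.Char3Solver F char3 using (follows)
  open ActionExpressions
  private
    cubic : ∀ {n} → Expr n → Expr n
    cubic v = v ^ 3 + v ^ 2 + v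

  unscale = follows 3 (λ k a a′ → :1 ≈ k * :1 ∙[ a ]⇒ a′ ≈ k * a ∙[ - :1 ]⇒ concl (a ≈ a′)) _
  upper-det = follows 3 (λ D a d → concl (a * d - (a * d - D) * :1 ≈ D)) _
  upper-inj = follows 6 (λ a d D a′ d′ D′ → a ≈ a′ ∙[ d ]⇒ d ≈ d′ ∙[ a′ ]⇒ a * d - D ≈ a′ * d′ - D′ ∙[ - :1 ]⇒
    concl (D ≈ D′)) _
  upper-b = follows 5 (λ a b c d γ → c * γ ≈ :1 ∙[ b * γ ]⇒
    concl (a * γ * (d * γ) - γ ^ 2 * (a * d - b * c) ≈ γ * b)) _
  bigcell-disc = follows 5 (λ z1 z3 ζ e u → z1 * ζ ≈ :1 ∙[ - ((u ^ 3 + u ^ 2 - e) * (z1 * ζ + :1)) ]⇒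
    :0 - z1 * z3 ≈ u ∙[ (z1 * z3) ^ 2 - u * z1 * z3 + u ^ 2 + u - z1 * z3 ]⇒
    concl (disc ⟨ :0 , z1 , z3 , (u ^ 3 + u ^ 2 - e) * ζ ^ 2 ⟩ ≈ e)) _
  bigcell-z4 = follows 5 (λ z1 z3 z4 ζ e → let w = :0 - z1 * z3 in z1 * ζ ≈ :1 ∙[ - (z4 * (z1 * ζ + :1)) ]⇒
    disc ⟨ :0 , z1 , z3 , z4 ⟩ ≈ e ∙[ - ζ ^ 2 ]⇒
    concl (z4 ≈ (w ^ 3 + w ^ 2 - e) * ζ ^ 2)) _
  translate-z1 = follows 4 (λ u u′ z0 ζ → z0 * ζ ≈ :1 ∙[ u′ - u ]⇒ :0 - u * z0 ≈ :0 - u′ * z0 ∙[ - ζ ]⇒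
    concl (u ≈ u′)) _
  product-v = follows 3 (λ v x i → x * i ≈ :1 ∙[ v ]⇒ concl (x * (v * i) ≈ v)) _
  double-root-disc = follows 3 (λ v x i → let p = x * (v * i) in x * i ≈ :1 ∙[ v * (p ^ 2 + p * v + v ^ 2 + p + v + :1) ]⇒
    concl (disc ⟨ x , :0 , :0 , v * i ⟩ ≈ cubic v)) _
  double-root-cubic = follows 2 (λ z0 z4 → concl (disc ⟨ z0 , :0 , :0 , z4 ⟩ ≈ cubic (z0 * z4))) _
  restore-z4 = follows 3 (λ z0 z4 ζ → z0 * ζ ≈ :1 ∙[ - z4 ]⇒ concl (z4 ≈ z0 * z4 * ζ)) _
  general-product = follows 5 (λ p π x ξ v → p * π ≈ :1 ∙[ v * (x * ξ) ^ 2 ]⇒ x * ξ ≈ :1 ∙[ v * (x * ξ + :1) ]⇒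
    concl (p * ξ ^ 2 * (v * x ^ 2 * π) ≈ v)) _
  general-disc = follows 5 (λ z0 x z4 v e → z0 * z4 ≈ v ∙[ (z0 * z4) ^ 2 + z0 * z4 * v + v ^ 2 + z0 * z4 + v + :1 ]⇒
    z0 * x ^ 2 ≈ cubic v - e ∙[ - :1 ]⇒
    concl (disc ⟨ z0 , :0 , x , z4 ⟩ ≈ e)) _
  general-z0x² = follows 3 (λ p x ξ → x * ξ ≈ :1 ∙[ p * (x * ξ + :1) ]⇒ concl (p * ξ ^ 2 * x ^ 2 ≈ p)) _
  general-relation = follows 4 (λ z0 x z4 e → disc ⟨ z0 , :0 , x , z4 ⟩ ≈ e ∙[ :1 ]⇒
    concl (cubic (z0 * z4) - e ≈ z0 * x ^ 2)) _
  general-z0 = follows 4 (λ z0 x ξ p → x * ξ ≈ :1 ∙[ - (z0 * (x * ξ + :1)) ]⇒ p ≈ z0 * x ^ 2 ∙[ - ξ ^ 2 ]⇒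
    concl (z0 ≈ p * ξ ^ 2)) _
  general-z4 = follows 5 (λ z0 z4 x p π → p * π ≈ :1 ∙[ - z4 ]⇒ p ≈ z0 * x ^ 2 ∙[ z4 * π ]⇒
    concl (z4 ≈ z0 * z4 * x ^ 2 * π)) _

module Counting (FF : FiniteField) (char3 : Char3 FF) where
  open Char3FiniteField FF char3
  open Action FF char3
  open Stabiliser FF char3
  open StabiliserCount FF char3
  private
    module M = MatrixIdentities field' char3
    module P = ParametrisationIdentities field' char3

  q-1 : ℕ
  q-1 = proj₁ nonzero-count

  -- The summands are the two Bruhat cells, c = 0 and c ≠ 0. The same two numbers count the quartics
  -- of given discriminant with z0 = 0 and with z0 ≠ 0.
  group-order : ℕ
  group-order = q-1 ℕ.* q ℕ.+ q-1 ℕ.* (q ℕ.* q)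

  nonzero : ClassCount _≡_ (_≢ 0#) q-1
  nonzero = proj₂ (proj₂ nonzero-count)

  lower-count : ClassCount _∝_ (λ g → det g ≢ 0# × V4.c2 g ≡ 0#) (q-1 ℕ.* q)
  lower-count = ClassCount-image ∝.trans (λ (a , b) → ⟨ a , b , 0# , 1# ⟩)
    (λ {(a , b)} (a≢0 , _) → subst (_≢ 0#) (sym (trans (M.det-triangular a b 1#) (*-identityʳ a))) a≢0 , refl)
    (λ {(a , b)} {(a′ , b′)} _ _ (k , _ , eq) → cong₂ _,_
      (P.unscale k a a′ (cong V4.c3 eq) (cong V4.c0 eq)) (P.unscale k b b′ (cong V4.c3 eq) (cong V4.c1 eq)))
    (λ { _ _ refl → ∝.refl })
    onto
    (ClassCount-× nonzero count-all)
    where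
    onto : ∀ g → det g ≢ 0# × V4.c2 g ≡ 0# → ∃ λ (a , b) → (a ≢ 0# × ⊤) × g ∝ ⟨ a , b , 0# , 1# ⟩
    onto ⟨ a , b , _ , d ⟩ (g≢0 , refl) =
      (d ⁻¹ * a , d ⁻¹ * b) , (x*y≢0 (⁻¹≢0 d≢0) (xy≢0⇒x≢0 ad≢0) , tt) ,
      d ⁻¹ , ⁻¹≢0 d≢0 , V4-≡ refl refl (sym (zeroʳ _)) (sym (trans (*-comm _ _) (⁻¹-inverse d≢0)))
      where
      ad≢0 : a * d ≢ 0#
      ad≢0 = subst (_≢ 0#) (M.det-triangular a b d) g≢0
      d≢0 : d ≢ 0#
      d≢0 = xy≢0⇒y≢0 ad≢0

  -- With c scaled to 1, the entries a and d are free and b = ad - D is governed by the determinant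
  -- D, which ranges over the nonzero elements.
  upper-count : ClassCount _∝_ (λ g → det g ≢ 0# × V4.c2 g ≢ 0#) (q-1 ℕ.* (q ℕ.* q))
  upper-count = ClassCount-image ∝.trans (λ (D , a , d) → ⟨ a , a * d - D , 1# , d ⟩)
    (λ {(D , a , d)} (D≢0 , _) → subst (_≢ 0#) (sym (P.upper-det D a d)) D≢0 , 0≢1 ∘ sym)
    inj
    (λ { _ _ refl → ∝.refl })
    onto
    (ClassCount-× nonzero (ClassCount-× count-all count-all))
    where
    inj : ∀ {x x′ : Carrier × Carrier × Carrier} → proj₁ x ≢ 0# × ⊤ × ⊤ → proj₁ x′ ≢ 0# × ⊤ × ⊤ →
      (λ ((D , a , d) : Carrier × Carrier × Carrier) → ⟨ a , a * d - D , 1# , d ⟩) x ∝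
      (λ ((D , a , d) : Carrier × Carrier × Carrier) → ⟨ a , a * d - D , 1# , d ⟩) x′ → x ≡ x′
    inj {D , a , d} {D′ , a′ , d′} _ _ (k , _ , eq) =
      cong₂ _,_ (P.upper-inj a d D a′ d′ D′ a≡ d≡ (P.unscale k _ _ (cong V4.c2 eq) (cong V4.c1 eq))) (cong₂ _,_ a≡ d≡)
      where
      a≡ = P.unscale k a a′ (cong V4.c2 eq) (cong V4.c0 eq)
      d≡ = P.unscale k d d′ (cong V4.c2 eq) (cong V4.c3 eq)
    onto : ∀ g → det g ≢ 0# × V4.c2 g ≢ 0# →
           ∃ λ (D , a , d) → (D ≢ 0# × ⊤ × ⊤) × g ∝ ⟨ a , a * d - D , 1# , d ⟩
    onto ⟨ a , b , c , d ⟩ (g≢0 , c≢0) =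
      ((γ ^ 2) * (a * d - b * c) , a * γ , d * γ) , (x*y≢0 (x≢0⇒xⁿ≢0 (⁻¹≢0 c≢0) 2) g≢0 , tt , tt) ,
      γ , ⁻¹≢0 c≢0 , V4-≡ (*-comm a γ) (P.upper-b a b c d γ (⁻¹-inverse c≢0))
        (sym (trans (*-comm γ c) (⁻¹-inverse c≢0))) (*-comm d γ)
      where γ = c ⁻¹

  group-count : ClassCount _∝_ (λ g → det g ≢ 0#) group-order
  group-count = ClassCount-resp [ proj₁ , proj₁ ]′ (λ {g} g≢0 → by-c g g≢0 (V4.c2 g ≟ 0#))
    (ClassCount-⊎ (λ { (_ , c≡0) (_ , c≢0) (k , _ , refl) → c≢0 (trans (cong (k *_) c≡0) (zeroʳ k)) }) lower-count upper-count)
    where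
    by-c : ∀ g → det g ≢ 0# → Dec (V4.c2 g ≡ 0#) → det g ≢ 0# × V4.c2 g ≡ 0# ⊎ det g ≢ 0# × V4.c2 g ≢ 0#
    by-c g g≢0 (yes c≡0) = inj₁ (g≢0 , c≡0)
    by-c g g≢0 (no c≢0)  = inj₂ (g≢0 , c≢0)

  module _ (e : Carrier) (e≢0 : e ≢ 0#) where

    z0≡0-count : ClassCount _≡_ (λ z → disc z ≡ e × V4.c0 z ≡ 0#) (q-1 ℕ.* q)
    z0≡0-count = ClassCount-image trans point
      (λ {(z1 , z3)} (z1≢0 , _) → P.bigcell-disc z1 z3 (z1 ⁻¹) e _ (⁻¹-inverse z1≢0) refl , refl)
      (λ _ _ eq → cong₂ _,_ (cong V4.c1 eq) (cong V4.c2 eq))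
      (λ _ _ → cong point)
      onto
      (ClassCount-× nonzero count-all)
      where
      point : Carrier × Carrier → Quartic
      point (z1 , z3) = ⟨ 0# , z1 , z3 , ((w ^ 3) + (w ^ 2) - e) * (z1 ⁻¹ ^ 2) ⟩
        where w = 0# - z1 * z3
      onto : ∀ z → disc z ≡ e × V4.c0 z ≡ 0# → ∃ λ x → (proj₁ x ≢ 0# × ⊤) × z ≡ point x
      onto z@(⟨ _ , z1 , z3 , z4 ⟩) (disc≡e , refl) =
        (z1 , z3) , (z1≢0 , tt) , V4-≡ refl refl refl (P.bigcell-z4 z1 z3 z4 (z1 ⁻¹) e (⁻¹-inverse z1≢0) disc≡e)
        where z1≢0 = z0≡0⇒z1≢0 z refl (subst (_≢ 0#) (sym disc≡e) e≢0)

    cubic : Carrier → Carrier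
    cubic v = (v ^ 3) + (v ^ 2) + v

    Slice : Quartic → Set
    Slice z = disc z ≡ e × V4.c0 z ≢ 0# × V4.c1 z ≡ 0#

    z3≡0-count : ∀ {n} → ClassCount _≡_ (λ v → ⊤ × cubic v ≡ e) n →
                 ClassCount _≡_ (λ z → Slice z × V4.c2 z ≡ 0#) (n ℕ.* q-1)
    z3≡0-count count = ClassCount-image trans point
      (λ {(v , x)} ((_ , v-root) , x≢0) →
         (trans (P.double-root-disc v x (x ⁻¹) (⁻¹-inverse x≢0)) v-root , x≢0 , refl) , refl)
      (λ {(v , x)} {(v′ , x′)} (_ , x≢0) (_ , x′≢0) eq → cong₂ _,_
        (trans (sym (P.product-v v x (x ⁻¹) (⁻¹-inverse x≢0)))
          (trans (cong (λ z → V4.c0 z * V4.c3 z) eq) (P.product-v v′ x′ (x′ ⁻¹) (⁻¹-inverse x′≢0))))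
        (cong V4.c0 eq))
      (λ _ _ → cong point)
      onto
      (ClassCount-× count nonzero)
      where
      point : Carrier × Carrier → Quartic
      point (v , x) = ⟨ x , 0# , 0# , v * x ⁻¹ ⟩
      onto : ∀ z → Slice z × V4.c2 z ≡ 0# → ∃ λ y → ((⊤ × cubic (proj₁ y) ≡ e) × proj₂ y ≢ 0#) × z ≡ point y
      onto ⟨ z0 , _ , _ , z4 ⟩ ((disc≡e , z0≢0 , refl) , refl) = (z0 * z4 , z0) ,
        ((tt , trans (sym (P.double-root-cubic z0 z4)) disc≡e) , z0≢0) ,
        V4-≡ refl refl refl (P.restore-z4 z0 z4 (z0 ⁻¹) (⁻¹-inverse z0≢0))

    z3≢0-count : ∀ {n} → ClassCount _≡_ (λ v → ⊤ × cubic v ≢ e) n →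
                 ClassCount _≡_ (λ z → Slice z × V4.c2 z ≢ 0#) (n ℕ.* q-1)
    z3≢0-count count = ClassCount-image trans point
      sound
      (λ {y} {y′} Py Py′ eq → cong₂ _,_
        (trans (sym (point-v y Py)) (trans (cong (λ z → V4.c0 z * V4.c3 z) eq) (point-v y′ Py′)))
        (cong V4.c2 eq))
      (λ _ _ → cong point)
      onto
      (ClassCount-× count nonzero)
      where
      Parameter : Carrier × Carrier → Set
      Parameter (v , x) = (⊤ × cubic v ≢ e) × x ≢ 0#
      point : Carrier × Carrier → Quartic
      point (v , x) = ⟨ (cubic v - e) * (x ⁻¹ ^ 2) , 0# , x , v * (x ^ 2) * (cubic v - e) ⁻¹ ⟩
      point-v : ∀ y → Parameter y → V4.c0 (point y) * V4.c3 (point y) ≡ proj₁ y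
      point-v (v , x) ((_ , v≢) , x≢0) =
        P.general-product (cubic v - e) _ x (x ⁻¹) v (⁻¹-inverse (x≢y⇒x-y≢0 v≢)) (⁻¹-inverse x≢0)
      sound : ∀ {y} → Parameter y → Slice (point y) × V4.c2 (point y) ≢ 0#
      sound {v , x} ((_ , v≢) , x≢0) =
        (P.general-disc _ x _ v e (point-v (v , x) ((tt , v≢) , x≢0)) (P.general-z0x² (cubic v - e) x (x ⁻¹) (⁻¹-inverse x≢0)) ,
         x*y≢0 (x≢y⇒x-y≢0 v≢) (x≢0⇒xⁿ≢0 (⁻¹≢0 x≢0) 2) , refl) , x≢0
      onto : ∀ z → Slice z × V4.c2 z ≢ 0# → ∃ λ y → Parameter y × z ≡ point y
      onto ⟨ z0 , _ , x , z4 ⟩ ((disc≡e , z0≢0 , refl) , x≢0) = (z0 * z4 , x) , ((tt , v≢) , x≢0) ,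
        V4-≡ (P.general-z0 z0 x (x ⁻¹) _ (⁻¹-inverse x≢0) relation) refl refl
             (P.general-z4 z0 z4 x _ _ (⁻¹-inverse (x≢y⇒x-y≢0 v≢)) relation)
        where
        relation : cubic (z0 * z4) - e ≡ z0 * (x ^ 2)
        relation = P.general-relation z0 x z4 e disc≡e
        v≢ : cubic (z0 * z4) ≢ e
        v≢ eq = x*y≢0 z0≢0 (x≢0⇒xⁿ≢0 x≢0 2) (trans (sym relation) (trans (cong (_- e) eq) (-‿inverseʳ e)))

    -- Let n be the number of solutions of `cubic v ≡ e`. Each of them forces z3 = 0 and leaves z0 ≠
    -- 0 free; every other v leaves z3 ≠ 0 free and forces z0 = (cubic v - e)/z3². Both kinds
    -- contribute q - 1 quartics for each v, so the unknown n cancels.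
    slice-count : ClassCount _≡_ Slice (q ℕ.* q-1)
    slice-count =
      let roots = ClassCount-filter (λ v → cubic v ≟ e) (λ { refl → id }) (proj₁ count-all , proj₂ (proj₂ count-all))
          (k , n+k≡q , non-roots) = ClassCount-complement isEquivalence (λ v → cubic v ≟ e) (λ { refl → id }) count-all roots
      in assemble n+k≡q roots non-roots
      where
      by-z3 : ∀ z → Slice z → Dec (V4.c2 z ≡ 0#) → Slice z × V4.c2 z ≡ 0# ⊎ Slice z × V4.c2 z ≢ 0#
      by-z3 _ Sz (yes z3≡0) = inj₁ (Sz , z3≡0)
      by-z3 _ Sz (no z3≢0)  = inj₂ (Sz , z3≢0)
      assemble : ∀ {n k} → n ℕ.+ k ≡ q → ClassCount _≡_ (λ v → ⊤ × cubic v ≡ e) n →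
                 ClassCount _≡_ (λ v → ⊤ × cubic v ≢ e) k → ClassCount _≡_ Slice (q ℕ.* q-1)
      assemble {n} {k} n+k≡q roots non-roots =
        subst (ClassCount _≡_ Slice) (trans (sym (ℕ.*-distribʳ-+ q-1 n k)) (cong (ℕ._* q-1) n+k≡q))
          (ClassCount-resp [ proj₁ , proj₁ ]′ (λ {z} Sz → by-z3 z Sz (V4.c2 z ≟ 0#))
            (ClassCount-⊎ (λ { (_ , z3≡0) (_ , z3≢0) refl → z3≢0 z3≡0 }) (z3≡0-count roots) (z3≢0-count non-roots)))

    -- Every quartic with z0 ≠ 0 is a unique translate of one in the slice z1 = 0.
    z0≢0-count : ClassCount _≡_ (λ z → disc z ≡ e × V4.c0 z ≢ 0#) (q ℕ.* q-1 ℕ.* q)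
    z0≢0-count = ClassCount-image trans (λ (y , u) → translate u y)
      (λ {(y , u)} ((disc≡e , z0≢0 , _) , _) → trans (disc-translate u y) disc≡e , z0≢0)
      inj (λ _ _ → cong (λ (y , u) → translate u y)) onto
      (ClassCount-× slice-count count-all)
      where
      shift-≡ : ∀ {z0 z1 z0′ z1′ u u′} → z0 ≢ 0# → z1 ≡ 0# → z1′ ≡ 0# → z0 ≡ z0′ → z1 - u * z0 ≡ z1′ - u′ * z0′ → u ≡ u′
      shift-≡ {z0} {u = u} {u′} z0≢0 refl refl refl = P.translate-z1 u u′ z0 (z0 ⁻¹) (⁻¹-inverse z0≢0)
      translate-injective : ∀ u {y y′} → translate u y ≡ translate u y′ → y ≡ y′
      translate-injective u {y} {y′} eq = Acts-functional (det-adj≢0 {translation u} (det-translation≢0 u))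
        (Acts-adj (det-translation≢0 u) (Acts-translation u y))
        (subst (λ z → Acts (adj (translation u)) z y′) (sym eq) (Acts-adj (det-translation≢0 u) (Acts-translation u y′)))
      inj : ∀ {x x′} → Slice (proj₁ x) × ⊤ → Slice (proj₁ x′) × ⊤ →
            translate (proj₂ x) (proj₁ x) ≡ translate (proj₂ x′) (proj₁ x′) → x ≡ x′
      inj {y , u} {y′ , u′} ((_ , z0≢0 , z1≡0) , _) ((_ , _ , z1′≡0) , _) eq = cong₂ _,_
        (translate-injective u (trans eq (cong (λ x → translate x y′) (sym u≡u′)))) u≡u′
        where
        u≡u′ : u ≡ u′
        u≡u′ = shift-≡ z0≢0 z1≡0 z1′≡0 (cong V4.c0 eq) (cong V4.c1 eq)
      onto : ∀ z → disc z ≡ e × V4.c0 z ≢ 0# → ∃ λ x → (Slice (proj₁ x) × ⊤) × z ≡ translate (proj₂ x) (proj₁ x)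
      onto z (disc≡e , z0≢0) =
        let u = V4.c1 z * V4.c0 z ⁻¹
            (z3 , z4 , H) = translate-z1≡0 z z0≢0
            y = ⟨ V4.c0 z , 0# , z3 , z4 ⟩
        in (y , - u) , ((trans (Acts⇒disc-≡ (det-translation≢0 u) H) disc≡e , z0≢0 , refl) , tt) ,
           Acts-functional (det-translation≢0 (- u))
             (subst (λ c → Acts ⟨ 1# , - u , c , 1# ⟩ y z) -0#≈0# (Acts-adj (det-translation≢0 u) H))
             (Acts-translation (- u) y)

    quartic-count : ClassCount _≡_ (λ z → disc z ≡ e) group-order
    quartic-count = subst (ClassCount _≡_ _) size
      (ClassCount-resp [ proj₁ , proj₁ ]′ (λ {z} eq → by-z0 z eq (V4.c0 z ≟ 0#))
        (ClassCount-⊎ (λ { (_ , z0≡0) (_ , z0≢0) refl → z0≢0 z0≡0 }) z0≡0-count z0≢0-count))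
      where
      by-z0 : ∀ z → disc z ≡ e → Dec (V4.c0 z ≡ 0#) → disc z ≡ e × V4.c0 z ≡ 0# ⊎ disc z ≡ e × V4.c0 z ≢ 0#
      by-z0 _ eq (yes z0≡0) = inj₁ (eq , z0≡0)
      by-z0 _ eq (no z0≢0)  = inj₂ (eq , z0≢0)
      size : q-1 ℕ.* q ℕ.+ q ℕ.* q-1 ℕ.* q ≡ group-order
      size = cong (q-1 ℕ.* q ℕ.+_) (trans (cong (ℕ._* q) (ℕ.*-comm q q-1)) (ℕ.*-assoc q-1 q q))

  infix 4 _∼_ _∼?_
  _∼_ : Quartic → Quartic → Set
  z ∼ y = ∃ λ g → det g ≢ 0# × Acts g z y

  ∼-isEquivalence : IsEquivalence _∼_
  ∼-isEquivalence = record
    { refl  = λ {z} → 𝐈 , det-𝐈≢0 , Acts-𝐈 z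
    ; sym   = λ (g , g≢0 , G) → adj g , det-adj≢0 {g} g≢0 , Acts-adj g≢0 G
    ; trans = λ (g , g≢0 , G) (h , h≢0 , H) → h ∙ g , det-∙≢0 {h} {g} h≢0 g≢0 , Acts-∙ G H
    }

  _∼?_ : Decidable _∼_
  z ∼? y = map′ (λ (a , b , c , d , g≢0 , eq) → ⟨ a , b , c , d ⟩ , g≢0 , subst (Acts _ z) eq (Acts-▷ z g≢0))
                (λ { (⟨ a , b , c , d ⟩ , g≢0 , G) → a , b , c , d , g≢0 , sym (Acts⇒▷ g≢0 G) })
    (∃? λ a → ∃? λ b → ∃? λ c → ∃? λ d → ¬? (det ⟨ a , b , c , d ⟩ ≟ 0#) ×-dec (⟨ a , b , c , d ⟩ ▷ z ≟ᵛ y))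

  SameImage : Quartic → Matrix → Matrix → Set
  SameImage z g h = g ▷ z ≡ h ▷ z

  coset-count : ∀ {z i} → ClassCount _∝_ (Stabilises z) i →
    ∀ g → det g ≢ 0# → ClassCount _∝_ (λ h → det h ≢ 0# × SameImage z g h) i
  coset-count {z} stabiliser g g≢0 = ClassCount-image ∝.trans (g ∙_)
    (λ {s} → sound s)
    (λ {s} {s′} _ _ → ∝-cancel {g} {s} {s′} g≢0)
    (λ {s} {s′} _ _ → ∝⇒∙∝ g {s} {s′})
    onto
    stabiliser
    where
    sound : ∀ s → Stabilises z s → det (g ∙ s) ≢ 0# × SameImage z g (g ∙ s)
    sound s (s≢0 , S) = det-∙≢0 {g} {s} g≢0 s≢0 ,
      Acts⇒▷ {g ∙ s} {z} {g ▷ z} (det-∙≢0 {g} {s} g≢0 s≢0) (Acts-∙ {g} {s} {z} {z} {g ▷ z} S (Acts-▷ z g≢0))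
    onto : ∀ h → det h ≢ 0# × SameImage z g h → ∃ λ s → Stabilises z s × h ∝ g ∙ s
    onto h (h≢0 , eq) = adj g ∙ h ,
      (det-∙≢0 {adj g} {h} (det-adj≢0 {g} g≢0) h≢0 ,
       Acts-∙ {adj g} {h} {z} {g ▷ z} {z} (subst (Acts h z) (sym eq) (Acts-▷ z h≢0))
         (Acts-adj {g} {z} {g ▷ z} g≢0 (Acts-▷ z g≢0))) ,
      det g , g≢0 , M.∙-adj-∙ g h

  -- Orbit and stabiliser: the fibres of g ↦ g ▷ z are the left cosets of the stabiliser, each with
  -- i elements up to scalars.
  orbit-size : ∀ {z i} → ClassCount _∝_ (Stabilises z) i → ∃ λ m → m ℕ.* i ≡ group-order × ClassCount _≡_ (z ∼_) m
  orbit-size {z} {i} stabiliser =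
    let (m , m*i≡N , count) = ClassCount-quotient {_≈_ = SameImage z} (On.isEquivalence (_▷ z) isEquivalence)
                                (λ g h → g ▷ z ≟ᵛ h ▷ z) i
                                ∝-isEquivalence (λ {g} {h} → ▷-∝ {g} {h} z) group-count (coset-count stabiliser)
    in m , m*i≡N , ClassCount-image {_~_ = SameImage z} {P = λ g → det g ≢ 0#} trans (_▷ z)
         (λ {g} g≢0 → g , g≢0 , Acts-▷ z g≢0) (λ _ _ → id) (λ _ _ → id)
         (λ y (g , g≢0 , G) → g , g≢0 , Acts⇒▷ {g} {z} {y} g≢0 G) count

  group-order+q≡q³ : group-order ℕ.+ q ≡ q ℕ.^ 3
  group-order+q≡q³ = subst (λ x → q-1 ℕ.* x ℕ.+ q-1 ℕ.* (x ℕ.* x) ℕ.+ x ≡ x ℕ.^ 3) (proj₁ (proj₂ nonzero-count))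
    (+-*-Solver.solve 1 (λ k → let x = con 1 :+ k in k :* x :+ k :* (x :* x) :+ x := x :* (x :* (x :* con 1))) refl q-1)
    where open +-*-Solver

  group-order≡ : group-order ≡ q ℕ.^ 3 ℕ.∸ q
  group-order≡ = trans (sym (ℕ.m+n∸n≡m group-order q)) (cong (ℕ._∸ q) group-order+q≡q³)

  module _ (i : ℕ) .{{_ : NonZero i}} (e : Carrier) (e≢0 : e ≢ 0#)
           (stabiliser : ∀ z → disc z ≡ e → ClassCount _∝_ (Stabilises z) i) where

    orbit-size′ : ∀ z → disc z ≡ e → ClassCount _≡_ (z ∼_) (group-order ℕ./ i)
    orbit-size′ z disc≡e = let (m , m*i≡N , count) = orbit-size (stabiliser z disc≡e) in
      subst (ClassCount _≡_ (z ∼_)) (trans (sym (ℕ.m*n/n≡m m i)) (cong (ℕ._/ i) m*i≡N)) count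

    orbit-count : 0 ℕ.< group-order → ClassCount _∼_ (λ z → disc z ≡ e) i
    orbit-count 0<N =
      let (l , l*s≡N , count) = ClassCount-quotient ∼-isEquivalence _∼?_ (group-order ℕ./ i) isEquivalence
                                  (λ { refl → IsEquivalence.refl ∼-isEquivalence }) (quartic-count e e≢0)
                                  (λ z disc≡e → ClassCount-resp
                                    (λ { (g , g≢0 , G) → trans (Acts⇒disc-≡ g≢0 G) disc≡e , g , g≢0 , G }) proj₂
                                    (orbit-size′ z disc≡e))
      in subst (ClassCount _∼_ _) (l≡i l l*s≡N) count
      where
      -- Division of natural numbers truncates; that i divides the order is read off from the orbit
      -- of one quartic of discriminant e, which exists since there are |G| > 0 of them.
      s*i≡N : group-order ℕ./ i ℕ.* i ≡ group-order
      s*i≡N = from-representative (quartic-count e e≢0)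
        where
        from-representative : ClassCount _≡_ (λ z → disc z ≡ e) group-order → _
        from-representative ([] , 0≡N , _) = contradiction 0≡N (ℕ.<⇒≢ 0<N)
        from-representative (z ∷ _ , _ , disc≡e ∷ _ , _) =
          let (m , m*i≡N , _) = orbit-size (stabiliser z disc≡e) in
          trans (cong (ℕ._* i) (trans (cong (ℕ._/ i) (sym m*i≡N)) (ℕ.m*n/n≡m m i))) m*i≡N
      l≡i : ∀ l → l ℕ.* (group-order ℕ./ i) ≡ group-order → l ≡ i
      l≡i l l*s≡N = ℕ.*-cancelʳ-≡ l i s {{ℕ.≢-nonZero s≢0}} (trans l*s≡N (trans (sym s*i≡N) (ℕ.*-comm s i)))
        where
        s = group-order ℕ./ i
        s≢0 : s ≢ 0
        s≢0 s≡0 = ℕ.<⇒≢ 0<N (sym (trans (sym l*s≡N) (trans (cong (l ℕ.*_) s≡0) (ℕ.*-zeroʳ l))))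

-- From quartics to lines.

module LineIdentities (F : Field) (char3 : HasChar3 F) where
  open FieldProperties.Char3Solver F char3 using (follows; follows⁴)
  open ActionExpressions
  private
    lin : ∀ {n} → Expr n → V4 (Expr n) → Expr n → V4 (Expr n) → V4 (Expr n)
    lin a ⟨ x0 , x1 , x2 , x3 ⟩ b ⟨ y0 , y1 , y2 , y3 ⟩ =
      ⟨ a * x0 + b * y0 , a * x1 + b * y1 , a * x2 + b * y2 , a * x3 + b * y3 ⟩

    0v : ∀ {n} → V4 (Expr n)
    0v = ⟨ :0 , :0 , :0 , :0 ⟩

    act : ∀ {n} → V4 (Expr n) → V4 (Expr n) → V4 (Expr n)
    act g@(⟨ a , b , c , d ⟩) ⟨ y0 , y1 , y2 , y3 ⟩ =
      ⟨ a ^ 3 * y0 + b ^ 3 * y3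
      , a ^ 2 * c * y0 + a * D * y1 - b * D * y2 + b ^ 2 * d * y3
      , a * c ^ 2 * y0 - c * D * y1 + d * D * y2 + b * d ^ 2 * y3
      , c ^ 3 * y0 + d ^ 3 * y3 ⟩
      where D = det g

    point₁ point₂ : ∀ {n} → V4 (Expr n) → V4 (Expr n)
    point₁ ⟨ z0 , z1 , z3 , z4 ⟩ = ⟨ :1 , z1 , z0 , :0 ⟩
    point₂ ⟨ z0 , z1 , z3 , z4 ⟩ = ⟨ :0 , z4 , z3 , :1 ⟩

  combine = follows⁴ 2 6 (λ x y α β a b c d → concl⁴ (
    lin α (lin a x b y) β (lin c x d y) ≈⁴ lin (α * a + β * c) x (α * b + β * d) y)) _
  first = follows⁴ 2 0 (λ x y → concl⁴ (x ≈⁴ lin :1 x :0 y)) _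
  second = follows⁴ 2 0 (λ x y → concl⁴ (y ≈⁴ lin :0 x :1 y)) _
  invert₁ = follows⁴ 2 5 (λ x y a b c d e → (a * d - b * c) * e ≈ :1 ∙[ - :1 · x ]⇒
    concl⁴ (x ≈⁴ lin (e * d) (lin a x b y) (- (e * b)) (lin c x d y))) _
  invert₂ = follows⁴ 2 5 (λ x y a b c d e → (a * d - b * c) * e ≈ :1 ∙[ - :1 · y ]⇒
    concl⁴ (y ≈⁴ lin (- (e * c)) (lin a x b y) (e * a) (lin c x d y))) _
  degenerate₁ = follows⁴ 2 4 (λ x y a b c d → a * d - b * c ≈ :0 ∙[ x ]⇒
    concl⁴ (lin d (lin a x b y) (- b) (lin c x d y) ≈⁴ 0v)) _
  degenerate₂ = follows⁴ 2 4 (λ x y a b c d → a * d - b * c ≈ :0 ∙[ - :1 · y ]⇒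
    concl⁴ (lin c (lin a x b y) (- a) (lin c x d y) ≈⁴ 0v)) _
  degenerate₃ = follows⁴ 3 2 (λ x y w a b → - a ≈ :0 ∙[ - :1 · x ]⇒ - b ≈ :0 ∙[ - :1 · y ]⇒
    concl⁴ (lin :1 (lin a x b y) :0 w ≈⁴ 0v)) _
  unit₀ = follows 2 (λ a b → a * :1 + b * :0 ≈ :0 ∙[ :1 ]⇒ concl (a ≈ :0)) _
  unit₃ = follows 2 (λ a b → a * :0 + b * :1 ≈ :0 ∙[ :1 ]⇒ concl (b ≈ :0)) _
  linear = follows⁴ 3 2 (λ g x y α β → concl⁴ (act g (lin α x β y) ≈⁴ lin α (act g x) β (act g y))) _

  span₁ = follows⁴ 3 1 (λ g z y i → let ⟨ a , b , c , d ⟩ = g; p = det g * i; k = - (p - :1) ^ 2 in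
    p ≈ :1 ∙[ ⟨ - (p ^ 2 + p + :1) , k * c1 y , k * c0 y , :0 ⟩ ]⇒
    Acts g z y ∙⁴[ ⟨ 0v , ⟨ - (i * d) ^ 3 , :0 , (i * c) ^ 3 , :0 ⟩ , ⟨ :0 , - (i * d) ^ 3 , :0 , (i * c) ^ 3 ⟩ , 0v ⟩ ]⇒
    concl⁴ (point₁ y ≈⁴ lin (i ^ 3 * d ^ 3) (act g (point₁ z)) (- (i ^ 3 * c ^ 3)) (act g (point₂ z)))) _
  span₂ = follows⁴ 3 1 (λ g z y i → let ⟨ a , b , c , d ⟩ = g; p = det g * i; k = - (p - :1) ^ 2 in
    p ≈ :1 ∙[ ⟨ :0 , k * c3 y , k * c2 y , - (p ^ 2 + p + :1) ⟩ ]⇒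
    Acts g z y ∙⁴[ ⟨ 0v , ⟨ (i * b) ^ 3 , :0 , - (i * a) ^ 3 , :0 ⟩ , ⟨ :0 , (i * b) ^ 3 , :0 , - (i * a) ^ 3 ⟩ , 0v ⟩ ]⇒
    concl⁴ (point₂ y ≈⁴ lin (- (i ^ 3 * b ^ 3)) (act g (point₁ z)) (i ^ 3 * a ^ 3) (act g (point₂ z)))) _
  -- Coordinates 0 and 3 of the spanning points of y are (1, 0) and (0, 1), so they force the
  -- coefficients to be a³, c³, b³, d³; coordinates 1 and 2 are then the equations `Acts`.
  coefficients = follows⁴ 3 4 (λ g z y α β γ δ → let ⟨ y0 , y1 , y3 , y4 ⟩ = y in
    act g (point₁ z) ≈⁴ lin α (point₁ y) β (point₂ y) ∙⁴[
      ⟨ ⟨ - y1 , :1 , :0 , - y4 ⟩ , ⟨ - y0 , :0 , :1 , - y3 ⟩ , 0v , 0v ⟩ ]⇒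
    act g (point₂ z) ≈⁴ lin γ (point₁ y) δ (point₂ y) ∙⁴[
      ⟨ 0v , 0v , ⟨ - y1 , :1 , :0 , - y4 ⟩ , ⟨ - y0 , :0 , :1 , - y3 ⟩ ⟩ ]⇒
    concl⁴ (Acts g z y)) _
  normal₁ = follows 4 (λ α β z1 z4 → :1 ≈ α * :1 + β * :0 ∙[ - z1 ]⇒ :0 ≈ α * :0 + β * :1 ∙[ - z4 ]⇒
    concl (α * z1 + β * z4 ≈ z1)) _
  normal₂ = follows 4 (λ α β z1 z4 → :0 ≈ α * :1 + β * :0 ∙[ - z1 ]⇒ :1 ≈ α * :0 + β * :1 ∙[ - z4 ]⇒
    concl (α * z1 + β * z4 ≈ z4)) _
  through₁ = follows⁴ 2 1 (λ x y i → let ⟨ x0 , x1 , x2 , x3 ⟩ = x; ⟨ y0 , y1 , y2 , y3 ⟩ = y in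
    (x0 * y3 - x3 * y0) * i ≈ :1 ∙[ ⟨ - :1 , :0 , :0 , :0 ⟩ ]⇒
    concl⁴ (⟨ :1 , i * (x1 * y3 - x3 * y1) , i * (x2 * y3 - x3 * y2) , :0 ⟩ ≈⁴ lin (i * y3) x (- (i * x3)) y)) _
  through₂ = follows⁴ 2 1 (λ x y i → let ⟨ x0 , x1 , x2 , x3 ⟩ = x; ⟨ y0 , y1 , y2 , y3 ⟩ = y in
    (x0 * y3 - x3 * y0) * i ≈ :1 ∙[ ⟨ :0 , :0 , :0 , - :1 ⟩ ]⇒
    concl⁴ (⟨ :0 , i * (x0 * y1 - x1 * y0) , i * (x0 * y2 - x2 * y0) , :1 ⟩ ≈⁴ lin (- (i * y0)) x (i * x0) y)) _
  rescale = follows 3 (λ k i p → k * i ≈ :1 ∙[ - p ]⇒ concl (p ≈ k * (i * p))) _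
  private
    Δ : ∀ {n} → (z0 z1 z2 z3 z4 : Expr n) → Expr n
    Δ z0 z1 z2 z3 z4 = w ^ 3 + w ^ 2 * z2 ^ 2 - z2 ^ 3 * (z0 * z3 ^ 2 + z4 * z1 ^ 2 - z0 * z2 * z4)
      where w = z0 * z4 - z1 * z3
  -- Both Δ and z2⁶ have degree 6, so ȷ is unaffected by the factor p₀₃ that separates f_L from its
  -- normalised quartic.
  homogeneous = follows 5 (λ k z0 z1 z3 z4 → concl (Δ (k * z0) (k * z1) k (k * z3) (k * z4) ≈ k ^ 6 * disc ⟨ z0 , z1 , z3 , z4 ⟩)) _
  j-cancel = follows 4 (λ k i r x → k * i ≈ :1 ∙[ (r * x - :1) * (((k * i) ^ 2 + k * i + :1) * ((k * i) ^ 3 + :1)) ]⇒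
    k ^ 6 ≈ r * (k ^ 6 * x) ∙[ i ^ 6 ]⇒ concl (:1 ≈ r * x)) _
  j-expand = follows 3 (λ k r x → r * x ≈ :1 ∙[ - k ^ 6 ]⇒ concl (k ^ 6 ≈ r * (k ^ 6 * x))) _
  normal-fL₀ = follows 2 (λ x y → concl (x * :1 - :0 * y ≈ :1 * x)) _
  normal-fL₂ = follows 0 (concl (:1 * :1 - :0 * :0 ≈ :1)) _
  normal-fL₃ = follows 2 (λ x y → concl (:1 * x - y * :0 ≈ :1 * x)) _

module LinearAlgebra (F : Field) (char3 : HasChar3 F) where
  open FieldProperties F
  private module I = LineIdentities F char3

  Spans : Vec4 → Vec4 → Vec4 → Vec4 → Set
  Spans x y p q = InSpan x y p × InSpan x y q

  InSpan-trans : ∀ {x y p q z} → Spans x y p q → InSpan p q z → InSpan x y z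
  InSpan-trans {x} {y} ((a , b , refl) , (c , d , refl)) (α , β , refl) =
    α * a + β * c , α * b + β * d , I.combine x y α β a b c d

  Spans-trans : ∀ {x y p q u v} → Spans x y p q → Spans p q u v → Spans x y u v
  Spans-trans S (U , V) = InSpan-trans S U , InSpan-trans S V

  Spans-refl : ∀ {x y} → Spans x y x y
  Spans-refl {x} {y} = (1# , 0# , I.first x y) , (0# , 1# , I.second x y)

module Lines (FF : FiniteField) (char3 : Char3 FF) where
  open Char3FiniteField FF char3
  open Action FF char3
  open Counting FF char3 using (_∼_; ∼-isEquivalence)
  open LinearAlgebra field' char3
  open PG3 FF using (Line; line; SameLine; SameSpan; GL2; mat; act; Orbit; fL; JEq; Δ; module Plücker)
  private module I = LineIdentities field' char3

  -- If the determinant vanished, the combinations with coefficients (d, -b) and (c, -a) would both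
  -- be zero. Independence then gives a = b = 0, and the first vector itself is zero.
  independent-det≢0 : ∀ x y {a b c d} → Independent (lin a x b y) (lin c x d y) → a * d - b * c ≢ 0#
  independent-det≢0 x y {a} {b} {c} {d} indep det≡0 =
    contradiction (proj₁ (indep 1# 0# (I.degenerate₃ x y (lin c x d y) a b -a≡0 -b≡0))) (0≢1 ∘ sym)
    where
    -b≡0 : - b ≡ 0#
    -b≡0 = proj₂ (indep d (- b) (I.degenerate₁ x y a b c d det≡0))
    -a≡0 : - a ≡ 0#
    -a≡0 = proj₂ (indep c (- a) (I.degenerate₂ x y a b c d det≡0))

  -- Only one inclusion is assumed; independence of p and q makes the coefficient matrix invertible,
  -- and its inverse expresses x and y.
  Spans-sym : ∀ {x y p q} → Independent p q → Spans x y p q → Spans p q x y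
  Spans-sym {x} {y} indep ((a , b , refl) , (c , d , refl)) =
    (e * d , - (e * b) , I.invert₁ x y a b c d e inv) , (- (e * c) , e * a , I.invert₂ x y a b c d e inv)
    where
    e = (a * d - b * c) ⁻¹
    inv = ⁻¹-inverse (independent-det≢0 x y indep)

  matrix : GL2 → Matrix
  matrix (mat a b c d _) = ⟨ a , b , c , d ⟩

  toGL2 : ∀ g → det g ≢ 0# → GL2
  toGL2 ⟨ a , b , c , d ⟩ g≢0 = mat a b c d g≢0

  act-InSpan : ∀ g {x y z} → InSpan x y z → InSpan (act g x) (act g y) (act g z)
  act-InSpan g {x} {y} (α , β , refl) = α , β , I.linear (matrix g) x y α β

  act-Spans : ∀ g {x y p q} → Spans x y p q → Spans (act g x) (act g y) (act g p) (act g q)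
  act-Spans g {x} {y} {p} {q} (P , Q) = act-InSpan g {x} {y} {p} P , act-InSpan g {x} {y} {q} Q

  point₁ point₂ : Quartic → Vec4
  point₁ ⟨ z0 , z1 , z3 , z4 ⟩ = ⟨ 1# , z1 , z0 , 0# ⟩
  point₂ ⟨ z0 , z1 , z3 , z4 ⟩ = ⟨ 0# , z4 , z3 , 1# ⟩

  points-independent : ∀ z → Independent (point₁ z) (point₂ z)
  points-independent _ a b eq = I.unit₀ a b (cong V4.c0 eq) , I.unit₃ a b (cong V4.c3 eq)

  lineOf : Quartic → Line
  lineOf z = line (point₁ z) (point₂ z) (points-independent z)

  Acts⇒Spans : ∀ g g≢0 z y → Acts g z y →
    Spans (act (toGL2 g g≢0) (point₁ z)) (act (toGL2 g g≢0) (point₂ z)) (point₁ y) (point₂ y)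
  Acts⇒Spans g g≢0 z y A =
    (_ , _ , I.span₁ g z y (det g ⁻¹) (⁻¹-inverse g≢0) (Acts.equations A)) ,
    (_ , _ , I.span₂ g z y (det g ⁻¹) (⁻¹-inverse g≢0) (Acts.equations A))

  Spans⇒Acts : ∀ g z y → Spans (act g (point₁ z)) (act g (point₂ z)) (point₁ y) (point₂ y) → Acts (matrix g) z y
  Spans⇒Acts g z y S = from-images g z y (Spans-sym (points-independent y) S)
    where
    from-images : ∀ g z y → Spans (point₁ y) (point₂ y) (act g (point₁ z)) (act g (point₂ z)) → Acts (matrix g) z y
    from-images g z y ((α , β , e) , (γ , δ , e′)) = acts (I.coefficients (matrix g) z y α β γ δ e e′)

  lineOf-injective : ∀ z y → SameLine (lineOf z) (lineOf y) → z ≡ y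
  lineOf-injective ⟨ z0 , z1 , z3 , z4 ⟩ ⟨ y0 , y1 , y3 , y4 ⟩ ((α , β , e) , (α′ , β′ , e′)) = sym (V4-≡
    (trans (cong V4.c2 e) (I.normal₁ α β z0 z3 (cong V4.c0 e) (cong V4.c3 e)))
    (trans (cong V4.c1 e) (I.normal₁ α β z1 z4 (cong V4.c0 e) (cong V4.c3 e)))
    (trans (cong V4.c2 e′) (I.normal₂ α′ β′ z0 z3 (cong V4.c0 e′) (cong V4.c3 e′)))
    (trans (cong V4.c1 e′) (I.normal₂ α′ β′ z1 z4 (cong V4.c0 e′) (cong V4.c3 e′))))

  SameLine-isEquivalence : IsEquivalence SameLine
  SameLine-isEquivalence = record
    { refl  = Spans-refl
    ; sym   = λ {L} {M} → Spans-sym (Line.indep M)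
    ; trans = Spans-trans
    }
  module SameLine = IsEquivalence SameLine-isEquivalence

  infix 4 _≃_
  _≃_ : Line → Quartic → Set
  L ≃ z = SameLine L (lineOf z)

  Orbit⇒∼ : ∀ {L M z y} → L ≃ z → M ≃ y → Orbit L M → z ∼ y
  Orbit⇒∼ {L} {M} {z} {y} L≃z M≃y (g , S) = matrix g , det≢0 g , Spans⇒Acts g z y
    (Spans-trans (act-Spans g (SameLine.sym {L} {lineOf z} L≃z)) (Spans-trans S M≃y))
    where
    det≢0 : ∀ g → det (matrix g) ≢ 0#
    det≢0 (mat a b c d g≢0) = g≢0

  ∼⇒Orbit : ∀ {L M z y} → L ≃ z → M ≃ y → z ∼ y → Orbit L M
  ∼⇒Orbit {L} {M} {z} {y} L≃z M≃y (g , g≢0 , G) = toGL2 g g≢0 ,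
    Spans-trans (act-Spans (toGL2 g g≢0) L≃z)
      (Spans-trans (Acts⇒Spans g g≢0 z y G) (SameLine.sym {M} {lineOf y} M≃y))

  Orbit⇒≃ : ∀ {L M z} → L ≃ z → Orbit L M → ∃ λ y → z ∼ y × M ≃ y
  Orbit⇒≃ {L} {M} {z} L≃z (g@(mat a b c d g≢0) , S) =
    y , (matrix g , g≢0 , G) ,
    Spans-trans (Spans-sym (Line.indep M)
      (Spans-trans (act-Spans g (SameLine.sym {L} {lineOf z} L≃z)) S)) (Acts⇒Spans (matrix g) g≢0 z y G)
    where
    y = matrix g ▷ z
    G = Acts-▷ z g≢0

  formOf : Carrier → Quartic → V4 Carrier × Carrier
  formOf k ⟨ z0 , z1 , z3 , z4 ⟩ = ⟨ k * z0 , k * z1 , k , k * z3 ⟩ , k * z4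

  Δ-formOf : ∀ k z → Δ (formOf k z) ≡ (k ^ 6) * disc z
  Δ-formOf k ⟨ z0 , z1 , z3 , z4 ⟩ = I.homogeneous k z0 z1 z3 z4

  fL-lineOf : ∀ z → fL (lineOf z) ≡ formOf 1# z
  fL-lineOf ⟨ z0 , z1 , z3 , z4 ⟩ =
    cong₂ _,_ (V4-≡ (I.normal-fL₀ z0 z3) (I.normal-fL₀ z1 z4) I.normal-fL₂ (I.normal-fL₃ z3 z0)) (I.normal-fL₃ z4 z1)

  JEq-formOf : ∀ {k z r} → k ≢ 0# → disc z ≢ 0# → r * disc z ≡ 1# → JEq (formOf k z) r
  JEq-formOf {k} {z} {r} k≢0 disc≢0 eq = subst (λ x → x ≢ 0# × k ^ 6 ≡ r * x) (sym (Δ-formOf k z))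
    (x*y≢0 (x≢0⇒xⁿ≢0 k≢0 6) disc≢0 , I.j-expand k r (disc z) eq)

  formOf-JEq : ∀ {k z r} → k ≢ 0# → JEq (formOf k z) r → disc z ≢ 0# × r * disc z ≡ 1#
  formOf-JEq {k} {z} {r} k≢0 (Δ≢0 , eq) =
    xy≢0⇒y≢0 (subst (_≢ 0#) (Δ-formOf k z) Δ≢0) ,
    sym (I.j-cancel k (k ⁻¹) r (disc z) (⁻¹-inverse k≢0) (trans eq (cong (r *_) (Δ-formOf k z))))

  normal-form : ∀ L → Plücker.p03 L ≢ 0# → ∃ λ z → L ≃ z × fL L ≡ formOf (Plücker.p03 L) z
  normal-form (line x@(⟨ x0 , x1 , x2 , x3 ⟩) y@(⟨ y0 , y1 , y2 , y3 ⟩) indep) k≢0 =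
    ⟨ i * (x2 * y3 - x3 * y2) , i * (x1 * y3 - x3 * y1) , i * (x0 * y2 - x2 * y0) , i * (x0 * y1 - x1 * y0) ⟩ ,
    ((_ , _ , I.through₁ x y i inv) , (_ , _ , I.through₂ x y i inv)) ,
    cong₂ _,_ (V4-≡ (rescale _) (rescale _) refl (rescale _)) (rescale _)
    where
    k = x0 * y3 - x3 * y0
    i = k ⁻¹
    inv = ⁻¹-inverse k≢0
    rescale : ∀ p → p ≡ k * (i * p)
    rescale p = I.rescale k i p inv

-- Genericity: points on the cubic over extension fields, and osculating planes.

module FieldHomProperties {F K : Field} (ι : FieldHom F K) (char3 : HasChar3 F) where
  private
    module F = FieldProperties F
    module K = FieldProperties K
  open FieldHom ι
  open Expressions using (Expr; Equation; _≈_; var; :0; :1; _+_; _*_; -_)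

  map-0 : map F.0# ≡ K.0#
  map-0 = K.x+x≈x⇒x≈0 (map F.0#) (trans (sym (map-+ F.0# F.0#)) (cong map (F.+-identityˡ F.0#)))

  map-neg : ∀ x → map (F.- x) ≡ K.- map x
  map-neg x = K.+-cancelˡ (map x) _ _ (trans (sym (map-+ x (F.- x)))
    (trans (cong map (F.-‿inverseʳ x)) (trans map-0 (sym (K.-‿inverseʳ (map x))))))

  char3ᴷ : K.1# K.+ K.1# K.+ K.1# ≡ K.0#
  char3ᴷ = trans (sym (trans (map-+ _ _) (cong₂ K._+_ (trans (map-+ _ _) (cong₂ K._+_ map-1 map-1)) map-1)))
                   (trans (cong map char3) map-0)

  private
    module SF = F.Char3Solver char3
    module SK = K.Char3Solver char3ᴷ

  map-⟦⟧ : ∀ {n} (e : Expr n) ρ → map (SF.⟦ e ⟧ ρ) ≡ SK.⟦ e ⟧ (mapᵛ map ρ)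
  map-⟦⟧ (var i) ρ = sym (lookup-map i map ρ)
  map-⟦⟧ :0      ρ = map-0
  map-⟦⟧ :1      ρ = map-1
  map-⟦⟧ (e + f) ρ = trans (map-+ _ _) (cong₂ K._+_ (map-⟦⟧ e ρ) (map-⟦⟧ f ρ))
  map-⟦⟧ (e * f) ρ = trans (map-* _ _) (cong₂ K._*_ (map-⟦⟧ e ρ) (map-⟦⟧ f ρ))
  map-⟦⟧ (- e)   ρ = trans (map-neg _) (cong K.-_ (map-⟦⟧ e ρ))

  Transports : ∀ {n} → Equation n → Vec F.Carrier n → Set
  Transports (l ≈ r) ρ = SF.⟦ l ⟧ ρ ≡ SF.⟦ r ⟧ ρ → SK.⟦ l ⟧ (mapᵛ map ρ) ≡ SK.⟦ r ⟧ (mapᵛ map ρ)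

  transport : ∀ n (f : Curried n (Expr n) (Equation n)) → Quantified n (Transports (f $$ tabulate var))
  transport n f = quantify n (λ ρ → step (f $$ tabulate var) ρ)
    where
    step : ∀ eq ρ → Transports eq ρ
    step (l ≈ r) ρ h = trans (sym (map-⟦⟧ l ρ)) (trans (cong map h) (map-⟦⟧ r ρ))

module CurveIdentities (F : Field) (char3 : HasChar3 F) where
  open FieldProperties.Char3Solver F char3 using (follows; follows⁴)
  open Expressions
  private
    disc : ∀ {n} → (z0 z1 z3 z4 : Expr n) → Expr n
    disc z0 z1 z3 z4 = ActionExpressions.disc ⟨ z0 , z1 , z3 , z4 ⟩
    -- These come from eliminating τ between f₁ = z1 - τ + τ³z4 and f₂ = z0 - τ² + τ³z3: one has
    -- z0f₁ - z1f₂ = -τq₁ and z4f₂ - z3f₁ = q₂, and then z4q₁ - Wq₂ = A - Bτ.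
    W A B : ∀ {n} → (z0 z1 z3 z4 : Expr n) → Expr n
    W z0 z1 z3 z4 = z0 * z4 - z1 * z3
    A z0 z1 z3 z4 = z0 * z4 - W z0 z1 z3 z4 ^ 2
    B z0 z1 z3 z4 = W z0 z1 z3 z4 * z3 + z1 * z4
    q₁ q₂ : ∀ {n} → (τ z0 z1 z3 z4 : Expr n) → Expr n
    q₁ τ z0 z1 z3 z4 = z0 - z1 * τ - W z0 z1 z3 z4 * τ ^ 2
    q₂ τ z0 z1 z3 z4 = W z0 z1 z3 z4 + z3 * τ - z4 * τ ^ 2

  meet-z1 = follows 7 (λ s t σ α β z1 z4 → s * σ ≈ :1 ∙[ t * σ * (s * σ + :1) - z1 * (s * σ - :1) ^ 2 ]⇒
    s ^ 3 ≈ α * :1 + β * :0 ∙[ σ ^ 3 * z1 ]⇒ t ^ 3 ≈ α * :0 + β * :1 ∙[ σ ^ 3 * z4 ]⇒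
    s ^ 2 * t ≈ α * z1 + β * z4 ∙[ - σ ^ 3 ]⇒
    concl (z1 ≈ t * σ - (t * σ) ^ 3 * z4)) _
  meet-z0 = follows 7 (λ s t σ α β z0 z3 → s * σ ≈ :1 ∙[ (t * σ) ^ 2 - z0 * (s * σ - :1) ^ 2 ]⇒
    s ^ 3 ≈ α * :1 + β * :0 ∙[ σ ^ 3 * z0 ]⇒ t ^ 3 ≈ α * :0 + β * :1 ∙[ σ ^ 3 * z3 ]⇒
    s * t ^ 2 ≈ α * z0 + β * z3 ∙[ - σ ^ 3 ]⇒
    concl (z0 ≈ (t * σ) ^ 2 - (t * σ) ^ 3 * z3)) _
  meet-disc = follows 3 (λ τ z3 z4 → concl (disc (τ ^ 2 - τ ^ 3 * z3) (τ - τ ^ 3 * z4) z3 z4 ≈ :0)) _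
  infinity-z4 = follows 7 (λ s t σ α β z1 z4 → t * σ ≈ :1 ∙[ - (z4 * (t * σ - :1) ^ 2) ]⇒
    s ≈ :0 ∙[ σ ^ 3 * (s * t - s ^ 2 * z1) ]⇒
    s ^ 3 ≈ α * :1 + β * :0 ∙[ σ ^ 3 * z1 ]⇒ t ^ 3 ≈ α * :0 + β * :1 ∙[ σ ^ 3 * z4 ]⇒
    s ^ 2 * t ≈ α * z1 + β * z4 ∙[ - σ ^ 3 ]⇒
    concl (z4 ≈ :0)) _
  infinity-z3 = follows 7 (λ s t σ α β z0 z3 → t * σ ≈ :1 ∙[ - (z3 * (t * σ - :1) ^ 2) ]⇒
    s ≈ :0 ∙[ σ ^ 3 * (t ^ 2 - s ^ 2 * z0) ]⇒
    s ^ 3 ≈ α * :1 + β * :0 ∙[ σ ^ 3 * z0 ]⇒ t ^ 3 ≈ α * :0 + β * :1 ∙[ σ ^ 3 * z3 ]⇒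
    s * t ^ 2 ≈ α * z0 + β * z3 ∙[ - σ ^ 3 ]⇒
    concl (z3 ≈ :0)) _
  infinity-disc = follows 2 (λ z0 z1 → concl (disc z0 z1 :0 :0 ≈ :0)) _

  on-curve = follows⁴ 0 5 (λ τ z0 z1 z3 z4 →
    z1 ≈ τ - τ ^ 3 * z4 ∙[ ⟨ :0 , - :1 , :0 , :0 ⟩ ]⇒ z0 ≈ τ ^ 2 - τ ^ 3 * z3 ∙[ ⟨ :0 , :0 , - :1 , :0 ⟩ ]⇒
    concl⁴ (⟨ :1 ^ 3 , :1 ^ 2 * τ , :1 * τ ^ 2 , τ ^ 3 ⟩ ≈⁴
            ⟨ :1 * :1 + τ ^ 3 * :0 , :1 * z1 + τ ^ 3 * z4 , :1 * z0 + τ ^ 3 * z3 , :1 * :0 + τ ^ 3 * :1 ⟩)) _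
  at-infinity = follows⁴ 0 4 (λ z0 z1 z3 z4 →
    z3 ≈ :0 ∙[ ⟨ :0 , :0 , - :1 , :0 ⟩ ]⇒ z4 ≈ :0 ∙[ ⟨ :0 , - :1 , :0 , :0 ⟩ ]⇒
    concl⁴ (⟨ :0 ^ 3 , :0 ^ 2 * :1 , :0 * :1 ^ 2 , :1 ^ 3 ⟩ ≈⁴
            ⟨ :0 * :1 + :1 * :0 , :0 * z1 + :1 * z4 , :0 * z0 + :1 * z3 , :0 * :0 + :1 * :1 ⟩)) _

  origin₁ = follows 2 (λ z1 z4 → z1 ≈ :0 ∙[ :1 ]⇒ concl (z1 ≈ :0 - :0 ^ 3 * z4)) _
  origin₀ = follows 2 (λ z0 z3 → z0 ≈ :0 ∙[ :1 ]⇒ concl (z0 ≈ :0 ^ 2 - :0 ^ 3 * z3)) _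
  W≈0⇒z1z3 = follows 3 (λ z0 z1 z3 → z0 * :0 - z1 * z3 ≈ :0 ∙[ - :1 ]⇒ concl (z1 * z3 ≈ :0)) _
  W≈0⇒z0z4 = follows 3 (λ z0 z3 z4 → z0 * z4 - :0 * z3 ≈ :0 ∙[ :1 ]⇒ concl (z0 * z4 ≈ :0)) _
  disc≈0⇒z0 = follows 2 (λ z0 z3 → disc z0 :0 z3 :0 ≈ :0 ∙[ - :1 ]⇒ concl (z3 ^ 2 * z0 ≈ :0)) _
  -- For W = 0 the quadratic q₂ is τ(z3 - z4τ), so a common root can only be 0 or z3/z4.
  cusp-factor = follows 5 (λ z0 z1 z3 z4 i → let w = W z0 z1 z3 z4; τ = z3 * i in
    w ≈ :0 ∙[ i * (w ^ 2 + w) + i - i ^ 2 * z3 ^ 2 ]⇒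
    disc z0 z1 z3 z4 ≈ :0 ∙[ - i ]⇒ z4 * i ≈ :1 ∙[ z1 * z3 ^ 3 * i ^ 2 + i * z3 ^ 2 * z0 - z1 ^ 2 ]⇒
    concl (z1 * (z1 - (τ - τ ^ 3 * z4)) ≈ :0)) _
  cusp-z0 = follows 5 (λ z0 z1 z3 z4 i → let τ = z3 * i in
    W z0 z1 z3 z4 ≈ :0 ∙[ i ]⇒ z4 * i ≈ :1 ∙[ - (z0 + τ ^ 3 * z3) ]⇒ z1 ≈ τ - τ ^ 3 * z4 ∙[ τ ]⇒
    concl (z0 ≈ τ ^ 2 - τ ^ 3 * z3)) _
  linear-q₁ = follows 5 (λ z0 z1 z3 z4 b → let a = A z0 z1 z3 z4; p = B z0 z1 z3 z4 * b in
    B z0 z1 z3 z4 * b ≈ :1 ∙[ z1 * a * b - z0 * (p + :1) ]⇒ disc z0 z1 z3 z4 ≈ :0 ∙[ - (b ^ 2 * W z0 z1 z3 z4 ^ 2) ]⇒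
    concl (q₁ (a * b) z0 z1 z3 z4 ≈ :0)) _
  linear-q₂ = follows 5 (λ z0 z1 z3 z4 b → let a = A z0 z1 z3 z4; p = B z0 z1 z3 z4 * b in
    B z0 z1 z3 z4 * b ≈ :1 ∙[ - (z3 * a * b + W z0 z1 z3 z4 * (p + :1)) ]⇒
    disc z0 z1 z3 z4 ≈ :0 ∙[ - (b ^ 2 * z4 * W z0 z1 z3 z4) ]⇒
    concl (q₂ (a * b) z0 z1 z3 z4 ≈ :0)) _
  common-z1 = follows 6 (λ τ z0 z1 z3 z4 ω → W z0 z1 z3 z4 * ω ≈ :1 ∙[ - (z1 - (τ - τ ^ 3 * z4)) ]⇒
    q₁ τ z0 z1 z3 z4 ≈ :0 ∙[ - (ω * z4 * τ) ]⇒ q₂ τ z0 z1 z3 z4 ≈ :0 ∙[ ω * z1 ]⇒ concl (z1 ≈ τ - τ ^ 3 * z4)) _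
  common-z0 = follows 6 (λ τ z0 z1 z3 z4 ω → W z0 z1 z3 z4 * ω ≈ :1 ∙[ - (z0 - (τ ^ 2 - τ ^ 3 * z3)) ]⇒
    q₁ τ z0 z1 z3 z4 ≈ :0 ∙[ - (ω * z3 * τ) ]⇒ q₂ τ z0 z1 z3 z4 ≈ :0 ∙[ ω * z0 ]⇒ concl (z0 ≈ τ ^ 2 - τ ^ 3 * z3)) _
  square-A = follows 4 (λ z0 z1 z3 z4 → B z0 z1 z3 z4 ≈ :0 ∙[ z0 * z3 + W z0 z1 z3 z4 * z1 ]⇒
    disc z0 z1 z3 z4 ≈ :0 ∙[ W z0 z1 z3 z4 ]⇒
    concl (A z0 z1 z3 z4 * A z0 z1 z3 z4 ≈ :0)) _
  quadratic-q₁ = follows 6 (λ z0 z1 z3 z4 ω ρ → let w = W z0 z1 z3 z4 in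
    w * ω ≈ :1 ∙[ - (ω * (z1 + ρ) ^ 2 + z0) ]⇒ ρ * ρ ≈ z1 ^ 2 + w * z0 ∙[ - ω ]⇒
    concl (q₁ ((z1 + ρ) * ω) z0 z1 z3 z4 ≈ :0)) _
  quadratic-q₂ = follows 6 (λ τ z0 z1 z3 z4 ω → W z0 z1 z3 z4 * ω ≈ :1 ∙[ - q₂ τ z0 z1 z3 z4 ]⇒
    q₁ τ z0 z1 z3 z4 ≈ :0 ∙[ ω * z4 ]⇒
    A z0 z1 z3 z4 ≈ :0 ∙[ - ω ]⇒ B z0 z1 z3 z4 ≈ :0 ∙[ ω * τ ]⇒ concl (q₂ τ z0 z1 z3 z4 ≈ :0)) _

  cross₀ = follows 2 (λ x y → concl (y * x - x * y ≈ :0)) _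
  cross₁ = follows 4 (λ x0 x3 y0 y3 → x0 * y3 - x3 * y0 ≈ :0 ∙[ - :1 ]⇒ concl (x3 * y0 - x0 * y3 ≈ :0)) _
  cross₂ = follows 4 (λ x0 x3 y0 y3 → x0 * y3 - x3 * y0 ≈ :0 ∙[ :1 ]⇒ concl (y3 * x0 - y0 * x3 ≈ :0)) _
  cross₃ = follows 4 (λ x0 x3 u v → x0 ≈ :0 ∙[ u ]⇒ x3 ≈ :0 ∙[ - v ]⇒ concl (u * x0 - v * x3 ≈ :0)) _
  osculating₁ = follows 2 (λ s t → t ^ 3 * :1 - s ^ 3 * :0 ≈ :0 ∙[ :1 ]⇒ concl (t ^ 3 ≈ :0)) _
  osculating₂ = follows 2 (λ s t → t ^ 3 * :0 - s ^ 3 * :1 ≈ :0 ∙[ - :1 ]⇒ concl (s ^ 3 ≈ :0)) _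

  mul-assoc₁ = follows 7 (λ d a b a′ b′ a″ b″ → concl (
    (a * a′ + d * (b * b′)) * a″ + d * ((a * b′ + b * a′) * b″) ≈ a * (a′ * a″ + d * (b′ * b″)) + d * (b * (a′ * b″ + b′ * a″)))) _
  mul-assoc₂ = follows 7 (λ d a b a′ b′ a″ b″ → concl (
    (a * a′ + d * (b * b′)) * b″ + (a * b′ + b * a′) * a″ ≈ a * (a′ * b″ + b′ * a″) + b * (a′ * a″ + d * (b′ * b″)))) _
  mul-comm₁ = follows 5 (λ d a b a′ b′ → concl (a * a′ + d * (b * b′) ≈ a′ * a + d * (b′ * b))) _
  mul-comm₂ = follows 4 (λ a b a′ b′ → concl (a * b′ + b * a′ ≈ a′ * b + b′ * a)) _
  mul-unit₁ = follows 3 (λ d a b → concl (:1 * a + d * (:0 * b) ≈ a)) _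
  mul-unit₂ = follows 2 (λ a b → concl (:1 * b + :0 * a ≈ b)) _
  mul-distrib₁ = follows 7 (λ d a b a′ b′ a″ b″ → concl (
    a * (a′ + a″) + d * (b * (b′ + b″)) ≈ (a * a′ + d * (b * b′)) + (a * a″ + d * (b * b″)))) _
  mul-distrib₂ = follows 6 (λ a b a′ b′ a″ b″ → concl (
    a * (b′ + b″) + b * (a′ + a″) ≈ (a * b′ + b * a′) + (a * b″ + b * a″))) _
  norm-square = follows 4 (λ d a b β → b * β ≈ :1 ∙[ d * (b * β + :1) ]⇒ a * a - d * (b * b) ≈ :0 ∙[ β ^ 2 ]⇒
    concl ((a * β) * (a * β) ≈ d)) _
  norm-a = follows 2 (λ d a → a * a - d * (:0 * :0) ≈ :0 ∙[ :1 ]⇒ concl (a * a ≈ :0)) _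
  norm-inverse₁ = follows 4 (λ d a b ν → (a * a - d * (b * b)) * ν ≈ :1 ∙[ :1 ]⇒
    concl (a * (a * ν) + d * (b * (- (b * ν))) ≈ :1)) _
  norm-inverse₂ = follows 3 (λ a b ν → concl (a * (- (b * ν)) + b * (a * ν) ≈ :0)) _
  embed-mul₁ = follows 3 (λ d a b → concl (a * b ≈ a * b + d * (:0 * :0))) _
  embed-mul₂ = follows 2 (λ a b → concl (:0 ≈ a * :0 + :0 * b)) _
  root₁ = follows 1 (λ d → concl (:0 * :0 + d * (:1 * :1) ≈ d)) _
  root₂ = follows 0 (concl (:0 * :1 + :1 * :0 ≈ :0)) _

-- When q₁ and q₂ are proportional, their roots may be irrational. This is the only case of Δ = 0 in
-- which the line need not have a rational point on the cubic.
module QuadraticExtension (FF : FiniteField) (char3 : Char3 FF) (d : FiniteField.Carrier FF)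
    (nonsquare : ¬ IsSquare (FiniteField.field' FF) d) where
  open Char3FiniteField FF char3
  private module I = CurveIdentities field' char3

  infixl 6 _⊕_
  infixl 7 _⊗_
  _⊕_ _⊗_ : Carrier × Carrier → Carrier × Carrier → Carrier × Carrier
  (a , b) ⊕ (a′ , b′) = a + a′ , b + b′
  (a , b) ⊗ (a′ , b′) = a * a′ + d * (b * b′) , a * b′ + b * a′

  ⊖_ : Carrier × Carrier → Carrier × Carrier
  ⊖ (a , b) = - a , - b

  ⊗-comm : ∀ x y → x ⊗ y ≡ y ⊗ x
  ⊗-comm (a , b) (a′ , b′) = cong₂ _,_ (I.mul-comm₁ d a b a′ b′) (I.mul-comm₂ a b a′ b′)

  ⊗-identityˡ : ∀ x → (1# , 0#) ⊗ x ≡ x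
  ⊗-identityˡ (a , b) = cong₂ _,_ (I.mul-unit₁ d a b) (I.mul-unit₂ a b)

  ⊗-distribˡ : ∀ x y z → x ⊗ (y ⊕ z) ≡ x ⊗ y ⊕ x ⊗ z
  ⊗-distribˡ (a , b) (a′ , b′) (a″ , b″) = cong₂ _,_ (I.mul-distrib₁ d a b a′ b′ a″ b″) (I.mul-distrib₂ a b a′ b′ a″ b″)

  isCommutativeRing : IsCommutativeRing _≡_ _⊕_ _⊗_ ⊖_ (0# , 0#) (1# , 0#)
  isCommutativeRing = record
    { isRing = record
      { +-isAbelianGroup = record
        { isGroup = record
          { isMonoid = record
            { isSemigroup = record
              { isMagma = record { isEquivalence = isEquivalence ; ∙-cong = cong₂ _⊕_ }
              ; assoc = λ (a , b) (a′ , b′) (a″ , b″) → cong₂ _,_ (+-assoc a a′ a″) (+-assoc b b′ b″) }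
            ; identity = (λ (a , b) → cong₂ _,_ (+-identityˡ a) (+-identityˡ b)) ,
                         (λ (a , b) → cong₂ _,_ (+-identityʳ a) (+-identityʳ b)) }
          ; inverse = (λ (a , b) → cong₂ _,_ (-‿inverseˡ a) (-‿inverseˡ b)) ,
                      (λ (a , b) → cong₂ _,_ (-‿inverseʳ a) (-‿inverseʳ b))
          ; ⁻¹-cong = cong ⊖_ }
        ; comm = λ (a , b) (a′ , b′) → cong₂ _,_ (+-comm a a′) (+-comm b b′) }
      ; *-cong = cong₂ _⊗_
      ; *-assoc = λ (a , b) (a′ , b′) (a″ , b″) → cong₂ _,_ (I.mul-assoc₁ d a b a′ b′ a″ b″) (I.mul-assoc₂ d a b a′ b′ a″ b″)
      ; *-identity = ⊗-identityˡ , λ x → trans (⊗-comm x _) (⊗-identityˡ x)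
      ; distrib = ⊗-distribˡ , λ x y z → trans (⊗-comm _ x) (trans (⊗-distribˡ x y z) (cong₂ _⊕_ (⊗-comm x y) (⊗-comm x z)))
      }
    ; *-comm = ⊗-comm
    }

  norm≢0 : ∀ a b → (a , b) ≢ (0# , 0#) → a * a - d * (b * b) ≢ 0#
  norm≢0 a b x≢0 norm≡0 = by-b (b ≟ 0#) x≢0 norm≡0
    where
    by-b : ∀ {b} → Dec (b ≡ 0#) → (a , b) ≢ (0# , 0#) → a * a - d * (b * b) ≢ 0#
    by-b {b} (no b≢0) _   norm≡0 = nonsquare (a * b ⁻¹ , I.norm-square d a b (b ⁻¹) (⁻¹-inverse b≢0) norm≡0)
    by-b (yes refl)   x≢0 norm≡0 = x≢0 (cong (_, 0#) ([ id , id ]′ (x*y≡0⇒ (I.norm-a d a norm≡0))))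

  field√d : Field
  field√d = record
    { Carrier = Carrier × Carrier
    ; _+_ = _⊕_ ; _*_ = _⊗_ ; -_ = ⊖_ ; 0# = 0# , 0# ; 1# = 1# , 0#
    ; isCommRing = isCommutativeRing
    ; 0≢1 = 0≢1 ∘ cong proj₁
    ; inverse = λ (a , b) x≢0 → let ν = (a * a - d * (b * b)) ⁻¹ in
        (a * ν , - (b * ν)) ,
        cong₂ _,_ (I.norm-inverse₁ d a b ν (⁻¹-inverse (norm≢0 a b x≢0))) (I.norm-inverse₂ a b ν)
    }

  embed : FieldHom field' field√d
  embed = record
    { map   = _, 0#
    ; map-+ = λ a b → cong (a + b ,_) (sym (+-identityˡ 0#))
    ; map-* = λ a b → cong₂ _,_ (I.embed-mul₁ d a b) (I.embed-mul₂ a b)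
    ; map-1 = refl
    }

  √d : Field.Carrier field√d
  √d = 0# , 1#

  √d²≡d : Field._*_ field√d √d √d ≡ FieldHom.map embed d
  √d²≡d = cong₂ _,_ (I.root₁ d) I.root₂

module CurveOver (K : Field) (char3 : HasChar3 K) where
  open Char3Field K char3
  private module I = CurveIdentities K char3

  MeetsAt : (z0 z1 z3 z4 : Carrier) → Set
  MeetsAt z0 z1 z3 z4 = ∃₂ λ s t → NonZeroPair s t × InSpan ⟨ 1# , z1 , z0 , 0# ⟩ ⟨ 0# , z4 , z3 , 1# ⟩ (ν s t)

  -- The line with parameters z0, z1, z3, z4 passes through ν(1, τ).
  CommonRoot : (z0 z1 z3 z4 : Carrier) → Set
  CommonRoot z0 z1 z3 z4 = ∃ λ τ → z1 ≡ τ - (τ ^ 3) * z4 × z0 ≡ (τ ^ 2) - (τ ^ 3) * z3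

  disc : (z0 z1 z3 z4 : Carrier) → Carrier
  disc z0 z1 z3 z4 = (w ^ 3) + (w ^ 2) - (z0 * (z3 ^ 2) + z4 * (z1 ^ 2) - z0 * z4)
    where w = z0 * z4 - z1 * z3

  -- Equality in K need not be decidable, so the case split on s takes place under the negation.
  disc≢0⇒¬MeetsAt : ∀ {z0 z1 z3 z4} → disc z0 z1 z3 z4 ≢ 0# → ¬ MeetsAt z0 z1 z3 z4
  disc≢0⇒¬MeetsAt {z0} {z1} {z3} {z4} disc≢0 (s , t , st≢0 , α , β , on) = s≢0⇒⊥ s≡0⇒⊥
    where
    s≢0⇒⊥ : s ≢ 0# → ⊥
    s≢0⇒⊥ s≢0 = let (σ , sσ≡1) = inverse s s≢0 in disc≢0 (trans
      (cong₂ (λ x y → disc x y z3 z4)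
        (I.meet-z0 s t σ α β z0 z3 sσ≡1 (cong V4.c0 on) (cong V4.c3 on) (cong V4.c2 on))
        (I.meet-z1 s t σ α β z1 z4 sσ≡1 (cong V4.c0 on) (cong V4.c3 on) (cong V4.c1 on)))
      (I.meet-disc (t * σ) z3 z4))
    s≡0⇒⊥ : s ≢ 0#
    s≡0⇒⊥ s≡0 = let (σ , tσ≡1) = inverse t (λ t≡0 → st≢0 (s≡0 , t≡0)) in disc≢0 (trans
      (cong₂ (disc z0 z1)
        (I.infinity-z3 s t σ α β z0 z3 tσ≡1 s≡0 (cong V4.c0 on) (cong V4.c3 on) (cong V4.c2 on))
        (I.infinity-z4 s t σ α β z1 z4 tσ≡1 s≡0 (cong V4.c0 on) (cong V4.c3 on) (cong V4.c1 on)))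
      (I.infinity-disc z0 z1))

  CommonRoot⇒MeetsAt : ∀ {z0 z1 z3 z4} → CommonRoot z0 z1 z3 z4 → MeetsAt z0 z1 z3 z4
  CommonRoot⇒MeetsAt {z0} {z1} {z3} {z4} (τ , e₁ , e₀) = 1# , τ , (λ (1≡0 , _) → 0≢1 (sym 1≡0)) ,
    1# , τ ^ 3 , I.on-curve τ z0 z1 z3 z4 e₁ e₀

  infinity⇒MeetsAt : ∀ {z0 z1 z3 z4} → z3 ≡ 0# → z4 ≡ 0# → MeetsAt z0 z1 z3 z4
  infinity⇒MeetsAt {z0} {z1} {z3} {z4} z3≡0 z4≡0 = 0# , 1# , (λ (_ , 1≡0) → 0≢1 (sym 1≡0)) ,
    0# , 1# , I.at-infinity z0 z1 z3 z4 z3≡0 z4≡0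

  quadratic⇒CommonRoot : ∀ z0 z1 z3 z4 ω ρ → let w = z0 * z4 - z1 * z3 in
    w * ω ≡ 1# → z0 * z4 - (w ^ 2) ≡ 0# → w * z3 + z1 * z4 ≡ 0# → ρ * ρ ≡ (z1 ^ 2) + w * z0 →
    CommonRoot z0 z1 z3 z4
  quadratic⇒CommonRoot z0 z1 z3 z4 ω ρ wω≡1 A≡0 B≡0 ρ²≡ =
    τ , I.common-z1 τ z0 z1 z3 z4 ω wω≡1 q₁≡0 q₂≡0 , I.common-z0 τ z0 z1 z3 z4 ω wω≡1 q₁≡0 q₂≡0
    where
    -- The quadratic formula for wτ² + z1τ - z0 = 0 in characteristic 3, where 1/2 = -1 and z1² +
    -- 4wz0 = z1² + wz0.
    τ = (z1 + ρ) * ω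
    q₁≡0 = I.quadratic-q₁ z0 z1 z3 z4 ω ρ wω≡1 ρ²≡
    q₂≡0 = I.quadratic-q₂ τ z0 z1 z3 z4 ω wω≡1 q₁≡0 A≡0 B≡0

module GenericLines (FF : FiniteField) (char3 : Char3 FF) (m : ℕ)
                    (q≡3ⁿ : FiniteField.q FF ≡ 3 ℕ.^ suc m) where
  open Char3FiniteField FF char3
  open Action FF char3
  open Lines FF char3
  open PG3 FF using (Line; line; SameLine; Generic; MeetsCurveOver; ContainedInOscPlane; InOscPlane; module Plücker)

  module OverField (K : Field) (ι : FieldHom field' K) where
    open FieldHom ι using (map)
    open FieldHomProperties ι char3 using (map-0; char3ᴷ; transport)
    open FieldHom ι using (map-1)
    module K = Char3Field K char3ᴷ
    open CurveOver K char3ᴷ public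

    points-map : (z : Quartic) → let ⟨ z0 , z1 , z3 , z4 ⟩ = z in
      (mapV4 map (point₁ z) ≡ ⟨ K.1# , map z1 , map z0 , K.0# ⟩) × (mapV4 map (point₂ z) ≡ ⟨ K.0# , map z4 , map z3 , K.1# ⟩)
    points-map z = V4-≡ map-1 refl refl map-0 , V4-≡ map-0 refl refl map-1

    MeetsCurve⇒At : (z : Quartic) → let ⟨ z0 , z1 , z3 , z4 ⟩ = z in
      MeetsCurveOver K ι (lineOf z) → MeetsAt (map z0) (map z1) (map z3) (map z4)
    MeetsCurve⇒At z (s , t , st≢0 , on) =
      s , t , st≢0 , subst₂ (λ x y → K.InSpan x y (K.ν s t)) (proj₁ (points-map z)) (proj₂ (points-map z)) on

    At⇒MeetsCurve : (z : Quartic) → let ⟨ z0 , z1 , z3 , z4 ⟩ = z in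
      MeetsAt (map z0) (map z1) (map z3) (map z4) → MeetsCurveOver K ι (lineOf z)
    At⇒MeetsCurve z (s , t , st≢0 , on) =
      s , t , st≢0 , subst₂ (λ x y → K.InSpan x y (K.ν s t)) (sym (proj₁ (points-map z))) (sym (proj₂ (points-map z))) on

  identity : FieldHom field' field'
  identity = record { map = id ; map-+ = λ _ _ → refl ; map-* = λ _ _ → refl ; map-1 = refl }

  private module I = CurveIdentities field' char3

  Meets : Quartic → Set₁
  Meets z = ∃ λ K → ∃ λ ι → MeetsCurveOver K ι (lineOf z)

  CommonRoot⇒Meets : (z : Quartic) → let ⟨ z0 , z1 , z3 , z4 ⟩ = z in OverField.CommonRoot field' identity z0 z1 z3 z4 → Meets z
  CommonRoot⇒Meets z root = field' , identity ,
    OverField.At⇒MeetsCurve field' identity z (OverField.CommonRoot⇒MeetsAt field' identity root)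

  -- Here the elimination through q₁ and q₂ degenerates, but the point is rational: it is ν(0, 1) if
  -- z3 = z4 = 0, and otherwise ν(1, 0) or ν(1, z3/z4).
  w≡0⇒Meets : ∀ z0 z1 z3 z4 → z0 * z4 - z1 * z3 ≡ 0# → disc ⟨ z0 , z1 , z3 , z4 ⟩ ≡ 0# → Meets ⟨ z0 , z1 , z3 , z4 ⟩
  w≡0⇒Meets z0 z1 z3 z4 w≡0 disc≡0 = by-z4 (z4 ≟ 0#) w≡0 disc≡0
    where
    origin : ∀ {z0 z1 z3 z4} → z0 ≡ 0# → z1 ≡ 0# → Meets ⟨ z0 , z1 , z3 , z4 ⟩
    origin {z0} {z1} {z3} {z4} z0≡0 z1≡0 = CommonRoot⇒Meets _ (0# , I.origin₁ z1 z4 z1≡0 , I.origin₀ z0 z3 z0≡0)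

    by-z3 : ∀ {z1 z3} → Dec (z3 ≡ 0#) → z0 * 0# - z1 * z3 ≡ 0# → disc ⟨ z0 , z1 , z3 , 0# ⟩ ≡ 0# → Meets ⟨ z0 , z1 , z3 , 0# ⟩
    by-z3 (yes z3≡0) _ _ = field' , identity ,
      OverField.At⇒MeetsCurve field' identity _ (OverField.infinity⇒MeetsAt field' identity z3≡0 refl)
    by-z3 {z1} {z3} (no z3≢0) w≡0 disc≡0 = origin z0≡0 z1≡0
      where
      z1≡0 : z1 ≡ 0#
      z1≡0 = [ id , (λ z3≡0 → contradiction z3≡0 z3≢0) ]′ (x*y≡0⇒ (I.W≈0⇒z1z3 z0 z1 z3 w≡0))
      z0≡0 : z0 ≡ 0#
      z0≡0 = x*y≡0⇒y≡0 _≟_ (x≢0⇒xⁿ≢0 z3≢0 2)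
               (I.disc≈0⇒z0 z0 z3 (subst (λ x → disc ⟨ z0 , x , z3 , 0# ⟩ ≡ 0#) z1≡0 disc≡0))

    by-z1 : ∀ {z1 z3 z4} → z4 ≢ 0# → z0 * z4 - z1 * z3 ≡ 0# →
            z1 ≡ 0# ⊎ z1 - (z3 * z4 ⁻¹ - ((z3 * z4 ⁻¹) ^ 3) * z4) ≡ 0# → Meets ⟨ z0 , z1 , z3 , z4 ⟩
    by-z1 {z1} {z3} {z4} z4≢0 w≡0 (inj₁ refl) =
      origin ([ id , (λ z4≡0 → contradiction z4≡0 z4≢0) ]′ (x*y≡0⇒ (I.W≈0⇒z0z4 z0 z3 z4 w≡0))) refl
    by-z1 {z1} {z3} {z4} z4≢0 w≡0 (inj₂ eq) = CommonRoot⇒Meets _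
      (z3 * z4 ⁻¹ , z1≡ , I.cusp-z0 z0 z1 z3 z4 (z4 ⁻¹) w≡0 (⁻¹-inverse z4≢0) z1≡)
      where z1≡ = Char3Solver.x-y≡0⇒x≡y char3 eq

    by-z4 : ∀ {z1 z3 z4} → Dec (z4 ≡ 0#) → z0 * z4 - z1 * z3 ≡ 0# → disc ⟨ z0 , z1 , z3 , z4 ⟩ ≡ 0# → Meets ⟨ z0 , z1 , z3 , z4 ⟩
    by-z4 {z1} {z3} (yes refl) w≡0 disc≡0 = by-z3 (z3 ≟ 0#) w≡0 disc≡0
    by-z4 {z1} {z3} {z4} (no z4≢0) w≡0 disc≡0 =
      by-z1 z4≢0 w≡0 (x*y≡0⇒ (I.cusp-factor z0 z1 z3 z4 (z4 ⁻¹) w≡0 disc≡0 (⁻¹-inverse z4≢0)))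

  -- For w ≠ 0 the two cubics vanish together exactly when the quadratics q₁ and q₂ do; these are
  -- proportional or have a rational common root.
  w≢0⇒Meets : ∀ z0 z1 z3 z4 → z0 * z4 - z1 * z3 ≢ 0# → disc ⟨ z0 , z1 , z3 , z4 ⟩ ≡ 0# → Meets ⟨ z0 , z1 , z3 , z4 ⟩
  w≢0⇒Meets z0 z1 z3 z4 w≢0 disc≡0 = by-B (B ≟ 0#)
    where
    w B ω : Carrier
    w = z0 * z4 - z1 * z3
    B = w * z3 + z1 * z4
    ω = w ⁻¹
    wω≡1 : w * ω ≡ 1#
    wω≡1 = ⁻¹-inverse w≢0

    by-square : B ≡ 0# → z0 * z4 - (w ^ 2) ≡ 0# → Dec (∃ λ s → s * s ≡ (z1 ^ 2) + w * z0) → Meets ⟨ z0 , z1 , z3 , z4 ⟩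
    by-square B≡0 A≡0 (yes (ρ , ρ²≡)) = CommonRoot⇒Meets _
      (OverField.quadratic⇒CommonRoot field' identity z0 z1 z3 z4 ω ρ wω≡1 A≡0 B≡0 ρ²≡)
    by-square B≡0 A≡0 (no nonsquare) = E.field√d , E.embed , At⇒MeetsCurve _ (CommonRoot⇒MeetsAt
      (quadratic⇒CommonRoot (map z0) (map z1) (map z3) (map z4) (map ω) E.√d
        (transport 5 (λ z0 z1 z3 z4 ω → (z0 X.* z4 X.- z1 X.* z3) X.* ω X.≈ X.:1) z0 z1 z3 z4 ω wω≡1)
        (transport 4 (λ z0 z1 z3 z4 → z0 X.* z4 X.- (z0 X.* z4 X.- z1 X.* z3) X.^ 2 X.≈ X.:0) z0 z1 z3 z4 A≡0)
        (transport 4 (λ z0 z1 z3 z4 → (z0 X.* z4 X.- z1 X.* z3) X.* z3 X.+ z1 X.* z4 X.≈ X.:0) z0 z1 z3 z4 B≡0)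
        (trans E.√d²≡d (transport 5 (λ z0 z1 z3 z4 d → d X.≈ z1 X.^ 2 X.+ (z0 X.* z4 X.- z1 X.* z3) X.* z0) z0 z1 z3 z4 d refl))))
      where
      d = (z1 ^ 2) + w * z0
      module E = QuadraticExtension FF char3 d nonsquare
      module X = Expressions
      open OverField E.field√d E.embed using (At⇒MeetsCurve; CommonRoot⇒MeetsAt; quadratic⇒CommonRoot)
      open FieldHomProperties E.embed char3 using (transport)
      open FieldHom E.embed using (map)

    by-B : Dec (B ≡ 0#) → Meets ⟨ z0 , z1 , z3 , z4 ⟩
    by-B (yes B≡0) = by-square B≡0 ([ id , id ]′ (x*y≡0⇒ (I.square-A z0 z1 z3 z4 B≡0 disc≡0))) (∃? (λ s → s * s ≟ _))
    by-B (no B≢0)  = CommonRoot⇒Meets _ (τ ,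
        I.common-z1 τ z0 z1 z3 z4 ω wω≡1 q₁≡0 q₂≡0 , I.common-z0 τ z0 z1 z3 z4 ω wω≡1 q₁≡0 q₂≡0)
      where
      τ = (z0 * z4 - (w ^ 2)) * B ⁻¹
      q₁≡0 = I.linear-q₁ z0 z1 z3 z4 (B ⁻¹) (⁻¹-inverse B≢0) disc≡0
      q₂≡0 = I.linear-q₂ z0 z1 z3 z4 (B ⁻¹) (⁻¹-inverse B≢0) disc≡0

  disc≡0⇒Meets : ∀ z → disc z ≡ 0# → Meets z
  disc≡0⇒Meets ⟨ z0 , z1 , z3 , z4 ⟩ disc≡0 = by-w (z0 * z4 - z1 * z3 ≟ 0#)
    where
    by-w : Dec (z0 * z4 - z1 * z3 ≡ 0#) → Meets ⟨ z0 , z1 , z3 , z4 ⟩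
    by-w (yes w≡0) = w≡0⇒Meets z0 z1 z3 z4 w≡0 disc≡0
    by-w (no w≢0)  = w≢0⇒Meets z0 z1 z3 z4 w≢0 disc≡0

  ¬Meets⇐disc≢0 : ∀ z → disc z ≢ 0# → ∀ K ι → ¬ MeetsCurveOver K ι (lineOf z)
  ¬Meets⇐disc≢0 z@(⟨ z0 , z1 , z3 , z4 ⟩) disc≢0 K ι meets = disc≢0⇒¬MeetsAt disc≢0ᴷ (MeetsCurve⇒At z meets)
    where
    open OverField K ι using (disc≢0⇒¬MeetsAt; MeetsCurve⇒At; module K) renaming (disc to discᴷ)
    open FieldHomProperties ι char3 using (transport)
    open FieldHom ι using (map)
    module X = Expressions
    δ = disc z ⁻¹
    -- Polynomial equations pass along ι, so `disc z ≢ 0#` is carried over as the equation saying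
    -- that `disc z` is invertible.
    unit : discᴷ (map z0) (map z1) (map z3) (map z4) K.* map δ ≡ K.1#
    unit = transport 5 (λ z0 z1 z3 z4 δ → let w = z0 X.* z4 X.- z1 X.* z3 in
      (w X.^ 3 X.+ w X.^ 2 X.- (z0 X.* z3 X.^ 2 X.+ z4 X.* z1 X.^ 2 X.- z0 X.* z4)) X.* δ X.≈ X.:1)
      z0 z1 z3 z4 δ (⁻¹-inverse disc≢0)
    disc≢0ᴷ : discᴷ (map z0) (map z1) (map z3) (map z4) ≢ K.0#
    disc≢0ᴷ eq = K.xy≡1⇒x≢0 unit eq

  lineOf-generic : ∀ z → disc z ≢ 0# → Generic (lineOf z)
  lineOf-generic z disc≢0 = ¬Meets⇐disc≢0 z disc≢0 , λ (s , t , st≢0 , in₁ , in₂) → st≢0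
    (cube≡0 (I.osculating₂ s t in₂) , cube≡0 (I.osculating₁ s t in₁))
    where
    cube≡0 : ∀ {x} → x ^ 3 ≡ 0# → x ≡ 0#
    cube≡0 {x} x³≡0 = by-dec (x ≟ 0#)
      where
      by-dec : Dec (x ≡ 0#) → x ≡ 0#
      by-dec (yes x≡0) = x≡0
      by-dec (no x≢0)  = contradiction x³≡0 (x≢0⇒xⁿ≢0 x≢0 3)

  cube-root : ∀ x → ∃ λ y → y ^ 3 ≡ x
  cube-root x = x ^ (3 ℕ.^ m) , trans (sym (^-3* x (3 ℕ.^ m))) (trans (cong (x ^_) (sym q≡3ⁿ)) (Fermat x))

  -- Every element of the finite field is a cube, so the osculating planes t³y0 = s³y3 are all the
  -- planes u · y0 = v · y3 with (u, v) ≠ (0, 0).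
  osculating : ∀ u v {x0 x1 x2 x3 y0 y1 y2 y3 indep} → ¬ (u ≡ 0# × v ≡ 0#) →
    u * x0 - v * x3 ≡ 0# → u * y0 - v * y3 ≡ 0# →
    ContainedInOscPlane (line ⟨ x0 , x1 , x2 , x3 ⟩ ⟨ y0 , y1 , y2 , y3 ⟩ indep)
  osculating u v {x0} {x3 = x3} {y0} {y3 = y3} {indep} uv≢0 ex ey =
    let (t , t³≡u) = cube-root u ; (s , s³≡v) = cube-root v in
    s , t , (λ (s≡0 , t≡0) → uv≢0 (cube t³≡u t≡0 , cube s³≡v s≡0)) ,
    trans (cong₂ (λ a b → a * x0 - b * x3) t³≡u s³≡v) ex , trans (cong₂ (λ a b → a * y0 - b * y3) t³≡u s³≡v) ey
    where
    cube : ∀ {a b} → a ^ 3 ≡ b → a ≡ 0# → b ≡ 0#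
    cube refl refl = zeroˡ _

  -- p₀₃ = 0 says that the coordinates (0, 3) of the two points are proportional, so one plane u ·
  -- y0 = v · y3 contains both; its coefficients are read off from a point where these coordinates
  -- do not both vanish, if there is one.
  p03≡0⇒osculating : ∀ L → Plücker.p03 L ≡ 0# → ContainedInOscPlane L
  p03≡0⇒osculating L@(line ⟨ x0 , x1 , x2 , x3 ⟩ ⟨ y0 , y1 , y2 , y3 ⟩ indep) k≡0 =
    by-cases (x3 ≟ 0#) (x0 ≟ 0#) (y3 ≟ 0#) (y0 ≟ 0#)
    where
    through-x : ¬ (x3 ≡ 0# × x0 ≡ 0#) → ContainedInOscPlane L
    through-x x≢0 = osculating x3 x0 {indep = indep} x≢0 (I.cross₀ x0 x3) (I.cross₁ x0 x3 y0 y3 k≡0)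
    through-y : ¬ (y3 ≡ 0# × y0 ≡ 0#) → ContainedInOscPlane L
    through-y y≢0 = osculating y3 y0 {indep = indep} y≢0 (I.cross₂ x0 x3 y0 y3 k≡0) (I.cross₀ y0 y3)
    by-cases : Dec (x3 ≡ 0#) → Dec (x0 ≡ 0#) → Dec (y3 ≡ 0#) → Dec (y0 ≡ 0#) → ContainedInOscPlane L
    by-cases (no x3≢0) _ _ _ = through-x (x3≢0 ∘ proj₁)
    by-cases _ (no x0≢0) _ _ = through-x (x0≢0 ∘ proj₂)
    by-cases _ _ (no y3≢0) _ = through-y (y3≢0 ∘ proj₁)
    by-cases _ _ _ (no y0≢0) = through-y (y0≢0 ∘ proj₂)
    by-cases (yes x3≡0) (yes x0≡0) (yes y3≡0) (yes y0≡0) = osculating 1# 0# {indep = indep} (0≢1 ∘ sym ∘ proj₁)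
      (I.cross₃ x0 x3 1# 0# x0≡0 x3≡0) (I.cross₃ y0 y3 1# 0# y0≡0 y3≡0)

  generic⇒p03≢0 : ∀ L → Generic L → Plücker.p03 L ≢ 0#
  generic⇒p03≢0 L (_ , not-osculating) = not-osculating ∘ p03≡0⇒osculating L

-- Roots of the resolvent cubic in terms of ȷ, and the classification.

module InvariantIdentities (F : Field) (char3 : HasChar3 F) where
  open FieldProperties.Char3Solver F char3 using (follows)
  open Expressions
  inverse-square = follows 4 (λ r e s u → r * e ≈ :1 ∙[ - u ^ 2 ]⇒ s * s ≈ r ∙[ - (e * u ^ 2) ]⇒
    s * u ≈ :1 ∙[ e * (s * u + :1) ]⇒ concl (u * u ≈ e)) _
  -- From u² = e = θ²(θ + 1) the quotient σ = u/θ is a square root of θ + 1; then θ = σ² - 1 and u =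
  -- σθ = σ³ - σ, which is `root-℘`.
  root-square = follows 4 (λ u θ τ e → θ * τ ≈ :1 ∙[ (θ + :1) * (θ * τ + :1) ]⇒ u * u ≈ e ∙[ τ ^ 2 ]⇒
    e ≈ θ ^ 3 + θ ^ 2 ∙[ τ ^ 2 ]⇒
    concl ((u * τ) * (u * τ) ≈ θ + :1)) _
  root-℘ = follows 3 (λ u θ τ → let σ = u * τ in θ * τ ≈ :1 ∙[ - u ]⇒ σ * σ ≈ θ + :1 ∙[ - σ ]⇒ concl (u ≈ σ ^ 3 - σ)) _
  -- The converse: u = s(s² - 1) gives u² = θ²(θ + 1) for θ = s² - 1.
  ℘-root = follows 3 (λ u s e → let θ = s ^ 2 - :1 in u ≈ s ^ 3 - s ∙[ u + s ^ 3 - s ]⇒ u * u ≈ e ∙[ - :1 ]⇒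
    concl (e ≈ θ ^ 3 + θ ^ 2)) _
  additive-split = follows 3 (λ r x y → x ^ 3 - r * x ≈ y ^ 3 - r * y ∙[ :1 ]⇒
    concl ((x - y) * ((x - y) * (x - y) - r) ≈ :0)) _
  -- Put φ = 1/θ and r = 1/e: dividing e = θ³ + θ² by eθ³ turns it into φ³ - rφ = r, whose left side
  -- is additive in φ.
  reciprocal-root = follows 4 (λ r e φ θ → let p = φ * θ in r * e ≈ :1 ∙[ θ ^ 2 + θ ^ 3 ]⇒
    φ * θ ≈ :1 ∙[ r * e * θ ^ 2 - e * (p ^ 2 + p + :1) ]⇒ φ ^ 3 - r * φ ≈ r ∙[ e * θ ^ 3 ]⇒ concl (e ≈ θ ^ 3 + θ ^ 2)) _
  additive-zero = follows 2 (λ r φ → φ ≈ :0 ∙[ φ ^ 2 - r ]⇒ φ ^ 3 - r * φ ≈ r ∙[ - :1 ]⇒ concl (r ≈ :0)) _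
  square-inverse = follows 3 (λ r e s → r * e ≈ :1 ∙[ r ]⇒ s * s ≈ e ∙[ r ^ 2 ]⇒ concl ((r * s) * (r * s) ≈ r)) _
  inverse-neg = follows 3 (λ s u v → s * u ≈ :1 ∙[ - v ]⇒ (- s) * v ≈ :1 ∙[ - u ]⇒ concl (v ≈ - u)) _
  inverse-same = follows 3 (λ s u v → s * u ≈ :1 ∙[ - v ]⇒ s * v ≈ :1 ∙[ u ]⇒ concl (v ≈ u)) _

-- With q = 2k + 1 the order (q - 1)q(q + 1) is 4k(k + 1)q. The three orbit sizes thus become the
-- distinct multiples 4g, 2g and g of one nonzero g.
order-divisible-by-4 : ∀ p k m q → suc p ≡ q → suc (k ℕ.* 2) ≡ q → q ≡ 3 ℕ.^ suc m →
  ∃ λ g → g ≢ 0 × p ℕ.* q ℕ.+ p ℕ.* (q ℕ.* q) ≡ 4 ℕ.* g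
order-divisible-by-4 p k m q 1+p≡q refl q≡3ⁿ with ℕ.suc-injective 1+p≡q
... | refl = g , ℕ.≢-nonZero⁻¹ g {{ℕ.m*n≢0 (k ℕ.* (1 ℕ.+ k)) q {{ℕ.m*n≢0 k (1 ℕ.+ k) {{ℕ.≢-nonZero k≢0}}}}}} ,
  +-*-Solver.solve 1 (λ k → let b = con 1 :+ k :* con 2 in
    k :* con 2 :* b :+ k :* con 2 :* (b :* b) := con 4 :* (k :* (con 1 :+ k) :* b)) refl k
  where
  open +-*-Solver
  g = k ℕ.* (1 ℕ.+ k) ℕ.* q
  k≢0 : k ≢ 0
  k≢0 refl = ℕ.<⇒≢ (ℕ.≤-trans (s≤s (s≤s z≤n)) (ℕ.*-monoʳ-≤ 3 (ℕ.m^n>0 3 m))) q≡3ⁿ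

module Classification (FF : FiniteField) (char3 : Char3 FF) (m : ℕ)
                      (q≡3ⁿ : FiniteField.q FF ≡ 3 ℕ.^ suc m) where
  open TraceCounting FF char3 m q≡3ⁿ
  open Action FF char3
  open StabiliserCount FF char3
  open Counting FF char3
  open Lines FF char3
  open GenericLines FF char3 m q≡3ⁿ
  open PG3 FF using (Line; line; SameLine; Orbit; Generic; MeetsCurveOver; fL; JEq; Tr; J₁; J₂; J₄; ∣G∣; OrbitData; OrbitsOfSize; module Plücker)
  private
    module I = InvariantIdentities field' char3
    n = suc m

  module ∼ = IsEquivalence ∼-isEquivalence

  J₁⇒stabiliser : ∀ {r} → J₁ n r → ∀ z → r * disc z ≡ 1# → ClassCount _∝_ (Stabilises z) 1
  J₁⇒stabiliser {r} (r≢0 , s , u , s²≡r , su≡1 , Tr≢0) z re≡1 = stabiliser-1 disc≢0 no-root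
    where
    disc≢0 : disc z ≢ 0#
    disc≢0 = xy≡1⇒x≢0 (trans (*-comm _ _) re≡1)
    no-root : ¬ (∃ λ θ → disc z ≡ (θ ^ 3) + (θ ^ 2))
    no-root (θ , root) = Tr≢0 (trans (cong (Tr n) (I.root-℘ u θ (θ ⁻¹) θτ≡1 σ²)) (Tr-℘≡0 (u * θ ⁻¹)))
      where
      θτ≡1 : θ * θ ⁻¹ ≡ 1#
      θτ≡1 = ⁻¹-inverse (λ θ≡0 → disc≢0 (trans root (S.root-zero θ θ≡0)))
        where module S = StabiliserIdentities field' char3
      σ² : (u * θ ⁻¹) * (u * θ ⁻¹) ≡ θ + 1#
      σ² = I.root-square u θ (θ ⁻¹) (disc z) θτ≡1 (I.inverse-square r (disc z) s u re≡1 s²≡r su≡1) root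

  J₄⇒stabiliser : ∀ {r} → J₄ n r → ∀ z → r * disc z ≡ 1# → ClassCount _∝_ (Stabilises z) 4
  J₄⇒stabiliser {r} (r≢0 , s , u , s²≡r , su≡1 , Tr≡0) z re≡1 =
    stabiliser-4 (xy≡1⇒x≢0 (trans (*-comm _ _) re≡1)) _ (I.℘-root u (proj₁ u≡℘) (disc z) (proj₂ u≡℘) u²≡e) (u , u²≡e)
    where
    u≡℘ = Tr≡0⇒℘ u Tr≡0
    u²≡e = I.inverse-square r (disc z) s u re≡1 s²≡r su≡1

  J₂⇒stabiliser : ∀ {r} → J₂ r → ∀ z → r * disc z ≡ 1# → ClassCount _∝_ (Stabilises z) 2
  J₂⇒stabiliser {r} (r≢0 , nonsquare) z re≡1 =
    stabiliser-2 (xy≡1⇒x≢0 (trans (*-comm _ _) re≡1)) (φ ⁻¹)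
      (I.reciprocal-root r (disc z) φ (φ ⁻¹) re≡1 (⁻¹-inverse φ≢0) φ-eq)
      (λ (s , s²≡e) → nonsquare (r * s , I.square-inverse r (disc z) s re≡1 s²≡e))
    where
    -- φ ↦ φ³ − rφ is additive, with trivial kernel because r is not a square.
    additive-injective : ∀ {x y} → (x ^ 3) - r * x ≡ (y ^ 3) - r * y → x ≡ y
    additive-injective {x} {y} eq = [ Char3Solver.x-y≡0⇒x≡y char3 ,
      (λ e → contradiction (x - y , Char3Solver.x-y≡0⇒x≡y char3 e) nonsquare) ]′ (x*y≡0⇒ (I.additive-split r x y eq))
    preimage = injective⇒surjective (λ x → (x ^ 3) - r * x) additive-injective r
    φ = proj₁ preimage
    φ-eq = proj₂ preimage
    φ≢0 : φ ≢ 0#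
    φ≢0 φ≡0 = r≢0 (I.additive-zero r φ φ≡0 φ-eq)

  inverse-unique : ∀ {r x y} → r * x ≡ 1# → r * y ≡ 1# → y ≡ x
  inverse-unique {r} {x} {y} = I.inverse-same r x y

  record Normalised (L : Line) : Set where
    field
      z       : Quartic
      L≃z     : L ≃ z
      disc≢0  : disc z ≢ 0#
      JEq⇒    : ∀ {r} → JEq (fL L) r → r * disc z ≡ 1#
      ⇒JEq    : ∀ {r} → r * disc z ≡ 1# → JEq (fL L) r

  module _ (K : Field) (ι : FieldHom field' K) where
    open FieldHom ι using (map; map-+; map-*)
    open FieldHomProperties ι char3 using (char3ᴷ)
    private module K = FieldProperties K

    map-InSpan : ∀ x y {z} → InSpan x y z → K.InSpan (mapV4 map x) (mapV4 map y) (mapV4 map z)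
    map-InSpan ⟨ x0 , x1 , x2 , x3 ⟩ ⟨ y0 , y1 , y2 , y3 ⟩ (α , β , refl) =
      map α , map β , V4-≡ (homo x0 y0) (homo x1 y1) (homo x2 y2) (homo x3 y3)
      where
      homo : ∀ x y → map (α * x + β * y) ≡ map α K.* map x K.+ map β K.* map y
      homo x y = trans (map-+ _ _) (cong₂ K._+_ (map-* α x) (map-* β y))

    meets-resp : ∀ {L M} → SameLine L M → MeetsCurveOver K ι M → MeetsCurveOver K ι L
    meets-resp {L} (P , Q) (s , t , st≢0 , on) = s , t , st≢0 ,
      LinearAlgebra.InSpan-trans K char3ᴷ (map-InSpan (Line.p₁ L) (Line.p₂ L) P , map-InSpan (Line.p₁ L) (Line.p₂ L) Q) on

  normalised : ∀ L → Generic L → Normalised L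
  normalised L generic@(no-meet , _) = record
    { z = z ; L≃z = L≃z ; disc≢0 = disc≢0
    ; JEq⇒ = λ {r} J → proj₂ (formOf-JEq k≢0 (subst (λ f → JEq f r) fL≡ J))
    ; ⇒JEq = λ {r} eq → subst (λ f → JEq f r) (sym fL≡) (JEq-formOf k≢0 disc≢0 eq) }
    where
    k≢0 = generic⇒p03≢0 L generic
    nf = normal-form L k≢0
    z = proj₁ nf
    L≃z = proj₁ (proj₂ nf)
    fL≡ = proj₂ (proj₂ nf)
    disc≢0 : disc z ≢ 0#
    disc≢0 disc≡0 = let (K , ι , meets) = disc≡0⇒Meets z disc≡0 in
      no-meet K ι (meets-resp K ι {L} {lineOf z} L≃z meets)

  GenericWith : Carrier → Line → Set₁
  GenericWith r L = Generic L × JEq (fL L) r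

  Orbit⇒r≡ : ∀ {r r′ L M} → GenericWith r L → GenericWith r′ M → Orbit L M → r ≡ r′
  Orbit⇒r≡ {r} {r′} {L} {M} (GL , JL) (GM , JM) orbit =
    inverse-unique {disc NM.z} (trans (*-comm _ _) (NM.JEq⇒ JM))
      (trans (*-comm _ _) (trans (cong (r *_) disc≡) (NL.JEq⇒ JL)))
    where
    module NL = Normalised (normalised L GL)
    module NM = Normalised (normalised M GM)
    disc≡ : disc NM.z ≡ disc NL.z
    disc≡ = let (g , g≢0 , G) = Orbit⇒∼ {L} {M} {NL.z} {NM.z} NL.L≃z NM.L≃z orbit in Acts⇒disc-≡ {g} {NL.z} {NM.z} g≢0 G

  record Sizes : Set where
    field
      g         : ℕ
      g≢0       : g ≢ 0
      order≡4*g : group-order ≡ 4 ℕ.* g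

  sizes : Sizes
  sizes = let (g , g≢0 , order≡) = order-divisible-by-4 q-1 (proj₁ J₂-count) m q (proj₁ (proj₂ nonzero-count))
                                     (proj₁ (proj₂ J₂-count)) q≡3ⁿ
          in record { g = g ; g≢0 = g≢0 ; order≡4*g = order≡ }

  open Sizes sizes

  order/1 : ∣G∣ ℕ./ 1 ≡ 4 ℕ.* g
  order/1 = trans (ℕ.n/1≡n ∣G∣) (trans (sym group-order≡) order≡4*g)

  order/2 : ∣G∣ ℕ./ 2 ≡ 2 ℕ.* g
  order/2 = trans (cong (ℕ._/ 2) (trans (sym group-order≡) (trans order≡4*g
    (trans (ℕ.*-assoc 2 2 g) (ℕ.*-comm 2 (2 ℕ.* g)))))) (ℕ.m*n/n≡m (2 ℕ.* g) 2)

  order/4 : ∣G∣ ℕ./ 4 ≡ g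
  order/4 = trans (cong (ℕ._/ 4) (trans (sym group-order≡) (trans order≡4*g (ℕ.*-comm 4 g)))) (ℕ.m*n/n≡m g 4)

  0<order : 0 ℕ.< group-order
  0<order = ℕ.n≢0⇒n>0 (λ eq → g≢0 (ℕ.*-cancelˡ-≡ g 0 4 (trans (sym order≡4*g) (trans eq (sym (ℕ.*-zeroʳ 4))))))

  orbit-data : ∀ i .{{_ : NonZero i}} {r} → r ≢ 0# →
    (∀ z → r * disc z ≡ 1# → ClassCount _∝_ (Stabilises z) i) → OrbitData i r
  orbit-data i {r} r≢0 stabiliser =
    ClassCount-image′ lineOf sound
      (λ {z} {y} _ _ orbit → Orbit⇒∼ {lineOf z} {lineOf y} Spans-refl′ Spans-refl′ orbit)
      onto (orbit-count i e e≢0 stabiliser′ 0<order) ,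
    orbits
    where
    e = r ⁻¹
    e≢0 = ⁻¹≢0 r≢0
    re≡1 = ⁻¹-inverse r≢0
    Spans-refl′ : ∀ {z} → lineOf z ≃ z
    Spans-refl′ {z} = SameLine.refl {lineOf z}
    inverts : ∀ {z} → disc z ≡ e → r * disc z ≡ 1#
    inverts disc≡e = trans (cong (r *_) disc≡e) re≡1
    stabiliser′ : ∀ z → disc z ≡ e → ClassCount _∝_ (Stabilises z) i
    stabiliser′ z disc≡e = stabiliser z (inverts disc≡e)
    sound : ∀ {z} → disc z ≡ e → GenericWith r (lineOf z)
    sound {z} disc≡e = lineOf-generic z disc≢0 ,
      subst (λ f → JEq f r) (sym (fL-lineOf z)) (JEq-formOf (0≢1 ∘ sym) disc≢0 (inverts disc≡e))
      where
      disc≢0 : disc z ≢ 0#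
      disc≢0 = subst (_≢ 0#) (sym disc≡e) e≢0
    onto : ∀ L → GenericWith r L → ∃ λ z → disc z ≡ e × (∀ {y} → disc y ≡ e → z ∼ y → Orbit L (lineOf y))
    onto L (generic , J) = z , inverse-unique re≡1 (JEq⇒ J) , λ {y} _ z∼y → ∼⇒Orbit {L} {lineOf y} L≃z Spans-refl′ z∼y
      where open Normalised (normalised L generic)
    orbits : ∀ L → Generic L → JEq (fL L) r → ClassCount SameLine (Orbit L) (∣G∣ ℕ./ i)
    orbits L generic J = subst (λ N → ClassCount SameLine (Orbit L) (N ℕ./ i)) group-order≡
      (ClassCount-image′ lineOf
        (λ {y} z∼y → ∼⇒Orbit {L} {lineOf y} L≃z Spans-refl′ z∼y)
        (λ {y} {y′} _ _ → lineOf-injective y y′)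
        (λ M orbit → let (y , z∼y , M≃y) = Orbit⇒≃ {L} {M} L≃z orbit in y , z∼y , λ { _ refl → M≃y })
        (orbit-size′ i e e≢0 stabiliser′ z (inverse-unique re≡1 (JEq⇒ J))))
      where open Normalised (normalised L generic)

  orbit-data₁ : ∀ r → J₁ n r → OrbitData 1 r
  orbit-data₁ r J = orbit-data 1 (proj₁ J) (J₁⇒stabiliser J)

  orbit-data₂ : ∀ r → J₂ r → OrbitData 2 r
  orbit-data₂ r J = orbit-data 2 (proj₁ J) (J₂⇒stabiliser J)

  orbit-data₄ : ∀ r → J₄ n r → OrbitData 4 r
  orbit-data₄ r J = orbit-data 4 (proj₁ J) (J₄⇒stabiliser J)

  classify : ∀ r → r ≢ 0# → J₁ n r ⊎ J₂ r ⊎ J₄ n r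
  classify r r≢0 = by-square (∃? (λ s → s * s ≟ r))
    where
    by-trace : ∀ s → s * s ≡ r → (s≢0 : s ≢ 0#) → Dec (Tr n (s ⁻¹) ≡ 0#) → J₁ n r ⊎ J₂ r ⊎ J₄ n r
    by-trace s s²≡r s≢0 (yes Tr≡0) = inj₂ (inj₂ (r≢0 , s , s ⁻¹ , s²≡r , ⁻¹-inverse s≢0 , Tr≡0))
    by-trace s s²≡r s≢0 (no Tr≢0)  = inj₁ (r≢0 , s , s ⁻¹ , s²≡r , ⁻¹-inverse s≢0 , Tr≢0)
    by-square : Dec (∃ λ s → s * s ≡ r) → J₁ n r ⊎ J₂ r ⊎ J₄ n r
    by-square (no nonsquare)   = inj₂ (inj₁ (r≢0 , nonsquare))
    by-square (yes (s , s²≡r)) = by-trace s s²≡r (xy≢0⇒x≢0 (subst (_≢ 0#) (sym s²≡r) r≢0)) (Tr n (s ⁻¹) ≟ 0#)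

  invariant : ∀ L → Generic L → ∃ λ r → JEq (fL L) r × (J₁ n r ⊎ J₂ r ⊎ J₄ n r)
  invariant L generic = disc z ⁻¹ , ⇒JEq (trans (*-comm _ _) (⁻¹-inverse disc≢0)) , classify _ (⁻¹≢0 disc≢0)
    where open Normalised (normalised L generic)

  -- √r is determined up to sign only, and the vanishing of the trace does not change under u ↦ -u.
  J₁-J₄-disjoint : ∀ {r} → J₁ n r → ¬ J₄ n r
  J₁-J₄-disjoint (_ , s , u , s²≡r , su≡1 , Tr≢0) (_ , s′ , u′ , s′²≡r , s′u′≡1 , Tr≡0) =
    [ (λ s≡s′ → Tr≢0 (subst (λ x → Tr n x ≡ 0#)
                        (I.inverse-same s′ u u′ (subst (λ x → x * u ≡ 1#) s≡s′ su≡1) s′u′≡1) Tr≡0))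
    , (λ s≡-s′ → Tr≢0 (subst (λ x → Tr n x ≡ 0#)
                        (sym (I.inverse-neg s′ u′ u s′u′≡1 (subst (λ x → x * u ≡ 1#) s≡-s′ su≡1))) (Tr-neg Tr≡0))) ]′
    (x²≡y²⇒ (trans s²≡r (sym s′²≡r)))

  J₁-J₂-disjoint : ∀ {r} → J₁ n r → ¬ J₂ r
  J₁-J₂-disjoint (_ , s , _ , s²≡r , _) (_ , nonsquare) = nonsquare (s , s²≡r)

  J₂-J₄-disjoint : ∀ {r} → J₂ r → ¬ J₄ n r
  J₂-J₄-disjoint (_ , nonsquare) (_ , s , _ , s²≡r , _) = nonsquare (s , s²≡r)

  GenericIn : (Carrier → Set) → Line → Set₁
  GenericIn J L = ∃ λ r → J r × GenericWith r L

  count-in : ∀ {J k} i .{{_ : NonZero i}} → ClassCount _≡_ J k → (∀ r → J r → OrbitData i r) →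
             ClassCount Orbit (GenericIn J) (k ℕ.* i)
  count-in i count orbit-data = ClassCount-fibres (λ { refl → id })
    (λ {r} {r′} {L} {M} _ _ → Orbit⇒r≡ {r} {r′} {L} {M}) count (λ r J → proj₁ (orbit-data r J))

  disjoint-in : ∀ J J′ → (∀ {r} → J r → ¬ J′ r) → ∀ {L M} → GenericIn J L → GenericIn J′ M → ¬ Orbit L M
  disjoint-in J J′ J-J′ {L} {M} (r , Jr , GL) (r′ , J′r′ , GM) orbit =
    J-J′ Jr (subst J′ (sym (Orbit⇒r≡ {r} {r′} {L} {M} GL GM orbit)) J′r′)

  k₁ k₂ k₄ : ℕ
  k₁ = proj₁ J₁-count
  k₂ = proj₁ J₂-count
  k₄ = proj₁ J₄-count

  -- Subtraction of natural numbers truncates. For `k₄*4≡` and `total≡` the quantities are expressed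
  -- through k₄, with 3^m = 2k₄ + 1 and q = 6k₄ + 3, so that subtraction becomes cancellation of a
  -- summand.
  T≡ : 3 ℕ.^ m ≡ suc (k₄ ℕ.* 2)
  T≡ = sym (proj₁ (proj₂ J₄-count))

  q≡ : q ≡ 3 ℕ.* suc (k₄ ℕ.* 2)
  q≡ = trans q≡3ⁿ (cong (3 ℕ.*_) T≡)

  k₁≡ : k₁ ≡ 3 ℕ.^ m
  k₁≡ = ℕ.*-cancelʳ-≡ k₁ (3 ℕ.^ m) 2 (ℕ.+-cancelˡ-≡ (3 ℕ.^ m) _ _ (trans (proj₁ (proj₂ J₁-count))
    (cong (3 ℕ.^ m ℕ.+_) (ℕ.*-comm 2 (3 ℕ.^ m)))))

  k₁*1≡ : k₁ ℕ.* 1 ≡ q ℕ./ 3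
  k₁*1≡ = trans (ℕ.*-identityʳ k₁) (trans k₁≡ (sym (trans (cong (ℕ._/ 3) (trans q≡3ⁿ (ℕ.*-comm 3 (3 ℕ.^ m)))) (ℕ.m*n/n≡m (3 ℕ.^ m) 3))))

  k₂*2≡ : k₂ ℕ.* 2 ≡ q ℕ.∸ 1
  k₂*2≡ = cong (ℕ._∸ 1) (proj₁ (proj₂ J₂-count))

  k₄*4≡ : k₄ ℕ.* 4 ≡ (2 ℕ.* q ℕ.∸ 6) ℕ./ 3
  k₄*4≡ = sym (trans (cong (ℕ._/ 3) 2q-6≡) (ℕ.m*n/n≡m (k₄ ℕ.* 4) 3))
    where
    2q-6≡ : 2 ℕ.* q ℕ.∸ 6 ≡ k₄ ℕ.* 4 ℕ.* 3
    2q-6≡ = trans (cong (ℕ._∸ 6) (trans (cong (2 ℕ.*_) q≡)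
      (+-*-Solver.solve 1 (λ k → con 2 :* (con 3 :* (con 1 :+ k :* con 2)) := k :* con 4 :* con 3 :+ con 6) refl k₄)))
      (ℕ.m+n∸n≡m (k₄ ℕ.* 4 ℕ.* 3) 6)
      where open +-*-Solver

  total≡ : k₁ ℕ.* 1 ℕ.+ (k₂ ℕ.* 2 ℕ.+ k₄ ℕ.* 4) ≡ 2 ℕ.* q ℕ.∸ 3
  total≡ = begin
    k₁ ℕ.* 1 ℕ.+ (k₂ ℕ.* 2 ℕ.+ k₄ ℕ.* 4) ≡⟨ ℕ.m+n∸n≡m _ 3 ⟨
    k₁ ℕ.* 1 ℕ.+ (k₂ ℕ.* 2 ℕ.+ k₄ ℕ.* 4) ℕ.+ 3 ℕ.∸ 3
      ≡⟨ cong (ℕ._∸ 3) (cong₂ (λ a b → a ℕ.+ (b ℕ.+ k₄ ℕ.* 4) ℕ.+ 3)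
           (trans (ℕ.*-identityʳ k₁) (trans k₁≡ T≡)) (trans k₂*2≡ (cong (ℕ._∸ 1) q≡))) ⟩
    suc (k₄ ℕ.* 2) ℕ.+ ((k₄ ℕ.* 2 ℕ.+ 2 ℕ.* suc (k₄ ℕ.* 2)) ℕ.+ k₄ ℕ.* 4) ℕ.+ 3 ℕ.∸ 3
      ≡⟨ cong (ℕ._∸ 3) (+-*-Solver.solve 1 (λ k → let t = con 1 :+ k :* con 2 in
           t :+ ((k :* con 2 :+ con 2 :* t) :+ k :* con 4) :+ con 3 := con 2 :* (con 3 :* t)) refl k₄) ⟩
    2 ℕ.* (3 ℕ.* suc (k₄ ℕ.* 2)) ℕ.∸ 3 ≡⟨ cong (λ x → 2 ℕ.* x ℕ.∸ 3) q≡ ⟨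
    2 ℕ.* q ℕ.∸ 3 ∎
    where
    open ≡-Reasoning
    open +-*-Solver

  count₁ : ClassCount Orbit (GenericIn (J₁ n)) (k₁ ℕ.* 1)
  count₁ = count-in 1 (proj₂ (proj₂ J₁-count)) orbit-data₁

  count₂ : ClassCount Orbit (GenericIn J₂) (k₂ ℕ.* 2)
  count₂ = count-in 2 (proj₂ (proj₂ J₂-count)) orbit-data₂

  count₄ : ClassCount Orbit (GenericIn (J₄ n)) (k₄ ℕ.* 4)
  count₄ = count-in 4 (proj₂ (proj₂ J₄-count)) orbit-data₄

  generic-count : ClassCount Orbit Generic (2 ℕ.* q ℕ.∸ 3)
  generic-count = subst (ClassCount Orbit Generic) total≡
    (ClassCount-resp
      [ (λ (_ , _ , G , _) → G) , [ (λ (_ , _ , G , _) → G) , (λ (_ , _ , G , _) → G) ]′ ]′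
      (λ {L} G → let (r , JL , cases) = invariant L G in
        [ (λ J → inj₁ (r , J , G , JL)) , [ (λ J → inj₂ (inj₁ (r , J , G , JL))) , (λ J → inj₂ (inj₂ (r , J , G , JL))) ]′ ]′ cases)
      (ClassCount-⊎ (λ {L} {M} G → [ disjoint-in (J₁ n) J₂ J₁-J₂-disjoint {L} {M} G , disjoint-in (J₁ n) (J₄ n) J₁-J₄-disjoint {L} {M} G ]′) count₁
        (ClassCount-⊎ (λ {L} {M} → disjoint-in J₂ (J₄ n) J₂-J₄-disjoint {L} {M}) count₂ count₄)))

  multiples-distinct : ∀ {a b} → a ≢ b → a ℕ.* g ≢ b ℕ.* g
  multiples-distinct {a} {b} a≢b eq = a≢b (ℕ.*-cancelʳ-≡ a b g {{ℕ.≢-nonZero g≢0}} eq)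

  orders-distinct : ∀ a b {x y} → x ≡ a ℕ.* g → y ≡ b ℕ.* g → a ≢ b → x ≢ y
  orders-distinct a b x≡ y≡ a≢b x≡y = multiples-distinct {a} {b} a≢b (trans (sym x≡) (trans x≡y y≡))

  order/4′ : ∣G∣ ℕ./ 4 ≡ 1 ℕ.* g
  order/4′ = trans order/4 (sym (ℕ.*-identityˡ g))

  HasSize : Line → ℕ → Set
  HasSize L N = ClassCount SameLine (Orbit L) N

  has-size : ∀ {J : Carrier → Set} i .{{_ : NonZero i}} → (∀ r → J r → OrbitData i r) →
             ∀ {L r} → Generic L → JEq (fL L) r → J r → HasSize L (∣G∣ ℕ./ i)
  has-size i data-i {L} {r} G JL J = proj₂ (data-i r J) L G JL

  -- A generic line outside class J has an orbit of one of the other two sizes; since the size of an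
  -- orbit is unique and the sizes differ, having size |G|/i characterises the class.
  orbits-of-size : ∀ {J : Carrier → Set} i .{{_ : NonZero i}} → (∀ r → J r → OrbitData i r) →
    (∀ L r → Generic L → JEq (fL L) r → J r ⊎ ∃ λ N → ∣G∣ ℕ./ i ≢ N × HasSize L N) →
    ∀ {k} → ClassCount Orbit (GenericIn J) k → OrbitsOfSize (∣G∣ ℕ./ i) k
  orbits-of-size i data-i others = ClassCount-resp
    (λ {L} (r , J , G , JL) → G , has-size i data-i {L} {r} G JL J)
    (λ {L} (G , size) → let (r , JL , _) = invariant L G in
      [ (λ J → r , J , G , JL)
      , (λ (N , ≢N , size′) → contradiction (ClassCount-unique SameLine-isEquivalence size size′) ≢N) ]′ (others L r G JL))

  invariant-class : ∀ L r → Generic L → JEq (fL L) r → J₁ n r ⊎ J₂ r ⊎ J₄ n r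
  invariant-class L r G JL = classify r (xy≡1⇒x≢0 (Normalised.JEq⇒ (normalised L G) JL))

  orbits-of-size₁ : OrbitsOfSize ∣G∣ (q ℕ./ 3)
  orbits-of-size₁ = subst₂ OrbitsOfSize (ℕ.n/1≡n ∣G∣) k₁*1≡ (orbits-of-size 1 orbit-data₁
    (λ L r G JL →
      [ inj₁
      , [ (λ J → inj₂ (_ , orders-distinct 4 2 order/1 order/2 (λ ()) , has-size 2 orbit-data₂ {L} {r} G JL J))
        , (λ J → inj₂ (_ , orders-distinct 4 1 order/1 order/4′ (λ ()) , has-size 4 orbit-data₄ {L} {r} G JL J)) ]′ ]′
      (invariant-class L r G JL))
    count₁)

  orbits-of-size₂ : OrbitsOfSize (∣G∣ ℕ./ 2) (q ℕ.∸ 1)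
  orbits-of-size₂ = subst (OrbitsOfSize (∣G∣ ℕ./ 2)) k₂*2≡ (orbits-of-size 2 orbit-data₂
    (λ L r G JL →
      [ (λ J → inj₂ (_ , orders-distinct 2 4 order/2 order/1 (λ ()) , has-size 1 orbit-data₁ {L} {r} G JL J))
      , [ inj₁
        , (λ J → inj₂ (_ , orders-distinct 2 1 order/2 order/4′ (λ ()) , has-size 4 orbit-data₄ {L} {r} G JL J)) ]′ ]′
      (invariant-class L r G JL))
    count₂)

  orbits-of-size₄ : OrbitsOfSize (∣G∣ ℕ./ 4) ((2 ℕ.* q ℕ.∸ 6) ℕ./ 3)
  orbits-of-size₄ = subst (OrbitsOfSize (∣G∣ ℕ./ 4)) k₄*4≡ (orbits-of-size 4 orbit-data₄
    (λ L r G JL →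
      [ (λ J → inj₂ (_ , orders-distinct 1 4 order/4′ order/1 (λ ()) , has-size 1 orbit-data₁ {L} {r} G JL J))
      , [ (λ J → inj₂ (_ , orders-distinct 1 2 order/4′ order/2 (λ ()) , has-size 2 orbit-data₂ {L} {r} G JL J))
        , inj₁ ]′ ]′
      (invariant-class L r G JL))
    count₄)

-- Excludes n = 0, after which n = m + 1 and the trace polynomial has degree 3^m.
q≢1 : (FF : FiniteField) → Char3 FF → FiniteField.q FF ≢ 1
q≢1 FF char3 q≡1 = from-count nonzero-count
  where
  open Char3FiniteField FF char3
  from-count : (∃ λ k → suc k ≡ q × ClassCount _≡_ (_≢ 0#) k) → ⊥
  from-count (suc k , 1+k≡q , _) = ℕ.1+n≢0 (ℕ.suc-injective (trans 1+k≡q q≡1))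
  from-count (zero , _ , [] , _ , _ , _ , all) with all 1# (0≢1 ∘ sym)
  ... | ()

theorem1p6 : (F : FiniteField) (n : ℕ) →
    FiniteField.q F ≡ 3 ℕ.^ n → Char3 F →
    let open PG3 F in
    ((r : Carrier) → J₁ n r → OrbitData 1 r) ×
    ((r : Carrier) → J₂ r → OrbitData 2 r) ×
    ((r : Carrier) → J₄ n r → OrbitData 4 r) ×
    ((L : Line) → Generic L →
       ∃ λ r → JEq (fL L) r × (J₁ n r ⊎ J₂ r ⊎ J₄ n r)) ×
    ClassCount Orbit Generic (2 ℕ.* q ℕ.∸ 3) ×
    OrbitsOfSize ∣G∣ (q ℕ./ 3) ×
    OrbitsOfSize (∣G∣ ℕ./ 2) (q ℕ.∸ 1) ×
    OrbitsOfSize (∣G∣ ℕ./ 4) ((2 ℕ.* q ℕ.∸ 6) ℕ./ 3)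
theorem1p6 F zero    q≡1 char3 = contradiction q≡1 (q≢1 F char3)
theorem1p6 F (suc m) q≡3ⁿ char3 =
  orbit-data₁ , orbit-data₂ , orbit-data₄ , invariant , generic-count ,
  orbits-of-size₁ , orbits-of-size₂ , orbits-of-size₄
  where open Classification F char3 m q≡3ⁿ
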